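{- Let $(I,J)\in\mathfrak{S}_{n,k}$ be a partial permutation of $[n]$ of size $k$, and write the atomic symmetric function in the Schur basis as $A_{n,I,J}=\sum_{\lambda\vdash n} b_\lambda s_\lambda$. Then $b_\lambda=0$ unless $\lambda_1\ge n-k$.
   Context: A partial permutation of size $k$ of $[n]$ is a pair $(I,J)$ of length-$k$ sequences $I=(i_1,\dots,i_k)$, $J=(j_1,\dots,j_k)$, each consisting of distinct elements of $[n]$ (up to simultaneous permutation of entries); $\mathfrak{S}_{n,k}$ is the set of these. For $w\in\mathfrak{S}_n$ write $w(I)=J$ if $w(i_t)=j_t$ for all $t$. The atomic symmetric function is $A_{n,I,J}=\sum_{\lambda\vdash n} a_\lambda p_\lambda$, where $a_\lambda$ is the number of permutations $w\in\mathfrak{S}_n$ of cycle type $\lambda$ with $w(I)=J$ and $p_\lambda$ is a power sum symmetric function; $s_\lambda$ denotes the Schur function. -}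

module Defs where

open import Data.Nat using (ℕ; zero; suc; _+_; _∸_; _<ᵇ_; _≤ᵇ_; _⊔_; _⊓_)
open import Data.Bool using (Bool; true; false; _∧_; if_then_else_)
open import Data.Fin using (Fin; toℕ)
open import Data.Maybe using (Maybe; just; nothing; fromMaybe)
open import Data.Vec as V using (Vec; []; _∷_; lookup; tabulate)
open import Data.List as L using (List; []; _∷_; allFin; upTo; concatMap; length; take)
open import Data.Nat.ListAction using (sum)

allVecs : (m n : ℕ) → List (Vec (Fin n) m)
allVecs zero n = [] ∷ []
allVecs (suc m) n = concatMap (λ i → L.map (i ∷_) (allVecs m n)) (allFin n)

countB : {A : Set} → (A → Bool) → List A → ℕ
countB p [] = 0
countB p (x ∷ xs) = if p x then suc (countB p xs) else countB p xs

allB : {A : Set} → (A → Bool) → List A → Bool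
allB p [] = true
allB p (x ∷ xs) = p x ∧ allB p xs

_==ᶠ_ : {n : ℕ} → Fin n → Fin n → Bool
i ==ᶠ j = toℕ i Data.Nat.≡ᵇ toℕ j

vecEqB : {n : ℕ} → Vec ℕ n → Vec ℕ n → Bool
vecEqB [] [] = true
vecEqB (x ∷ xs) (y ∷ ys) = (x Data.Nat.≡ᵇ y) ∧ vecEqB xs ys

nth : {A : Set} → List A → ℕ → Maybe A
nth [] _ = nothing
nth (x ∷ xs) zero = just x
nth (x ∷ xs) (suc r) = nth xs r

isPermB : {n : ℕ} → Vec (Fin n) n → Bool
isPermB {n} w = allB (λ i → allB (λ j → if lookup w i ==ᶠ lookup w j then i ==ᶠ j else true)
                                 (allFin n)) (allFin n)

mapsB : {n k : ℕ} → Vec (Fin n) n → Vec (Fin n) k → Vec (Fin n) k → Bool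
mapsB w [] [] = true
mapsB w (i ∷ I) (j ∷ J) = (lookup w i ==ᶠ j) ∧ mapsB w I J

iter : {n : ℕ} → Vec (Fin n) n → ℕ → Fin n → Fin n
iter w zero i = i
iter w (suc m) i = lookup w (iter w m i)

cycleLen : {n : ℕ} → Vec (Fin n) n → Fin n → ℕ
cycleLen {n} w i = go n 1
  where
  go : ℕ → ℕ → ℕ
  go zero m = 0
  go (suc f) m = if iter w m i ==ᶠ i then m else go f (suc m)

isCycleMin : {n : ℕ} → Vec (Fin n) n → Fin n → Bool
isCycleMin {n} w i = allB (λ m → toℕ i ≤ᵇ toℕ (iter w m i)) (upTo n)

-- cycle type of w: the multiset of cycle lengths (one entry per cycle),
-- listed as a list of parts (order irrelevant for power sums p_λ)
cycleType : {n : ℕ} → Vec (Fin n) n → List ℕ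
cycleType {n} w = go (allFin n)
  where
  go : List (Fin n) → List ℕ
  go [] = []
  go (i ∷ is) = if isCycleMin w i then cycleLen w i ∷ go is else go is

-- Symmetric functions of degree n, represented in n variables x_0..x_{n-1}
-- by their monomial coefficients: a coefficient function Vec ℕ n → ℕ/ℤ,
-- α ↦ coefficient of x^α.

-- p_μ = ∏_j p_{μ_j} = ∏_j Σ_i x_i^{μ_j}; a term is a choice c_j ∈ [n] for each part,
-- giving the monomial with exponent vector weight μ c.
weight : {n : ℕ} → (μ : List ℕ) → Vec (Fin n) (length μ) → Vec ℕ n
weight {n} [] [] = V.replicate n 0
weight (m ∷ μ) (c ∷ cs) = tabulate (λ i → (if c ==ᶠ i then m else 0) + lookup (weight μ cs) i)

pCoef : (n : ℕ) → List ℕ → Vec ℕ n → ℕ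
pCoef n μ α = countB (λ c → vecEqB (weight μ c) α) (allVecs (length μ) n)

aCoef : (n k : ℕ) → Vec (Fin n) k → Vec (Fin n) k → Vec ℕ n → ℕ
aCoef n k I J α = go (allVecs n n)
  where
  go : List (Vec (Fin n) n) → ℕ
  go [] = 0
  go (w ∷ ws) = (if isPermB w ∧ mapsB w I J then pCoef n (cycleType w) α else 0) + go ws

partsLE : ℕ → ℕ → ℕ → List (List ℕ)    -- fuel, size, max part
partsLE _ zero _ = [] ∷ []
partsLE zero (suc _) _ = []
partsLE (suc f) (suc n) m =
  concatMap (λ p → L.map (p ∷_) (partsLE f (suc n ∸ p) p)) (L.map suc (upTo (suc n ⊓ m)))

partitions : ℕ → List (List ℕ)
partitions n = partsLE n n n

-- λ_r (0 if r ≥ ℓ(λ)); λ_1 is partAt λ 0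
partAt : List ℕ → ℕ → ℕ
partAt sh r = fromMaybe 0 (nth sh r)

-- Schur functions via semistandard Young tableaux.
-- A filling of shape λ with entries in [n] is a list T listing the entries
-- row by row (row r, column c is at position λ_0+…+λ_{r-1}+c).

entry : {n : ℕ} → List ℕ → List (Fin n) → ℕ → ℕ → Maybe (Fin n)
entry sh T r c = nth T (sum (take r sh) + c)

leM : {n : ℕ} → Maybe (Fin n) → Maybe (Fin n) → Bool
leM (just a) (just b) = toℕ a ≤ᵇ toℕ b
leM _ _ = false

ltM : {n : ℕ} → Maybe (Fin n) → Maybe (Fin n) → Bool
ltM (just a) (just b) = toℕ a <ᵇ toℕ b
ltM _ _ = false

isSSYT : {n : ℕ} → List ℕ → List (Fin n) → Bool
isSSYT sh T =
  allB (λ r → allB (λ c → if suc c <ᵇ partAt sh r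
                            then leM (entry sh T r c) (entry sh T r (suc c)) else true)
                   (upTo (partAt sh r)))
       (upTo (length sh))
  ∧ allB (λ r → allB (λ c → ltM (entry sh T r c) (entry sh T (suc r) c))
                     (upTo (partAt sh (suc r))))
         (upTo (length sh))

content : {n : ℕ} → List (Fin n) → Vec ℕ n
content {n} T = tabulate (λ i → countB (λ t → t ==ᶠ i) T)

sCoef : (n : ℕ) → List ℕ → Vec ℕ n → ℕ
sCoef n sh α = countB (λ T → isSSYT sh T ∧ vecEqB (content T) α)
                     (L.map V.toList (allVecs (sum sh) n))

{-# OPTIONS --safe #-}

-- The involution ω sends s_λ to s_λ' and w ↦ p_cyc(w) to ±p_cyc(w). In m - 1 variables, m = n - k, the
-- image of the atomic function is Σ_d x^d Σ_w sgn(w), over colourings d of [n] with m - 1 colours and over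
-- the w with w(I) = J that preserve d. Two of the m points outside I share a colour, and composing with
-- their transposition reverses signs, so this vanishes; but the s_λ' with λ_1 < m are linearly independent
-- in m - 1 variables. Since only coefficients of monomials are available, ω is replaced by the functionals
-- f ↦ ⟨f, e_β⟩, obtained from the coefficients ⟨f, h_α⟩ by the recursion Σ_i (-1)^i e_{r-i} h_i = 0. For β
-- the conjugate of a partition κ they are triangular on Schur functions in the lexicographic order.
module Submission where

open import Defs
open import Data.Nat using (ℕ; zero; suc; pred; _<_; _≤_; _∸_; z≤n; s≤s; _≟_; _≤?_; _<?_; _⊓_; _≡ᵇ_)
import Data.Nat as ℕ
import Data.Nat.Properties as ℕₚ
open import Data.Nat.DivMod using (_%_; _/_; m%n<n; m≡m%n+[m/n]*n)
open import Data.Nat.ListAction using (sum)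
open import Data.Nat.ListAction.Properties using (sum-++)
open import Data.Integer using (ℤ; +_; -[1+_]; _*_; _+_; 0ℤ; 1ℤ)
import Data.Integer as ℤ
import Data.Integer.Properties as ℤₚ
open import Data.Integer.Tactic.RingSolver using (solve-∀)
open import Data.Bool using (Bool; true; false; _∧_; if_then_else_; T; T?)
open import Data.Empty using (⊥; ⊥-elim)
open import Data.Unit using (⊤; tt)
open import Data.Product using (∃; ∃₂; _×_; _,_; proj₁; proj₂)
open import Data.Sum using (_⊎_; inj₁; inj₂; [_,_]′)
open import Data.Sum.Properties using (inj₂-injective)
open import Data.Maybe as Maybe using (Maybe; just; nothing)
open import Data.Fin as F using (Fin; zero; suc; toℕ; fromℕ<)
import Data.Fin.Properties as Fₚ
open import Data.Vec as V using (Vec; []; _∷_; lookup)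
import Data.Vec.Properties as Vₚ
open import Data.List using (List; []; _∷_; _++_; map; concatMap; filter; foldr; length; replicate; take; drop; tabulate; allFin; upTo; applyUpTo)
open import Data.List.Properties
  using (upTo-∷ʳ; map-upTo; map-tabulate; length-++; length-map; length-replicate; length-take; length-drop; take++drop≡id;
         ++-identityʳ; map-++; map-replicate; filter-++; filter-all; filter-none; filter-accept; filter-reject)
open import Data.List.Membership.Propositional using (_∈_; _∉_; find)
open import Data.List.Membership.Propositional.Properties
  using (∈-++⁻; ∈-map⁻; ∈-filter⁻; ∈-concatMap⁻; ∈-upTo⁺; ∈-upTo⁻; ∈-allFin)
open import Data.List.Relation.Unary.All as All using (All; []; _∷_)
import Data.List.Relation.Unary.All.Properties as Allₚ
open import Data.List.Relation.Unary.AllPairs as AllPairs using (AllPairs; []; _∷_)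
import Data.List.Relation.Unary.AllPairs.Properties as AllPairsₚ
open import Data.List.Relation.Unary.Any using (here; there)
open import Data.List.Relation.Unary.Linked using (Linked; []; [-]; _∷_; linked?)
open import Data.List.Relation.Unary.Unique.Propositional using (Unique)
import Data.List.Relation.Unary.Unique.Propositional.Properties as Uniqueₚ
open import Function using (_∘_; id)
open import Relation.Nullary using (¬_; Dec; yes; no; contradiction)
open import Relation.Nullary.Decidable using (_×-dec_)
open import Relation.Binary.Definitions using (tri<; tri≈; tri>)
open import Relation.Binary.PropositionalEquality
open ≡-Reasoning

-- Finite sums

-- An exponent list is read from the last variable down, so h_j^⊥ acts on coefficient functions by
-- prefixing j. Stripping the last variable turns a tableau into one of a smaller shape, and a
-- choice of variables for the parts of a power sum into a choice for fewer parts. Both bases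
-- thereby obey one calculus, `StripCalculus`, whose main law is that Σ h_i and Σ (-1)^i e_i are
-- mutually inverse; the values of `E` on either basis follow from it. The functional for β carries
-- the sign (-1)^|β|. On p_μ this turns the sign of ω into (-1)^ℓ(μ), so a permutation enters
-- through the parity of its number of cycles. The conjugate of λ has λ_1 parts, which fixes the
-- number of colours: λ_1 < n - k leaves more points than there are boxes, one for each point of I
-- and one for each colour. The expansion is given in n variables only. This suffices because the
-- recursion prefixes positive exponents, so in degree n it reads lists of length at most n.

infixl 6 _⊕_
infixl 7 _⊗_
infix 8 ⊝_

-- Opaque copies of the ring operations: the unifier would otherwise unfold ℤ's arithmetic.
opaque
  _⊕_ _⊗_ : ℤ → ℤ → ℤ
  _⊕_ = ℤ._+_
  _⊗_ = ℤ._*_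

  ⊝_ : ℤ → ℤ
  ⊝_ = ℤ.-_

opaque
  unfolding _⊕_

  ⊕≡+ : ∀ a b → a ⊕ b ≡ a ℤ.+ b
  ⊕≡+ a b = refl

  ⊗≡* : ∀ a b → a ⊗ b ≡ a ℤ.* b
  ⊗≡* a b = refl

  ⊕-identityˡ : ∀ a → 0ℤ ⊕ a ≡ a
  ⊕-identityˡ = ℤₚ.+-identityˡ

  ⊕-identityʳ : ∀ a → a ⊕ 0ℤ ≡ a
  ⊕-identityʳ = ℤₚ.+-identityʳ

  ⊕-assoc : ∀ a b c → a ⊕ b ⊕ c ≡ a ⊕ (b ⊕ c)
  ⊕-assoc = ℤₚ.+-assoc

  ⊕-comm : ∀ a b → a ⊕ b ≡ b ⊕ a
  ⊕-comm = ℤₚ.+-comm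

  ⊕-interchange : ∀ a b c d → (a ⊕ b) ⊕ (c ⊕ d) ≡ (a ⊕ c) ⊕ (b ⊕ d)
  ⊕-interchange = solve-∀

  ⊕-cancel : ∀ a b → a ⊕ (b ⊕ ⊝ a) ≡ b
  ⊕-cancel = solve-∀

  ⊝-as-difference : ∀ a b → ⊝ a ≡ b ⊕ ⊝ (b ⊕ a)
  ⊝-as-difference = solve-∀

  ⊝-zero : ⊝ 0ℤ ≡ 0ℤ
  ⊝-zero = refl

  ⊝-involutive : ∀ a → ⊝ (⊝ a) ≡ a
  ⊝-involutive = solve-∀

  ⊝-⊕ : ∀ a b → ⊝ (a ⊕ b) ≡ ⊝ a ⊕ ⊝ b
  ⊝-⊕ = solve-∀

  ⊝-⊗ˡ : ∀ a b → ⊝ (a ⊗ b) ≡ ⊝ a ⊗ b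
  ⊝-⊗ˡ = solve-∀

  ⊝-⊗ʳ : ∀ a b → ⊝ (a ⊗ b) ≡ a ⊗ ⊝ b
  ⊝-⊗ʳ = solve-∀

  ⊗-zeroˡ : ∀ a → 0ℤ ⊗ a ≡ 0ℤ
  ⊗-zeroˡ = ℤₚ.*-zeroˡ

  ⊗-zeroʳ : ∀ a → a ⊗ 0ℤ ≡ 0ℤ
  ⊗-zeroʳ = ℤₚ.*-zeroʳ

  ⊗-identityˡ : ∀ a → 1ℤ ⊗ a ≡ a
  ⊗-identityˡ = ℤₚ.*-identityˡ

  ⊗-identityʳ : ∀ a → a ⊗ 1ℤ ≡ a
  ⊗-identityʳ = ℤₚ.*-identityʳ

  ⊗-assoc : ∀ a b c → a ⊗ b ⊗ c ≡ a ⊗ (b ⊗ c)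
  ⊗-assoc = ℤₚ.*-assoc

  ⊗-swap : ∀ a b c → a ⊗ (b ⊗ c) ≡ b ⊗ (a ⊗ c)
  ⊗-swap = solve-∀

  ⊗-⊕ : ∀ a b c → a ⊗ (b ⊕ c) ≡ a ⊗ b ⊕ a ⊗ c
  ⊗-⊕ = ℤₚ.*-distribˡ-+

  ⊕-⊗ : ∀ a b c → (a ⊕ b) ⊗ c ≡ a ⊗ c ⊕ b ⊗ c
  ⊕-⊗ = solve-∀

∑ : {A : Set} → List A → (A → ℤ) → ℤ
∑ [] f = 0ℤ
∑ (x ∷ xs) f = f x ⊕ ∑ xs f

∑-cong∈ : {A : Set} (xs : List A) {f g : A → ℤ} → (∀ {x} → x ∈ xs → f x ≡ g x) → ∑ xs f ≡ ∑ xs g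
∑-cong∈ [] e = refl
∑-cong∈ (x ∷ xs) e = cong₂ _⊕_ (e (here refl)) (∑-cong∈ xs (e ∘ there))

∑-cong : {A : Set} (xs : List A) {f g : A → ℤ} → (∀ x → f x ≡ g x) → ∑ xs f ≡ ∑ xs g
∑-cong xs e = ∑-cong∈ xs (λ {x} _ → e x)

∑-zero : {A : Set} (xs : List A) {f : A → ℤ} → (∀ {x} → x ∈ xs → f x ≡ 0ℤ) → ∑ xs f ≡ 0ℤ
∑-zero [] e = refl
∑-zero (x ∷ xs) e = trans (cong₂ _⊕_ (e (here refl)) (∑-zero xs (e ∘ there))) (⊕-identityˡ 0ℤ)

∑-++ : {A : Set} (xs ys : List A) (f : A → ℤ) → ∑ (xs ++ ys) f ≡ ∑ xs f ⊕ ∑ ys f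
∑-++ [] ys f = sym (⊕-identityˡ _)
∑-++ (x ∷ xs) ys f = trans (cong (f x ⊕_) (∑-++ xs ys f)) (sym (⊕-assoc (f x) _ _))

∑-map : {A B : Set} (h : A → B) (xs : List A) (f : B → ℤ) → ∑ (map h xs) f ≡ ∑ xs (f ∘ h)
∑-map h [] f = refl
∑-map h (x ∷ xs) f = cong (f (h x) ⊕_) (∑-map h xs f)

∑-concatMap : {A B : Set} (h : A → List B) (xs : List A) (f : B → ℤ)
  → ∑ (concatMap h xs) f ≡ ∑ xs (λ x → ∑ (h x) f)
∑-concatMap h [] f = refl
∑-concatMap h (x ∷ xs) f =
  trans (∑-++ (h x) (concatMap h xs) f) (cong (∑ (h x) f ⊕_) (∑-concatMap h xs f))

∑-⊕ : {A : Set} (xs : List A) (f g : A → ℤ) → ∑ xs (λ x → f x ⊕ g x) ≡ ∑ xs f ⊕ ∑ xs g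
∑-⊕ [] f g = sym (⊕-identityˡ 0ℤ)
∑-⊕ (x ∷ xs) f g = trans (cong ((f x ⊕ g x) ⊕_) (∑-⊕ xs f g)) (⊕-interchange (f x) (g x) _ _)

∑-⊗ˡ : {A : Set} (c : ℤ) (xs : List A) (f : A → ℤ) → ∑ xs (λ x → c ⊗ f x) ≡ c ⊗ ∑ xs f
∑-⊗ˡ c [] f = sym (⊗-zeroʳ c)
∑-⊗ˡ c (x ∷ xs) f = trans (cong (c ⊗ f x ⊕_) (∑-⊗ˡ c xs f)) (sym (⊗-⊕ c (f x) _))

∑-⊗ʳ : {A : Set} (c : ℤ) (xs : List A) (f : A → ℤ) → ∑ xs (λ x → f x ⊗ c) ≡ ∑ xs f ⊗ c
∑-⊗ʳ c [] f = sym (⊗-zeroˡ c)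
∑-⊗ʳ c (x ∷ xs) f = trans (cong (f x ⊗ c ⊕_) (∑-⊗ʳ c xs f)) (sym (⊕-⊗ (f x) _ c))

∑-⊝ : {A : Set} (xs : List A) (f : A → ℤ) → ∑ xs (λ x → ⊝ f x) ≡ ⊝ ∑ xs f
∑-⊝ [] f = sym ⊝-zero
∑-⊝ (x ∷ xs) f = trans (cong (⊝ f x ⊕_) (∑-⊝ xs f)) (sym (⊝-⊕ (f x) _))

∑-swap : {A B : Set} (xs : List A) (ys : List B) (f : A → B → ℤ)
  → ∑ xs (λ x → ∑ ys (f x)) ≡ ∑ ys (λ y → ∑ xs (λ x → f x y))
∑-swap [] ys f = sym (∑-zero ys (λ _ → refl))
∑-swap (x ∷ xs) ys f =
  trans (cong (∑ ys (f x) ⊕_) (∑-swap xs ys f)) (sym (∑-⊕ ys (f x) (λ y → ∑ xs (λ x → f x y))))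

opaque
  ind : {P : Set} → Dec P → ℤ
  ind (yes _) = 1ℤ
  ind (no _) = 0ℤ

  ind-yes : {P : Set} {d : Dec P} → P → ind d ≡ 1ℤ
  ind-yes {d = yes _} p = refl
  ind-yes {d = no ¬p} p = contradiction p ¬p

  ind-no : {P : Set} {d : Dec P} → ¬ P → ind d ≡ 0ℤ
  ind-no {d = yes p} ¬p = contradiction p ¬p
  ind-no {d = no _} ¬p = refl

ind-cong : {P Q : Set} {d : Dec P} {e : Dec Q} → (P → Q) → (Q → P) → ind d ≡ ind e
ind-cong {d = yes p} f g = trans (ind-yes p) (sym (ind-yes (f p)))
ind-cong {d = no ¬p} f g = trans (ind-no ¬p) (sym (ind-no (¬p ∘ g)))

1⊗ : {P : Set} {d : Dec P} {a : ℤ} → P → ind d ⊗ a ≡ a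
1⊗ {a = a} p = trans (cong (_⊗ a) (ind-yes p)) (⊗-identityˡ a)

0⊗ : {P : Set} {d : Dec P} {a : ℤ} → ¬ P → ind d ⊗ a ≡ 0ℤ
0⊗ {a = a} ¬p = trans (cong (_⊗ a) (ind-no ¬p)) (⊗-zeroˡ a)

ind-guard : {P : Set} {d : Dec P} {a b : ℤ} → (P → a ≡ b) → ind d ⊗ a ≡ ind d ⊗ b
ind-guard {d = yes p} {a} {b} e = cong (ind _ ⊗_) (e p)
ind-guard {d = no ¬p} e = trans (0⊗ ¬p) (sym (0⊗ ¬p))

ind-× : {P Q : Set} (d : Dec P) (e : Dec Q) → ind (d ×-dec e) ≡ ind d ⊗ ind e
ind-× (yes p) e = trans (ind-cong proj₂ (p ,_)) (sym (1⊗ p))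
ind-× (no ¬p) e = trans (ind-no (¬p ∘ proj₁)) (sym (0⊗ ¬p))

-- Linear functionals on coefficient functions

record Linear {A : Set} (L : (A → ℤ) → ℤ) : Set where
  field
    cong-L : ∀ {f g} → (∀ x → f x ≡ g x) → L f ≡ L g
    ⊕-L : ∀ f g → L (λ x → f x ⊕ g x) ≡ L f ⊕ L g
    ⊗-L : ∀ c f → L (λ x → c ⊗ f x) ≡ c ⊗ L f

  ∑-L : {B : Set} (ys : List B) (f : B → A → ℤ) → L (λ x → ∑ ys (λ y → f y x)) ≡ ∑ ys (λ y → L (f y))
  ∑-L [] f = trans (cong-L (λ _ → sym (⊗-zeroˡ 0ℤ))) (trans (⊗-L 0ℤ (λ _ → 0ℤ)) (⊗-zeroˡ _))
  ∑-L (y ∷ ys) f = trans (⊕-L (f y) _) (cong (L (f y) ⊕_) (∑-L ys f))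

open Linear public

evaluation : {A : Set} (x : A) → Linear (λ f → f x)
evaluation x = record { cong-L = λ e → e x ; ⊕-L = λ f g → refl ; ⊗-L = λ c f → refl }

⊝-linear : {A : Set} {L : (A → ℤ) → ℤ} → Linear L → Linear (λ f → ⊝ L f)
⊝-linear ℓ = record
  { cong-L = λ e → cong ⊝_ (cong-L ℓ e)
  ; ⊕-L = λ f g → trans (cong ⊝_ (⊕-L ℓ f g)) (⊝-⊕ _ _)
  ; ⊗-L = λ c f → trans (cong ⊝_ (⊗-L ℓ c f)) (⊝-⊗ʳ c _)
  }

⊕-linear : {A : Set} {L M : (A → ℤ) → ℤ} → Linear L → Linear M → Linear (λ f → L f ⊕ M f)
⊕-linear ℓ m = record
  { cong-L = λ e → cong₂ _⊕_ (cong-L ℓ e) (cong-L m e)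
  ; ⊕-L = λ f g → trans (cong₂ _⊕_ (⊕-L ℓ f g) (⊕-L m f g)) (⊕-interchange _ _ _ _)
  ; ⊗-L = λ c f → trans (cong₂ _⊕_ (⊗-L ℓ c f) (⊗-L m c f)) (sym (⊗-⊕ c _ _))
  }

∘-linear : {A B : Set} {L : (B → ℤ) → ℤ} {M : (A → ℤ) → B → ℤ}
  → Linear L → (∀ y → Linear (λ f → M f y)) → Linear (λ f → L (M f))
∘-linear ℓ m = record
  { cong-L = λ e → cong-L ℓ (λ y → cong-L (m y) e)
  ; ⊕-L = λ f g → trans (cong-L ℓ (λ y → ⊕-L (m y) f g)) (⊕-L ℓ _ _)
  ; ⊗-L = λ c f → trans (cong-L ℓ (λ y → ⊗-L (m y) c f)) (⊗-L ℓ c _)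
  }

-- The adjoint of multiplication by e_r, up to sign

mutual
  -- If F α is the coefficient of x^α in f, then E r F gives the coefficients of (-1)^r e_r^⊥ f:
  -- the recursion is Σ_i (-1)^{r-i} e_{r-i}^⊥ h_i^⊥ = 0.
  E : ℕ → (List ℕ → ℤ) → List ℕ → ℤ
  E zero F α = F α
  E (suc r) F α = ⊝ Etail r 1 F α

  -- Σ_{i ≤ r} E (r - i) h_{j+i}^⊥
  Etail : ℕ → ℕ → (List ℕ → ℤ) → List ℕ → ℤ
  Etail zero j F α = F (j ∷ α)
  Etail (suc r) j F α = E (suc r) (λ γ → F (j ∷ γ)) α ⊕ Etail r (suc j) F α

-- This is (-1)^|β| ⟨f, e_β⟩: the factors of e_β are moved to the other side one by one, until the
-- constant term is read.
E* : List ℕ → (List ℕ → ℤ) → ℤ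
E* [] F = F []
E* (r ∷ β) F = E* β (E r F)

mutual
  E-linear : ∀ r α → Linear (λ F → E r F α)
  E-linear zero α = evaluation α
  E-linear (suc r) α = ⊝-linear (Etail-linear r 1 α)

  Etail-linear : ∀ r j α → Linear (λ F → Etail r j F α)
  Etail-linear zero j α = evaluation (j ∷ α)
  Etail-linear (suc r) j α =
    ⊕-linear (∘-linear (E-linear (suc r) α) (λ γ → evaluation (j ∷ γ))) (Etail-linear r (suc j) α)

E*-linear : ∀ β → Linear (E* β)
E*-linear [] = evaluation []
E*-linear (r ∷ β) = ∘-linear (E*-linear β) (E-linear r)

mutual
  -- Every prefixed exponent is at least 1, which bounds the length by the degree. This bound lets
  -- coefficients in n variables determine the functionals of degree n.
  E-local : ∀ r α {F G} → (∀ γ → sum γ ≡ r → length γ ≤ r → F (γ ++ α) ≡ G (γ ++ α)) → E r F α ≡ E r G α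
  E-local zero α e = e [] refl z≤n
  E-local (suc r) α e = cong ⊝_ (Etail-local r 0 α e)

  Etail-local : ∀ r j α {F G} → (∀ γ → sum γ ≡ suc j ℕ.+ r → length γ ≤ suc j ℕ.+ r → F (γ ++ α) ≡ G (γ ++ α))
    → Etail r (suc j) F α ≡ Etail r (suc j) G α
  Etail-local zero j α e = e (suc j ∷ []) refl (s≤s z≤n)
  Etail-local (suc r) j α {F} {G} e = cong₂ _⊕_
    (E-local (suc r) α (λ γ s l → e (suc j ∷ γ) (cong (suc j ℕ.+_) s) (s≤s (ℕₚ.≤-trans l (ℕₚ.m≤n+m _ j)))))
    (Etail-local r (suc j) α (λ γ s l → e γ (trans s (sym (ℕₚ.+-suc (suc j) r)))
      (subst (length γ ≤_) (sym (ℕₚ.+-suc (suc j) r)) l)))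

E*-local : ∀ β {F G} → (∀ α → sum α ≡ sum β → length α ≤ sum β → F α ≡ G α) → E* β F ≡ E* β G
E*-local [] e = e [] refl z≤n
E*-local (r ∷ β) e = E*-local β (λ α sα lα → E-local r α (λ γ sγ lγ →
  e (γ ++ α) (trans (sum-++ γ α) (cong₂ ℕ._+_ sγ sα))
    (subst (_≤ r ℕ.+ sum β) (sym (length-++ γ)) (ℕₚ.+-mono-≤ lγ lα))))

-- The calculus of strips

Signed : Set
Signed = List (ℤ × List ℕ)

⟪_⟫ : Signed → (List ℕ → ℤ) → ℤ
⟪ c ⟫ G = ∑ c (λ p → proj₁ p ⊗ G (proj₂ p))

-- h x lists what h_0^⊥ + h_1^⊥ + ⋯ produces from the basis element x, and v x what e_0^⊥ - e_1^⊥ + ⋯ does;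
-- coef x α is the coefficient of x^α in the symmetric function indexed by x.
record StripCalculus : Set₁ where
  field
    Ok : List ℕ → Set
    h : List ℕ → List (List ℕ)
    v : List ℕ → Signed
    h-Ok : ∀ {x y} → Ok x → y ∈ h x → Ok y
    v-≤ : ∀ {x p} → p ∈ v x → sum (proj₂ p) ≤ sum x
    h-full : ∀ {x} → Ok x → ∀ G → ∑ (h x) (λ y → ind (sum y ≟ sum x) ⊗ G y) ≡ G x
    v-full : ∀ {x} → Ok x → ∀ G → ⟪ v x ⟫ (λ z → ind (sum z ≟ sum x) ⊗ G z) ≡ G x
    -- The identity Σ_i (-1)^i h_{r-i} e_i = 0 for all r > 0 at once; the degree is recovered from
    -- the sizes of the lists.
    h-v : ∀ {x} → Ok x → ∀ G → ∑ (h x) (λ y → ⟪ v y ⟫ G) ≡ G x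
    h-≤ : ∀ {x y} → Ok x → y ∈ h x → sum y ≤ sum x

  coef : List ℕ → List ℕ → ℤ
  coef x [] = ind (sum x ≟ 0)
  coef x (j ∷ α) = ∑ (h x) (λ y → ind (sum y ℕ.+ j ≟ sum x) ⊗ coef y α)

  -- The condition that at least j cells are lost splits into exactly j and at least j + 1. When |x|
  -- = |y| + j, the loss of z may be measured from y or from x.
  split-ind : ∀ {x} y j r (G : List ℕ → ℤ) → sum y ≤ sum x →
    ind (sum y ℕ.+ j ≟ sum x) ⊗ ⟪ v y ⟫ (λ z → ind (sum z ℕ.+ r ≟ sum y) ⊗ G z)
      ⊕ ind (sum y ℕ.+ suc j ≤? sum x) ⊗ ⟪ v y ⟫ (λ z → ind (sum z ℕ.+ (j ℕ.+ r) ≟ sum x) ⊗ G z)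
    ≡ ind (sum y ℕ.+ j ≤? sum x) ⊗ ⟪ v y ⟫ (λ z → ind (sum z ℕ.+ (j ℕ.+ r) ≟ sum x) ⊗ G z)
  split-ind {x} y j r G y≤x with sum y ℕ.+ j ≟ sum x
  ... | yes e = trans (cong₂ _⊕_
        (trans (1⊗ e) (∑-cong (v y) (λ p → cong (proj₁ p ⊗_) (cong (_⊗ G (proj₂ p)) (ind-cong
          (λ q → trans (rearr (sum (proj₂ p))) (trans (cong (ℕ._+ j) q) e))
          (λ q → ℕₚ.+-cancelʳ-≡ j _ _ (trans (sym (rearr (sum (proj₂ p)))) (trans q (sym e)))))))))
        (0⊗ (λ q → ℕₚ.<-irrefl e (subst (_≤ sum x) (ℕₚ.+-suc (sum y) j) q))))
      (trans (⊕-identityʳ _) (sym (1⊗ (ℕₚ.≤-reflexive e))))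
    where
    rearr : ∀ a → a ℕ.+ (j ℕ.+ r) ≡ a ℕ.+ r ℕ.+ j
    rearr a = trans (cong (a ℕ.+_) (ℕₚ.+-comm j r)) (sym (ℕₚ.+-assoc a r j))
  ... | no ¬e = trans (cong₂ _⊕_ (0⊗ ¬e) (cong₂ _⊗_ (ind-cong
        (λ q → ℕₚ.≤-trans (ℕₚ.+-monoʳ-≤ (sum y) (ℕₚ.n≤1+n j)) q)
        (λ q → subst (_≤ sum x) (sym (ℕₚ.+-suc (sum y) j)) (ℕₚ.≤∧≢⇒< q ¬e))) refl))
      (⊕-identityˡ _)

  mutual
    -- The right side satisfies the recursion that defines `E`. By `h-v`, the ways to lose r + 1
    -- cells in an `h` step and then a `v` step cancel; an `h` step that loses nothing gives the
    -- right side, and one that loses something gives `Etail r 1`.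
    E-coef : ∀ r {x} → Ok x → ∀ α → E r (coef x) α ≡ ⟪ v x ⟫ (λ z → ind (sum z ℕ.+ r ≟ sum x) ⊗ coef z α)
    E-coef zero {x} ok α = trans (sym (v-full ok (λ z → coef z α)))
      (∑-cong (v x) (λ p → cong (λ c → proj₁ p ⊗ (c ⊗ coef (proj₂ p) α))
        (ind-cong (trans (ℕₚ.+-identityʳ _)) (trans (sym (ℕₚ.+-identityʳ _))))))
    E-coef (suc r) {x} ok α = trans (cong ⊝_ (Etail-coef r 1 ok α)) (begin
        ⊝ A ≡⟨ ⊝-as-difference A B ⟩
        B ⊕ ⊝ (B ⊕ A) ≡⟨ cong (λ z → B ⊕ ⊝ z) total ⟩
        B ⊕ ⊝ 0ℤ ≡⟨ cong (B ⊕_) ⊝-zero ⟩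
        B ⊕ 0ℤ ≡⟨ ⊕-identityʳ B ⟩
        B ∎)
      where
      G : List ℕ → ℤ
      G z = ind (sum z ℕ.+ suc r ≟ sum x) ⊗ coef z α
      A B : ℤ
      A = ∑ (h x) (λ y → ind (sum y ℕ.+ 1 ≤? sum x) ⊗ ⟪ v y ⟫ G)
      B = ⟪ v x ⟫ G
      pointwise : ∀ y → sum y ≤ sum x → (c : ℤ) → ind (sum y ≟ sum x) ⊗ c ⊕ ind (sum y ℕ.+ 1 ≤? sum x) ⊗ c ≡ c
      pointwise y le c with sum y ≟ sum x
      ... | yes e = trans (cong₂ _⊕_ (1⊗ e)
              (0⊗ (λ q → ℕₚ.<-irrefl e (subst (_≤ sum x) (ℕₚ.+-comm (sum y) 1) q))))
              (⊕-identityʳ c)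
      ... | no ¬e = trans (cong₂ _⊕_ (0⊗ ¬e) (1⊗ (subst (_≤ sum x) (ℕₚ.+-comm 1 (sum y)) (ℕₚ.≤∧≢⇒< le ¬e))))
              (⊕-identityˡ c)
      total : B ⊕ A ≡ 0ℤ
      total = begin
        B ⊕ A ≡⟨ cong (_⊕ A) (h-full ok (λ y → ⟪ v y ⟫ G)) ⟨
        ∑ (h x) (λ y → ind (sum y ≟ sum x) ⊗ ⟪ v y ⟫ G) ⊕ A ≡⟨ ∑-⊕ (h x) _ _ ⟨
        ∑ (h x) (λ y → ind (sum y ≟ sum x) ⊗ ⟪ v y ⟫ G ⊕ ind (sum y ℕ.+ 1 ≤? sum x) ⊗ ⟪ v y ⟫ G)
          ≡⟨ ∑-cong∈ (h x) (λ {y} y∈ → pointwise y (h-≤ ok y∈) (⟪ v y ⟫ G)) ⟩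
        ∑ (h x) (λ y → ⟪ v y ⟫ G) ≡⟨ h-v ok G ⟩
        -- `G` asks for a loss of r + 1 cells, and x itself has lost none.
        G x ≡⟨ 0⊗ (ℕₚ.m+1+n≢m (sum x)) ⟩
        0ℤ ∎

    -- The sum in `Etail` starts at h_j^⊥, so the first step loses at least j cells; the second
    -- brings the total loss to j + r.
    Etail-coef : ∀ r j {x} → Ok x → ∀ α → Etail r j (coef x) α ≡
      ∑ (h x) (λ y → ind (sum y ℕ.+ j ≤? sum x) ⊗ ⟪ v y ⟫ (λ z → ind (sum z ℕ.+ (j ℕ.+ r) ≟ sum x) ⊗ coef z α))
    Etail-coef zero j {x} ok α = ∑-cong∈ (h x) (λ {y} y∈ → begin
        ind (sum y ℕ.+ j ≟ sum x) ⊗ coef y α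
          ≡⟨ cong (ind (sum y ℕ.+ j ≟ sum x) ⊗_) (E-coef zero (h-Ok ok y∈) α) ⟩
        _ ≡⟨ ⊕-identityʳ _ ⟨
        _ ≡⟨ cong₂ _⊕_ refl (last y) ⟨
        _ ≡⟨ split-ind {x} y j 0 (λ z → coef z α) (h-≤ ok y∈) ⟩
        _ ∎)
      where
      -- A first loss of more than j cells already exceeds the total j + 0.
      last : ∀ y → ind (sum y ℕ.+ suc j ≤? sum x) ⊗ ⟪ v y ⟫ (λ z → ind (sum z ℕ.+ (j ℕ.+ 0) ≟ sum x) ⊗ coef z α) ≡ 0ℤ
      last y = trans (ind-guard (λ le → ∑-zero (v y) (λ {p} p∈ →
          trans (cong (proj₁ p ⊗_) (0⊗
            (λ q → ℕₚ.<⇒≢ (ℕₚ.≤-<-trans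
              (ℕₚ.+-mono-≤ (v-≤ p∈) (ℕₚ.≤-reflexive (ℕₚ.+-identityʳ j)))
              (subst (_≤ sum x) (ℕₚ.+-suc (sum y) j) le)) q)))
          (⊗-zeroʳ (proj₁ p)))))
        (⊗-zeroʳ _)
    Etail-coef (suc r) j {x} ok α = begin
      E (suc r) (λ γ → coef x (j ∷ γ)) α ⊕ Etail r (suc j) (coef x) α
        ≡⟨ cong₂ _⊕_ (headed (λ ok′ → E-coef (suc r) ok′ α)) (Etail-coef r (suc j) ok α) ⟩
      _ ≡⟨ ∑-⊕ (h x) _ _ ⟨
      _ ≡⟨ ∑-cong∈ (h x) (λ {y} y∈ → trans (cong₂ _⊕_ refl (cong₂ _⊗_ refl (∑-cong (v y) (λ p → cong (proj₁ p ⊗_)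
             (cong (λ m → ind (sum (proj₂ p) ℕ.+ m ≟ sum x) ⊗ coef (proj₂ p) α) (sym (ℕₚ.+-suc j r)))))))
             (split-ind {x} y j (suc r) (λ z → coef z α) (h-≤ ok y∈))) ⟩
      _ ∎
      where
      headed : (∀ {y} → Ok y → E (suc r) (coef y) α ≡ ⟪ v y ⟫ (λ z → ind (sum z ℕ.+ suc r ≟ sum y) ⊗ coef z α))
        → E (suc r) (λ γ → coef x (j ∷ γ)) α ≡ ∑ (h x) (λ y → ind (sum y ℕ.+ j ≟ sum x) ⊗
        ⟪ v y ⟫ (λ z → ind (sum z ℕ.+ suc r ≟ sum y) ⊗ coef z α))
      headed ih = trans (∑-L (E-linear (suc r) α) (h x) _) (∑-cong∈ (h x) (λ {y} y∈ →
        trans (⊗-L (E-linear (suc r) α) _ (coef y)) (cong (ind (sum y ℕ.+ j ≟ sum x) ⊗_) (ih (h-Ok ok y∈)))))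

  E*-coef : ∀ r β {x} → Ok x → E* (r ∷ β) (coef x) ≡ ⟪ v x ⟫ (λ z → ind (sum z ℕ.+ r ≟ sum x) ⊗ E* β (coef z))
  E*-coef r β {x} ok = begin
    E* β (E r (coef x)) ≡⟨ cong-L L (E-coef r ok) ⟩
    _ ≡⟨ ∑-L L (v x) _ ⟩
    _ ≡⟨ ∑-cong (v x) (λ p → trans (⊗-L L (proj₁ p) _) (cong (proj₁ p ⊗_) (⊗-L L _ (coef (proj₂ p))))) ⟩
    _ ∎
    where L = E*-linear β

-- Power sums

module PowerSum where

  -- Each p_m is primitive and h_j has scalar product 1 with every p_ν of degree j. Hence h_j^⊥
  -- drops parts of total size j, each selection counting once.
  h : List ℕ → List (List ℕ)
  h [] = [] ∷ []
  h (m ∷ μ) = h μ ++ map (m ∷_) (h μ)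

  -- The scalar product of (-1)^r e_r with p_ν of degree r is (-1)^ℓ(ν), one sign for each dropped
  -- part.
  v : List ℕ → Signed
  v [] = (1ℤ , []) ∷ []
  v (m ∷ μ) = map (λ p → ⊝ proj₁ p , proj₂ p) (v μ) ++ map (λ p → proj₁ p , m ∷ proj₂ p) (v μ)

  ∑-h : ∀ m μ G → ∑ (h (m ∷ μ)) G ≡ ∑ (h μ) G ⊕ ∑ (h μ) (λ ρ → G (m ∷ ρ))
  ∑-h m μ G = trans (∑-++ (h μ) _ G) (cong (∑ (h μ) G ⊕_) (∑-map (m ∷_) (h μ) G))

  ∑-v : ∀ m μ G → ⟪ v (m ∷ μ) ⟫ G ≡ ⊝ ⟪ v μ ⟫ G ⊕ ⟪ v μ ⟫ (λ ρ → G (m ∷ ρ))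
  ∑-v m μ G = trans (∑-++ (map _ (v μ)) _ _) (cong₂ _⊕_
    (trans (∑-map _ (v μ) _) (trans (∑-cong (v μ) (λ p → sym (⊝-⊗ˡ (proj₁ p) (G (proj₂ p))))) (∑-⊝ (v μ) _)))
    (∑-map _ (v μ) _))

  -- The part m is dropped in the first step, dropped in the second, or kept; the first two
  -- possibilities cancel.
  h-v : ∀ μ G → ∑ (h μ) (λ ρ → ⟪ v ρ ⟫ G) ≡ G μ
  h-v [] G = trans (⊕-identityʳ _) (trans (⊕-identityʳ _) (⊗-identityˡ _))
  h-v (m ∷ μ) G = begin
    ∑ (h (m ∷ μ)) (λ ρ → ⟪ v ρ ⟫ G) ≡⟨ ∑-h m μ _ ⟩
    a ⊕ ∑ (h μ) (λ ρ → ⟪ v (m ∷ ρ) ⟫ G)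
      ≡⟨ cong (a ⊕_) (∑-cong (h μ) (λ ρ → trans (∑-v m ρ G) (⊕-comm _ _))) ⟩
    a ⊕ ∑ (h μ) (λ ρ → ⟪ v ρ ⟫ (λ σ → G (m ∷ σ)) ⊕ ⊝ ⟪ v ρ ⟫ G) ≡⟨ cong (a ⊕_) (∑-⊕ (h μ) _ _) ⟩
    a ⊕ (b ⊕ ∑ (h μ) (λ ρ → ⊝ ⟪ v ρ ⟫ G)) ≡⟨ cong (λ z → a ⊕ (b ⊕ z)) (∑-⊝ (h μ) _) ⟩
    a ⊕ (b ⊕ ⊝ a) ≡⟨ ⊕-cancel a b ⟩
    b ≡⟨ h-v μ (λ σ → G (m ∷ σ)) ⟩
    G (m ∷ μ) ∎
    where
    a = ∑ (h μ) (λ ρ → ⟪ v ρ ⟫ G)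
    b = ∑ (h μ) (λ ρ → ⟪ v ρ ⟫ (λ σ → G (m ∷ σ)))

  h-≤ : ∀ μ {ρ} → ρ ∈ h μ → sum ρ ≤ sum μ
  h-≤ [] (here refl) = z≤n
  h-≤ (m ∷ μ) ρ∈ with ∈-++⁻ (h μ) ρ∈
  ... | inj₁ i = ℕₚ.≤-trans (h-≤ μ i) (ℕₚ.m≤n+m _ m)
  ... | inj₂ i with ∈-map⁻ (m ∷_) i
  ...   | _ , j , refl = ℕₚ.+-monoʳ-≤ m (h-≤ μ j)

  v-≤ : ∀ μ {p} → p ∈ v μ → sum (proj₂ p) ≤ sum μ
  v-≤ [] (here refl) = z≤n
  v-≤ (m ∷ μ) p∈ with ∈-++⁻ (map _ (v μ)) p∈
  ... | inj₁ i with ∈-map⁻ _ i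
  ...   | _ , j , refl = ℕₚ.≤-trans (v-≤ μ j) (ℕₚ.m≤n+m _ m)
  v-≤ (m ∷ μ) p∈ | inj₂ i with ∈-map⁻ _ i
  ...   | _ , j , refl = ℕₚ.+-monoʳ-≤ m (v-≤ μ j)

  Positive : List ℕ → Set
  Positive = All (1 ≤_)

  h-positive : ∀ {μ ρ} → Positive μ → ρ ∈ h μ → Positive ρ
  h-positive {[]} ok (here refl) = []
  h-positive {m ∷ μ} (pm ∷ ok) ρ∈ with ∈-++⁻ (h μ) ρ∈
  ... | inj₁ i = h-positive ok i
  ... | inj₂ i with ∈-map⁻ (m ∷_) i
  ...   | _ , j , refl = pm ∷ h-positive ok j

  smaller : ∀ {m a b} → 1 ≤ m → a ≤ b → a ≢ m ℕ.+ b
  smaller {suc m} {a} {b} (s≤s _) a≤b = ℕₚ.<⇒≢ (s≤s (ℕₚ.≤-trans a≤b (ℕₚ.m≤n+m b m)))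

  h-full : ∀ {μ} → Positive μ → ∀ G → ∑ (h μ) (λ ρ → ind (sum ρ ≟ sum μ) ⊗ G ρ) ≡ G μ
  h-full [] G = trans (⊕-identityʳ _) (1⊗ refl)
  h-full {m ∷ μ} (pm ∷ ok) G = begin
    _ ≡⟨ ∑-h m μ _ ⟩
    _ ≡⟨ cong₂ _⊕_ (∑-zero (h μ) (λ ρ∈ → 0⊗ (smaller pm (h-≤ μ ρ∈))))
           (∑-cong (h μ) (λ ρ → cong (_⊗ G (m ∷ ρ)) (ind-cong (ℕₚ.+-cancelˡ-≡ m _ _) (cong (m ℕ.+_))))) ⟩
    0ℤ ⊕ ∑ (h μ) (λ ρ → ind (sum ρ ≟ sum μ) ⊗ G (m ∷ ρ)) ≡⟨ ⊕-identityˡ _ ⟩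
    _ ≡⟨ h-full ok (λ ρ → G (m ∷ ρ)) ⟩
    G (m ∷ μ) ∎

  v-full : ∀ {μ} → Positive μ → ∀ G → ⟪ v μ ⟫ (λ ρ → ind (sum ρ ≟ sum μ) ⊗ G ρ) ≡ G μ
  v-full [] G = trans (⊕-identityʳ _) (trans (⊗-identityˡ _) (1⊗ refl))
  v-full {m ∷ μ} (pm ∷ ok) G = begin
    _ ≡⟨ ∑-v m μ _ ⟩
    _ ≡⟨ cong₂ _⊕_ (trans (cong ⊝_ (∑-zero (v μ) (λ {p} p∈ →
             trans (cong (proj₁ p ⊗_) (0⊗ (smaller pm (v-≤ μ p∈)))) (⊗-zeroʳ _)))) ⊝-zero)
           (∑-cong (v μ) (λ p → cong (λ c → proj₁ p ⊗ (c ⊗ G (m ∷ proj₂ p)))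
             (ind-cong (ℕₚ.+-cancelˡ-≡ m _ _) (cong (m ℕ.+_))))) ⟩
    0ℤ ⊕ ⟪ v μ ⟫ (λ ρ → ind (sum ρ ≟ sum μ) ⊗ G (m ∷ ρ)) ≡⟨ ⊕-identityˡ _ ⟩
    _ ≡⟨ v-full ok (λ ρ → G (m ∷ ρ)) ⟩
    G (m ∷ μ) ∎

  calculus : StripCalculus
  calculus = record
    { Ok = Positive ; h = h ; v = v ; h-Ok = h-positive ; v-≤ = λ {μ} → v-≤ μ ; h-full = h-full
    ; v-full = v-full ; h-v = λ {μ} _ → h-v μ ; h-≤ = λ {μ} _ → h-≤ μ }

  open StripCalculus calculus using (coef; E*-coef) public

  sign : List ℕ → ℤ
  sign [] = 1ℤ
  sign (_ ∷ μ) = ⊝ sign μ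

  -- The signs of the dropped parts, supplied by `v`, and those of the kept parts multiply to the
  -- sign of μ.
  v-sign : ∀ μ G → ⟪ v μ ⟫ (λ ρ → sign ρ ⊗ G ρ) ≡ sign μ ⊗ ∑ (h μ) G
  v-sign [] G = trans (⊕-identityʳ _) (trans (⊗-identityˡ _) (cong (1ℤ ⊗_) (sym (⊕-identityʳ _))))
  v-sign (m ∷ μ) G = begin
    _ ≡⟨ ∑-v m μ _ ⟩
    ⊝ ⟪ v μ ⟫ (λ ρ → sign ρ ⊗ G ρ) ⊕ ⟪ v μ ⟫ (λ ρ → ⊝ sign ρ ⊗ G (m ∷ ρ))
      ≡⟨ cong₂ (λ x y → ⊝ x ⊕ y) (v-sign μ G)
           (trans (∑-cong (v μ) (λ p → trans (cong (proj₁ p ⊗_) (sym (⊝-⊗ˡ (sign (proj₂ p)) (G (m ∷ proj₂ p)))))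
             (sym (⊝-⊗ʳ (proj₁ p) _)))) (∑-⊝ (v μ) _)) ⟩
    ⊝ (sign μ ⊗ ∑ (h μ) G) ⊕ ⊝ ⟪ v μ ⟫ (λ ρ → sign ρ ⊗ G (m ∷ ρ))
      ≡⟨ cong₂ (λ x y → x ⊕ ⊝ y) (⊝-⊗ˡ (sign μ) _) (v-sign μ (λ ρ → G (m ∷ ρ))) ⟩
    ⊝ sign μ ⊗ ∑ (h μ) G ⊕ ⊝ (sign μ ⊗ ∑ (h μ) (λ ρ → G (m ∷ ρ))) ≡⟨ cong₂ _⊕_ refl (⊝-⊗ˡ (sign μ) _) ⟩
    ⊝ sign μ ⊗ ∑ (h μ) G ⊕ ⊝ sign μ ⊗ ∑ (h μ) (λ ρ → G (m ∷ ρ)) ≡⟨ ⊗-⊕ (⊝ sign μ) _ _ ⟨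
    ⊝ sign μ ⊗ (∑ (h μ) G ⊕ ∑ (h μ) (λ ρ → G (m ∷ ρ))) ≡⟨ cong (⊝ sign μ ⊗_) (∑-h m μ G) ⟨
    ⊝ sign μ ⊗ ∑ (h (m ∷ μ)) G ∎

  v-positive : ∀ {μ p} → Positive μ → p ∈ v μ → Positive (proj₂ p)
  v-positive {[]} ok (here refl) = []
  v-positive {m ∷ μ} (pm ∷ ok) p∈ with ∈-++⁻ (map _ (v μ)) p∈
  ... | inj₁ i with ∈-map⁻ _ i
  ...   | _ , j , refl = v-positive ok j
  v-positive {m ∷ μ} (pm ∷ ok) p∈ | inj₂ i with ∈-map⁻ _ i
  ...   | _ , j , refl = pm ∷ v-positive ok j

  -- This plays the role of ω p_μ = (-1)^(|μ|-ℓ(μ)) p_μ: the sign (-1)^|β| inside `E*` leaves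
  -- (-1)^ℓ(μ).
  E*-powersum : ∀ β {μ} → Positive μ → E* β (coef μ) ≡ sign μ ⊗ coef μ β
  E*-powersum [] [] = sym (⊗-identityˡ _)
  E*-powersum [] (s≤s _ ∷ _) = trans (ind-no (λ ())) (sym (trans (cong₂ _⊗_ refl (ind-no (λ ()))) (⊗-zeroʳ _)))
  E*-powersum (r ∷ β) {μ} ok = begin
    E* (r ∷ β) (coef μ) ≡⟨ E*-coef r β ok ⟩
    ⟪ v μ ⟫ (λ ρ → ind (sum ρ ℕ.+ r ≟ sum μ) ⊗ E* β (coef ρ))
      ≡⟨ ∑-cong∈ (v μ) (λ {p} p∈ → cong (proj₁ p ⊗_) (trans
           (cong₂ _⊗_ refl (E*-powersum β (v-positive ok p∈))) (⊗-swap _ (sign (proj₂ p)) _))) ⟩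
    ⟪ v μ ⟫ (λ ρ → sign ρ ⊗ (ind (sum ρ ℕ.+ r ≟ sum μ) ⊗ coef ρ β)) ≡⟨ v-sign μ _ ⟩
    sign μ ⊗ coef μ (r ∷ β) ∎

-- Strips of partitions

∑-filter : {A : Set} {P : A → Set} (P? : ∀ x → Dec (P x)) (xs : List A) (f : A → ℤ)
  → ∑ (filter P? xs) f ≡ ∑ xs (λ x → ind (P? x) ⊗ f x)
∑-filter P? [] f = refl
∑-filter P? (x ∷ xs) f with P? x
... | yes p = cong₂ _⊕_ (sym (1⊗ p)) (∑-filter P? xs f)
... | no ¬p = trans (∑-filter P? xs f) (trans (sym (⊕-identityˡ _)) (cong₂ _⊕_ (sym (0⊗ ¬p)) refl))

∑-upTo : ∀ n (f : ℕ → ℤ) → ∑ (upTo (suc n)) f ≡ ∑ (upTo n) f ⊕ f n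
∑-upTo n f = begin
  ∑ (upTo (suc n)) f ≡⟨ cong (λ xs → ∑ xs f) (upTo-∷ʳ n) ⟨
  ∑ (upTo n ++ n ∷ []) f ≡⟨ ∑-++ (upTo n) _ f ⟩
  ∑ (upTo n) f ⊕ (f n ⊕ 0ℤ) ≡⟨ cong (∑ (upTo n) f ⊕_) (⊕-identityʳ (f n)) ⟩
  ∑ (upTo n) f ⊕ f n ∎

∑-upTo-last : ∀ n (f : ℕ → ℤ) → (∀ {q} → q < n → f q ≡ 0ℤ) → ∑ (upTo (suc n)) f ≡ f n
∑-upTo-last n f e =
  trans (∑-upTo n f) (trans (cong (_⊕ f n) (∑-zero (upTo n) (λ q∈ → e (∈-upTo⁻ q∈)))) (⊕-identityˡ _))

head₀ : List ℕ → ℕ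
head₀ sh = partAt sh 0

-- Empty rows are allowed: removing a strip never shortens the list, so the rows before and after
-- stay aligned.
data Decr : List ℕ → Set where
  [] : Decr []
  _∷_ : ∀ {p sh} → head₀ sh ≤ p → Decr sh → Decr (p ∷ sh)

-- The lexicographic order without its prefix case: no partition is a proper prefix of one of the same size.
data _⋖_ : List ℕ → List ℕ → Set where
  here : ∀ {a b x y} → a < b → (a ∷ x) ⋖ (b ∷ y)
  there : ∀ {a x y} → x ⋖ y → (a ∷ x) ⋖ (a ∷ y)

module Schur where

  data HStrip : List ℕ → List ℕ → Set where
    [] : HStrip [] []
    row : ∀ {p q x y} → head₀ x ≤ q → q ≤ p → HStrip x y → HStrip (p ∷ x) (q ∷ y)

  data VStrip : List ℕ → List ℕ → Set where
    [] : VStrip [] []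
    keep : ∀ {p x y} → VStrip x y → VStrip (p ∷ x) (p ∷ y)
    shrink : ∀ {p x y} → head₀ y ≤ p → VStrip x y → VStrip (suc p ∷ x) (p ∷ y)

  h : List ℕ → List (List ℕ)
  h [] = [] ∷ []
  h (p ∷ x) = concatMap (λ q → map (q ∷_) (h x)) (filter (head₀ x ≤?_) (upTo (suc p)))

  dropped : ℕ → ℤ × List ℕ → Signed
  dropped p (s , y) with head₀ y <? p
  ... | yes _ = (⊝ s , pred p ∷ y) ∷ []
  ... | no _ = []

  v : List ℕ → Signed
  v [] = (1ℤ , []) ∷ []
  v (p ∷ x) = concatMap (λ sy → (proj₁ sy , p ∷ proj₂ sy) ∷ dropped p sy) (v x)

  ∑-h : ∀ p x G → ∑ (h (p ∷ x)) G ≡ ∑ (upTo (suc p)) (λ q → ind (head₀ x ≤? q) ⊗ ∑ (h x) (λ y → G (q ∷ y)))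
  ∑-h p x G = begin
    _ ≡⟨ ∑-concatMap (λ q → map (q ∷_) (h x)) (filter (head₀ x ≤?_) (upTo (suc p))) G ⟩
    _ ≡⟨ ∑-filter (head₀ x ≤?_) (upTo (suc p)) _ ⟩
    _ ≡⟨ ∑-cong (upTo (suc p)) (λ q → cong (ind (head₀ x ≤? q) ⊗_) (∑-map (q ∷_) (h x) G)) ⟩
    _ ∎

  ∑-dropped : ∀ p sy G → ⟪ dropped p sy ⟫ G ≡ proj₁ sy ⊗ ⊝ (ind (head₀ (proj₂ sy) <? p) ⊗ G (pred p ∷ proj₂ sy))
  ∑-dropped p (s , y) G with head₀ y <? p
  ... | yes q = trans (⊕-identityʳ _) (trans (trans (sym (⊝-⊗ˡ s _)) (⊝-⊗ʳ s _)) (cong (λ c → s ⊗ ⊝ c) (sym (1⊗ q))))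
  ... | no ¬q = sym (trans (cong (λ c → s ⊗ c) (trans (cong ⊝_ (0⊗ ¬q)) ⊝-zero)) (⊗-zeroʳ s))

  ∑-v : ∀ p x G → ⟪ v (p ∷ x) ⟫ G ≡ ⟪ v x ⟫ (λ y → G (p ∷ y) ⊕ ⊝ (ind (head₀ y <? p) ⊗ G (pred p ∷ y)))
  ∑-v p x G = trans (∑-concatMap _ (v x) _) (∑-cong (v x) (λ sy →
    trans (cong (proj₁ sy ⊗ G (p ∷ proj₂ sy) ⊕_) (∑-dropped p sy G)) (sym (⊗-⊕ (proj₁ sy) _ _))))

  -- For q > lo the summand is g q - g (q - 1), for q = lo it is g lo. In `h-v` below, q is the
  -- length to which a horizontal strip cuts the top row, and the negative term comes from the cell
  -- that a vertical strip then takes from it.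
  telescope : ∀ lo p (g : ℕ → ℤ) →
    ∑ (upTo (suc p)) (λ q → ind (lo ≤? q) ⊗ (g q ⊕ ⊝ (ind (lo <? q) ⊗ g (pred q)))) ≡ ind (lo ≤? p) ⊗ g p
  telescope lo zero g = begin
    _ ≡⟨ ∑-upTo 0 (λ q → ind (lo ≤? q) ⊗ (g q ⊕ ⊝ (ind (lo <? q) ⊗ g (pred q)))) ⟩
    _ ≡⟨ ⊕-identityˡ _ ⟩
    _ ≡⟨ cong (ind (lo ≤? 0) ⊗_) (cong₂ _⊕_ refl (trans (cong ⊝_ (0⊗ (λ ()))) ⊝-zero)) ⟩
    _ ≡⟨ cong (ind (lo ≤? 0) ⊗_) (⊕-identityʳ _) ⟩
    _ ∎
  telescope lo (suc p) g = begin
    _ ≡⟨ ∑-upTo (suc p) (λ q → ind (lo ≤? q) ⊗ (g q ⊕ ⊝ (ind (lo <? q) ⊗ g (pred q)))) ⟩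
    _ ≡⟨ cong₂ _⊕_ (telescope lo p g) refl ⟩
    ind (lo ≤? p) ⊗ g p ⊕ ind (lo ≤? suc p) ⊗ (g (suc p) ⊕ ⊝ (ind (lo <? suc p) ⊗ g p)) ≡⟨ last (lo ≤? suc p) ⟩
    _ ∎
    where
    last : (d : Dec (lo ≤ suc p)) → ind (lo ≤? p) ⊗ g p ⊕ ind d ⊗ (g (suc p) ⊕ ⊝ (ind (lo <? suc p) ⊗ g p)) ≡ ind d ⊗ g (suc p)
    last (yes le) = begin
      a ⊕ ind (yes le) ⊗ (g (suc p) ⊕ ⊝ (ind (lo <? suc p) ⊗ g p)) ≡⟨ cong (a ⊕_) (1⊗ le) ⟩
      a ⊕ (g (suc p) ⊕ ⊝ (ind (lo <? suc p) ⊗ g p))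
        ≡⟨ cong (λ c → a ⊕ (g (suc p) ⊕ ⊝ (c ⊗ g p))) (ind-cong (λ { (s≤s l) → l }) s≤s) ⟩
      a ⊕ (g (suc p) ⊕ ⊝ a) ≡⟨ ⊕-cancel a _ ⟩
      g (suc p) ≡⟨ 1⊗ le ⟨
      ind (yes le) ⊗ g (suc p) ∎
      where a = ind (lo ≤? p) ⊗ g p
    last (no nle) = trans (cong₂ _⊕_ (0⊗ (λ l → nle (ℕₚ.≤-trans l (ℕₚ.n≤1+n p)))) (0⊗ nle))
      (trans (⊕-identityˡ 0ℤ) (sym (0⊗ nle)))

  h-strip : ∀ x {y} → y ∈ h x → HStrip x y
  h-strip [] (here refl) = []
  h-strip (p ∷ x) y∈
    with find (∈-concatMap⁻ (λ q → map (q ∷_) (h x)) {filter (head₀ x ≤?_) (upTo (suc p))} y∈)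
  ... | q , q∈ , j with ∈-map⁻ (q ∷_) j | ∈-filter⁻ (head₀ x ≤?_) {xs = upTo (suc p)} q∈
  ...   | _ , k , refl | q∈′ , lo with ∈-upTo⁻ q∈′
  ...     | s≤s q≤p = row lo q≤p (h-strip x k)

  HStrip-≤ : ∀ {x y} → HStrip x y → sum y ≤ sum x
  HStrip-≤ [] = z≤n
  HStrip-≤ (row _ q≤p s) = ℕₚ.+-mono-≤ q≤p (HStrip-≤ s)

  HStrip-Decr : ∀ {x y} → HStrip x y → Decr y
  HStrip-Decr [] = []
  HStrip-Decr (row lo _ s) = ℕₚ.≤-trans (first s) lo ∷ HStrip-Decr s
    where
    first : ∀ {x y} → HStrip x y → head₀ y ≤ head₀ x
    first [] = z≤n
    first (row _ q≤p _) = q≤p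

  v-strip : ∀ x {p} → p ∈ v x → VStrip x (proj₂ p)
  v-strip [] (here refl) = []
  v-strip (p ∷ x) i with find (∈-concatMap⁻ (λ sy → (proj₁ sy , p ∷ proj₂ sy) ∷ dropped p sy) i)
  ... | sy , sy∈ , here refl = keep (v-strip x sy∈)
  ... | sy , sy∈ , there j = go (v-strip x sy∈) j
    where
    go : ∀ {p s y r} → VStrip x y → r ∈ dropped p (s , y) → VStrip (p ∷ x) (proj₂ r)
    go {p} {s} {y} st r∈ with head₀ y <? p
    go {suc p} st (here refl) | yes (s≤s le) = shrink le st
    go {suc p} st (there ()) | yes _

  VStrip-≤ : ∀ {x y} → VStrip x y → sum y ≤ sum x
  VStrip-≤ [] = z≤n
  VStrip-≤ {p ∷ _} (keep s) = ℕₚ.+-monoʳ-≤ p (VStrip-≤ s)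
  VStrip-≤ (shrink _ s) = ℕₚ.+-mono-≤ (ℕₚ.n≤1+n _) (VStrip-≤ s)

  VStrip-Decr : ∀ {x y} → VStrip x y → Decr x → Decr y
  VStrip-Decr [] [] = []
  VStrip-Decr (keep s) (le ∷ d) = ℕₚ.≤-trans (first s) le ∷ VStrip-Decr s d
    where
    first : ∀ {x y} → VStrip x y → head₀ y ≤ head₀ x
    first [] = z≤n
    first (keep _) = ℕₚ.≤-refl
    first (shrink _ _) = ℕₚ.n≤1+n _
  VStrip-Decr (shrink le s) (_ ∷ d) = le ∷ VStrip-Decr s d

  -- By induction the two strips cancel on the lower rows and restore them to x. What is left is a
  -- sum over the lengths of the top row, which telescopes.
  h-v : ∀ {x} → Decr x → ∀ G → ∑ (h x) (λ y → ⟪ v y ⟫ G) ≡ G x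
  h-v [] G = trans (⊕-identityʳ _) (trans (⊕-identityʳ _) (⊗-identityˡ _))
  h-v {p ∷ x} (le ∷ d) G = begin
    _ ≡⟨ ∑-h p x _ ⟩
    _ ≡⟨ ∑-cong (upTo (suc p)) (λ q → cong (ind (head₀ x ≤? q) ⊗_)
           (trans (∑-cong (h x) (λ y → ∑-v q y G)) (h-v d (λ y → G (q ∷ y) ⊕ ⊝ (ind (head₀ y <? q) ⊗ G (pred q ∷ y)))))) ⟩
    _ ≡⟨ telescope (head₀ x) p (λ q → G (q ∷ x)) ⟩
    _ ≡⟨ 1⊗ le ⟩
    G (p ∷ x) ∎

  h-full : ∀ {x} → Decr x → ∀ G → ∑ (h x) (λ y → ind (sum y ≟ sum x) ⊗ G y) ≡ G x
  h-full [] G = trans (⊕-identityʳ _) (1⊗ refl)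
  h-full {p ∷ x} (le ∷ d) G = begin
    _ ≡⟨ ∑-h p x _ ⟩
    _ ≡⟨ ∑-upTo-last p _ (λ {q} q<p → trans (cong (ind (head₀ x ≤? q) ⊗_) (∑-zero (h x) (λ y∈ →
           0⊗ (ℕₚ.<⇒≢ (ℕₚ.+-mono-<-≤ q<p (HStrip-≤ (h-strip x y∈))))))) (⊗-zeroʳ _)) ⟩
    _ ≡⟨ 1⊗ le ⟩
    _ ≡⟨ ∑-cong (h x) (λ y → cong (_⊗ G (p ∷ y)) (ind-cong (ℕₚ.+-cancelˡ-≡ p _ _) (cong (p ℕ.+_)))) ⟩
    _ ≡⟨ h-full d (λ y → G (p ∷ y)) ⟩
    G (p ∷ x) ∎

  v-full : ∀ x G → ⟪ v x ⟫ (λ y → ind (sum y ≟ sum x) ⊗ G y) ≡ G x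
  v-full [] G = trans (⊕-identityʳ _) (trans (⊗-identityˡ _) (1⊗ refl))
  v-full (p ∷ x) G = begin
    _ ≡⟨ ∑-v p x _ ⟩
    _ ≡⟨ ∑-cong∈ (v x) (λ {sy} i → cong (proj₁ sy ⊗_) (trans (cong₂ _⊕_
           (cong (_⊗ G (p ∷ proj₂ sy)) (ind-cong (ℕₚ.+-cancelˡ-≡ p _ _) (cong (p ℕ.+_))))
           (trans (cong ⊝_ (trans (ind-guard (λ lt → 0⊗ (shrunk lt (VStrip-≤ (v-strip x i))))) (⊗-zeroʳ _))) ⊝-zero))
           (⊕-identityʳ _))) ⟩
    _ ≡⟨ v-full x (λ y → G (p ∷ y)) ⟩
    G (p ∷ x) ∎
    where
    shrunk : ∀ {a p b c} → a < p → b ≤ c → pred p ℕ.+ b ≢ p ℕ.+ c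
    shrunk {p = suc p} _ b≤c = ℕₚ.<⇒≢ (s≤s (ℕₚ.+-monoʳ-≤ p b≤c))

  calculus : StripCalculus
  calculus = record
    { Ok = Decr ; h = h ; v = v ; h-Ok = λ {x} _ i → HStrip-Decr (h-strip x i)
    ; v-≤ = λ {x} i → VStrip-≤ (v-strip x i) ; h-full = h-full
    ; v-full = λ {x} _ → v-full x ; h-v = h-v ; h-≤ = λ {x} _ i → HStrip-≤ (h-strip x i) }

  open StripCalculus calculus using (coef; E*-coef) public

  -- Conjugate partitions and triangularity

  support : List ℕ → ℕ
  support [] = 0
  support (zero ∷ x) = support x
  support (suc _ ∷ x) = suc (support x)

  -- the column lengths of x, provided that all rows have length at most w
  conj : ℕ → List ℕ → List ℕ
  conj zero x = []
  conj (suc w) x = support x ∷ conj w (map pred x)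

  sum-pred : ∀ x → sum (map pred x) ℕ.+ support x ≡ sum x
  sum-pred [] = refl
  sum-pred (zero ∷ x) = sum-pred x
  sum-pred (suc p ∷ x) = trans (ℕₚ.+-suc _ (support x)) (cong suc (trans (ℕₚ.+-assoc p _ _) (cong (p ℕ.+_) (sum-pred x))))

  head-pred : ∀ x → head₀ (map pred x) ≡ pred (head₀ x)
  head-pred [] = refl
  head-pred (_ ∷ _) = refl

  pred-Decr : ∀ {x} → Decr x → Decr (map pred x)
  pred-Decr [] = []
  pred-Decr {p ∷ x} (le ∷ d) = subst (_≤ pred p) (sym (head-pred x)) (ℕₚ.pred-mono-≤ le) ∷ pred-Decr d

  Decr-0 : ∀ {x} → Decr x → head₀ x ≤ 0 → sum x ≡ 0
  Decr-0 [] _ = refl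
  Decr-0 (le ∷ d) z≤n = Decr-0 d le

  length-conj : ∀ w x → length (conj w x) ≡ w
  length-conj zero x = refl
  length-conj (suc w) x = cong suc (length-conj w (map pred x))

  head-pred-≤ : ∀ {w} x → head₀ x ≤ suc w → head₀ (map pred x) ≤ w
  head-pred-≤ {w} x le = subst (_≤ w) (sym (head-pred x)) (ℕₚ.pred-mono-≤ le)

  sum-conj : ∀ w {x} → Decr x → head₀ x ≤ w → sum (conj w x) ≡ sum x
  sum-conj zero d le = sym (Decr-0 d le)
  sum-conj (suc w) {x} d le = trans (cong (support x ℕ.+_) (sum-conj w (pred-Decr d) (head-pred-≤ x le)))
    (trans (ℕₚ.+-comm (support x) _) (sum-pred x))

  ⋖-positive : ∀ {x y} → x ⋖ y → 0 < sum y
  ⋖-positive (here a<b) = ℕₚ.≤-trans (ℕₚ.≤-trans (s≤s z≤n) a<b) (ℕₚ.m≤m+n _ _)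
  ⋖-positive {_} {a ∷ _} (there l) = ℕₚ.≤-trans (⋖-positive l) (ℕₚ.m≤n+m _ a)

  -- Nonempty rows of x lose a cell each and rows of y at most one, so the first difference
  -- persists, or an earlier one appears where y keeps a nonempty row whole. If the first difference
  -- sits at an empty row of x, then x has no cells from there on, and fewer cells than y.
  ⋖-strip : ∀ {x y z} → Decr x → x ⋖ y → VStrip y z → map pred x ⋖ z ⊎ sum x < sum y
  ⋖-strip {zero ∷ x} (le ∷ d) (here a<b) s =
    inj₂ (subst (_< _) (sym (Decr-0 d le)) (ℕₚ.≤-trans a<b (ℕₚ.m≤m+n _ _)))
  ⋖-strip {suc a ∷ x} d (here a<b) (keep s) = inj₁ (here (ℕₚ.≤-trans (ℕₚ.n≤1+n _) a<b))
  ⋖-strip {suc a ∷ x} d (here (s≤s a<b)) (shrink _ s) = inj₁ (here a<b)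
  ⋖-strip {suc a ∷ x} d (there l) (keep s) = inj₁ (here (ℕₚ.≤-refl))
  ⋖-strip {zero ∷ x} (_ ∷ d) (there l) (keep s) with ⋖-strip d l s
  ... | inj₁ i = inj₁ (there i)
  ... | inj₂ i = inj₂ i
  ⋖-strip {suc a ∷ x} (_ ∷ d) (there l) (shrink _ s) with ⋖-strip d l s
  ... | inj₁ i = inj₁ (there i)
  ... | inj₂ i = inj₂ (s≤s (ℕₚ.+-monoʳ-< a i))

  -- Up to sign, the pairing with e_β counts the ways to dismantle y by vertical strips of the sizes
  -- in β. While x loses its columns one at a time, sizes agree and `⋖-strip` keeps the order, so y
  -- still has cells when x has none.
  E*-triangular : ∀ w {x y} → Decr x → Decr y → head₀ x ≤ w → sum x ≡ sum y → x ⋖ y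
    → E* (conj w x) (coef y) ≡ 0ℤ
  E*-triangular zero {x} {y} dx dy le e l =
    ind-no (λ z → ℕₚ.<⇒≢ (⋖-positive l) (sym z))
  E*-triangular (suc w) {x} {y} dx dy le e l = trans (E*-coef (support x) (conj w (map pred x)) dy)
    (∑-zero (v y) (λ {sz} i → trans (cong (proj₁ sz ⊗_) (trans (ind-guard (λ q →
      next (v-strip y i) q)) (⊗-zeroʳ _))) (⊗-zeroʳ _)))
    where
    next : ∀ {z} → VStrip y z → sum z ℕ.+ support x ≡ sum y → E* (conj w (map pred x)) (coef z) ≡ 0ℤ
    next s q with ⋖-strip dx l s
    ... | inj₁ l′ = E*-triangular w (pred-Decr dx) (VStrip-Decr s dy) (head-pred-≤ x le)
            (ℕₚ.+-cancelʳ-≡ (support x) _ _ (trans (sum-pred x) (trans e (sym q)))) l′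
    ... | inj₂ i = contradiction e (ℕₚ.<⇒≢ i)

  rowSign : List ℕ → ℤ
  rowSign [] = 1ℤ
  rowSign (zero ∷ x) = rowSign x
  rowSign (suc _ ∷ x) = ⊝ rowSign x

  -- Taking a cell from every nonempty row leaves the smallest result of a vertical strip, with one
  -- factor -1 for each such row. All other results are larger, where G vanishes.
  v-top : ∀ {x} → Decr x → ∀ G → (∀ {y} → VStrip x y → map pred x ⋖ y → G y ≡ 0ℤ)
    → ⟪ v x ⟫ G ≡ rowSign x ⊗ G (map pred x)
  v-top [] G e = ⊕-identityʳ _
  v-top {zero ∷ x} (_ ∷ d) G e = begin
    _ ≡⟨ ∑-v 0 x G ⟩
    _ ≡⟨ ∑-cong (v x) (λ p → cong (proj₁ p ⊗_) (trans (cong₂ _⊕_ refl (trans (cong ⊝_ (0⊗ (λ ()))) ⊝-zero)) (⊕-identityʳ _))) ⟩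
    _ ≡⟨ v-top d (λ y → G (0 ∷ y)) (λ s l → e (keep s) (there l)) ⟩
    _ ∎
  v-top {suc p ∷ x} (le ∷ d) G e = begin
    _ ≡⟨ ∑-v (suc p) x G ⟩
    _ ≡⟨ ∑-cong∈ (v x) (λ {sy} i → cong (proj₁ sy ⊗_)
           (trans (cong₂ _⊕_ (e (keep (v-strip x i)) (here ℕₚ.≤-refl)) refl) (⊕-identityˡ _))) ⟩
    ⟪ v x ⟫ G′ ≡⟨ v-top d G′ (λ {y} s l → trans (cong ⊝_ (trans (ind-guard {b = 0ℤ}
           (λ { (s≤s lt) → e (shrink lt s) (there l) })) (⊗-zeroʳ _))) ⊝-zero) ⟩
    rowSign x ⊗ ⊝ (ind (head₀ (map pred x) <? suc p) ⊗ G (p ∷ map pred x))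
      ≡⟨ cong (λ c → rowSign x ⊗ ⊝ c) (1⊗ (s≤s (head-pred-≤ x le))) ⟩
    rowSign x ⊗ ⊝ G (p ∷ map pred x) ≡⟨ trans (sym (⊝-⊗ʳ (rowSign x) _)) (⊝-⊗ˡ (rowSign x) _) ⟩
    ⊝ rowSign x ⊗ G (p ∷ map pred x) ∎
    where
    G′ : List ℕ → ℤ
    G′ y = ⊝ (ind (head₀ y <? suc p) ⊗ G (p ∷ y))

  Sign : ℤ → Set
  Sign u = u ≡ 1ℤ ⊎ u ≡ ⊝ 1ℤ

  ⊝-Sign : ∀ {u} → Sign u → Sign (⊝ u)
  ⊝-Sign (inj₁ e) = inj₂ (cong ⊝_ e)
  ⊝-Sign (inj₂ e) = inj₁ (trans (cong ⊝_ e) (⊝-involutive 1ℤ))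

  ⊗-Sign : ∀ {u w} → Sign u → Sign w → Sign (u ⊗ w)
  ⊗-Sign {w = w} (inj₁ e) s = subst Sign (sym (trans (cong (_⊗ w) e) (⊗-identityˡ w))) s
  ⊗-Sign {w = w} (inj₂ e) s =
    subst Sign (sym (trans (cong (_⊗ w) e) (trans (sym (⊝-⊗ˡ 1ℤ w)) (cong ⊝_ (⊗-identityˡ w))))) (⊝-Sign s)

  rowSign-Sign : ∀ x → Sign (rowSign x)
  rowSign-Sign [] = inj₁ refl
  rowSign-Sign (zero ∷ x) = rowSign-Sign x
  rowSign-Sign (suc _ ∷ x) = ⊝-Sign (rowSign-Sign x)

  -- Only the removal of the full first column survives, since `E*-triangular` kills the larger
  -- remainders. The diagonal is thus a unit, and the system can be solved over the integers.
  E*-diagonal : ∀ w {x} → Decr x → head₀ x ≤ w → Sign (E* (conj w x) (coef x))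
  E*-diagonal zero d le = inj₁ (ind-yes (Decr-0 d le))
  E*-diagonal (suc w) {x} d le = subst Sign (sym eq)
      (⊗-Sign (rowSign-Sign x) (E*-diagonal w (pred-Decr d) (head-pred-≤ x le)))
    where
    β = conj w (map pred x)
    eq : E* (support x ∷ β) (coef x) ≡ rowSign x ⊗ E* β (coef (map pred x))
    eq = begin
      _ ≡⟨ E*-coef (support x) β d ⟩
      _ ≡⟨ v-top d _ (λ s l → trans (ind-guard (λ q → E*-triangular w (pred-Decr d) (VStrip-Decr s d) (head-pred-≤ x le)
             (ℕₚ.+-cancelʳ-≡ (support x) _ _ (trans (sum-pred x) (sym q))) l)) (⊗-zeroʳ _)) ⟩
      _ ≡⟨ cong (rowSign x ⊗_) (1⊗ (sum-pred x)) ⟩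
      _ ∎

-- Words and tableaux

∑-upTo-head : ∀ n (f : ℕ → ℤ) → ∑ (upTo (suc n)) f ≡ f 0 ⊕ ∑ (upTo n) (λ q → f (suc q))
∑-upTo-head n f = cong (f 0 ⊕_) (trans (cong (λ xs → ∑ xs f) (sym (map-upTo suc n))) (∑-map suc (upTo n) f))

words : ℕ → ℕ → List (List ℕ)
words n zero = [] ∷ []
words n (suc p) = concatMap (λ i → map (i ∷_) (words n p)) (upTo n)

∑-words : ∀ n p f → ∑ (words n (suc p)) f ≡ ∑ (upTo n) (λ i → ∑ (words n p) (λ w → f (i ∷ w)))
∑-words n p f = trans (∑-concatMap (λ i → map (i ∷_) (words n p)) (upTo n) f)
  (∑-cong (upTo n) (λ i → ∑-map (i ∷_) (words n p) f))

∑-words-++ : ∀ n p s f → ∑ (words n (p ℕ.+ s)) f ≡ ∑ (words n p) (λ w → ∑ (words n s) (λ u → f (w ++ u)))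
∑-words-++ n zero s f = sym (⊕-identityʳ _)
∑-words-++ n (suc p) s f = begin
  _ ≡⟨ ∑-words n (p ℕ.+ s) f ⟩
  _ ≡⟨ ∑-cong (upTo n) (λ i → ∑-words-++ n p s (λ w → f (i ∷ w))) ⟩
  _ ≡⟨ ∑-words n p (λ w → ∑ (words n s) (λ u → f (w ++ u))) ⟨
  _ ∎

words-length : ∀ n p {w} → w ∈ words n p → length w ≡ p
words-length n zero (here refl) = refl
words-length n (suc p) w∈ with find (∈-concatMap⁻ (λ i → map (i ∷_) (words n p)) {upTo n} w∈)
... | i , _ , j with ∈-map⁻ (i ∷_) j
...   | _ , k , refl = cong suc (words-length n p k)

words-bound : ∀ n p {w} → w ∈ words n p → All (_< n) w
words-bound n zero (here refl) = []
words-bound n (suc p) w∈ with find (∈-concatMap⁻ (λ i → map (i ∷_) (words n p)) {upTo n} w∈)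
... | i , i∈ , j with ∈-map⁻ (i ∷_) j
...   | _ , k , refl = ∈-upTo⁻ i∈ ∷ words-bound n p k

Sorted : List ℕ → Set
Sorted = Linked _≤_

sorted? : ∀ w → Dec (Sorted w)
sorted? = linked? _≤?_

HeadGe : ℕ → List ℕ → Set
HeadGe i [] = ⊤
HeadGe i (x ∷ _) = i ≤ x

headGe? : ∀ i w → Dec (HeadGe i w)
headGe? i [] = yes tt
headGe? i (x ∷ _) = i ≤? x

sorted-∷ : ∀ i w → ind (sorted? (i ∷ w)) ≡ ind (sorted? w) ⊗ ind (headGe? i w)
sorted-∷ i w = trans (ind-cong to from) (ind-× (sorted? w) (headGe? i w))
  where
  to : ∀ {i w} → Sorted (i ∷ w) → Sorted w × HeadGe i w
  to [-] = [] , tt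
  to (le ∷ s) = s , le
  from : ∀ {i w} → Sorted w × HeadGe i w → Sorted (i ∷ w)
  from {w = []} _ = [-]
  from {w = _ ∷ _} (s , le) = le ∷ s

-- Generated by appending copies of the largest letter, so that each row of a tableau comes already
-- divided into its smaller letters and its copies of N.
sortedWords : ℕ → ℕ → List (List ℕ)
sortedWords zero zero = [] ∷ []
sortedWords zero (suc p) = []
sortedWords (suc N) p = concatMap (λ q → map (_++ replicate (p ∸ q) N) (sortedWords N q)) (upTo (suc p))

∑-sortedWords : ∀ N p f → ∑ (sortedWords (suc N) p) f
  ≡ ∑ (upTo (suc p)) (λ q → ∑ (sortedWords N q) (λ w → f (w ++ replicate (p ∸ q) N)))
∑-sortedWords N p f = trans (∑-concatMap (λ q → map (_++ replicate (p ∸ q) N) (sortedWords N q)) (upTo (suc p)) f)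
  (∑-cong (upTo (suc p)) (λ q → ∑-map (_++ replicate (p ∸ q) N) (sortedWords N q) f))

-- Induction on the length through the first letter: below N it joins the smaller letters; if it
-- equals N, sortedness makes the whole word constant.
split-largest : ∀ N p f → ∑ (words (suc N) p) (λ w → ind (sorted? w) ⊗ f w)
  ≡ ∑ (upTo (suc p)) (λ q → ∑ (words N q) (λ w → ind (sorted? w) ⊗ f (w ++ replicate (p ∸ q) N)))
split-largest N zero f = sym (⊕-identityʳ _)
split-largest N (suc p) f = begin
  _ ≡⟨ ∑-words (suc N) p _ ⟩
  ∑ (upTo (suc N)) (λ i → ∑ (words (suc N) p) (λ w → ind (sorted? (i ∷ w)) ⊗ f (i ∷ w)))
    ≡⟨ ∑-cong (upTo (suc N)) (λ i → trans
         (∑-cong (words (suc N) p) (λ w → trans (cong (_⊗ f (i ∷ w)) (sorted-∷ i w)) (⊗-assoc _ _ _)))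
         (split-largest N p (λ w → ind (headGe? i w) ⊗ f (i ∷ w)))) ⟩
  ∑ (upTo (suc N)) body ≡⟨ ∑-upTo N body ⟩
  ∑ (upTo N) body ⊕ body N ≡⟨ cong₂ _⊕_ (∑-cong∈ (upTo N) (λ {i} i∈ → small i (∈-upTo⁻ i∈))) largest ⟩
  ∑ (upTo N) (λ i → ∑ (upTo (suc p)) (λ q → tail i q)) ⊕ f (replicate (suc p) N)
    ≡⟨ cong (_⊕ f (replicate (suc p) N)) (∑-swap (upTo N) (upTo (suc p)) tail) ⟩
  ∑ (upTo (suc p)) (λ q → ∑ (upTo N) (λ i → tail i q)) ⊕ f (replicate (suc p) N)
    ≡⟨ ⊕-comm _ _ ⟩
  f (replicate (suc p) N) ⊕ ∑ (upTo (suc p)) (λ q → ∑ (upTo N) (λ i → tail i q))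
    ≡⟨ cong₂ _⊕_ (sym (trans (⊕-identityʳ _) (1⊗ []))) (∑-cong (upTo (suc p)) (λ q → sym (∑-words N q _))) ⟩
  G 0 ⊕ ∑ (upTo (suc p)) (λ q → G (suc q)) ≡⟨ ∑-upTo-head (suc p) G ⟨
  ∑ (upTo (suc (suc p))) G ∎
  where
  G : ℕ → ℤ
  G q = ∑ (words N q) (λ w → ind (sorted? w) ⊗ f (w ++ replicate (suc p ∸ q) N))
  body : ℕ → ℤ
  body i = ∑ (upTo (suc p)) (λ q → ∑ (words N q) (λ w → ind (sorted? w) ⊗
    (ind (headGe? i (w ++ replicate (p ∸ q) N)) ⊗ f (i ∷ w ++ replicate (p ∸ q) N))))
  tail : ℕ → ℕ → ℤ
  tail i q = ∑ (words N q) (λ w → ind (sorted? (i ∷ w)) ⊗ f (i ∷ w ++ replicate (p ∸ q) N))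
  small : ∀ i → i < N → body i ≡ ∑ (upTo (suc p)) (tail i)
  small i i<N = ∑-cong (upTo (suc p)) (λ q → ∑-cong (words N q) (λ w → trans (sym (⊗-assoc _ _ _))
    (cong (_⊗ f (i ∷ w ++ replicate (p ∸ q) N)) (trans
      (cong (ind (sorted? w) ⊗_) (ind-cong (to w) (from w (p ∸ q)))) (sym (sorted-∷ i w))))))
    where
    to : ∀ w {r} → HeadGe i (w ++ r) → HeadGe i w
    to [] _ = tt
    to (_ ∷ _) le = le
    from : ∀ w e → HeadGe i w → HeadGe i (w ++ replicate e N)
    from [] zero _ = tt
    from [] (suc e) _ = ℕₚ.<⇒≤ i<N
    from (_ ∷ _) e le = le
  replicate-headGe : ∀ e → HeadGe N (replicate e N)
  replicate-headGe zero = tt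
  replicate-headGe (suc e) = ℕₚ.≤-refl
  largest : body N ≡ f (replicate (suc p) N)
  largest = begin
    body N ≡⟨ ∑-upTo-head p _ ⟩
    _ ≡⟨ cong₂ _⊕_ (trans (⊕-identityʳ _) (trans (1⊗ []) (1⊗ (replicate-headGe p))))
           (∑-zero (upTo p) (λ {q} _ → ∑-zero (words N (suc q)) (λ w∈ → trans
             (cong₂ _⊗_ refl (0⊗ (notHead (words-length N (suc q) w∈) (words-bound N (suc q) w∈)))) (⊗-zeroʳ _)))) ⟩
    f (N ∷ replicate p N) ⊕ 0ℤ ≡⟨ ⊕-identityʳ _ ⟩
    f (replicate (suc p) N) ∎
    where
    notHead : ∀ {w q r} → length w ≡ suc q → All (_< N) w → ¬ HeadGe N (w ++ r)
    notHead {_ ∷ _} _ (lt ∷ _) le = ℕₚ.<-irrefl refl (ℕₚ.≤-trans lt le)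

∑-sorted : ∀ N p f → ∑ (words N p) (λ w → ind (sorted? w) ⊗ f w) ≡ ∑ (sortedWords N p) f
∑-sorted zero zero f = cong (_⊕ 0ℤ) (1⊗ [])
∑-sorted zero (suc p) f = refl
∑-sorted (suc N) p f = begin
  _ ≡⟨ split-largest N p f ⟩
  _ ≡⟨ ∑-cong (upTo (suc p)) (λ q → ∑-sorted N q (λ w → f (w ++ replicate (p ∸ q) N))) ⟩
  _ ≡⟨ ∑-sortedWords N p f ⟨
  _ ∎

sortedWords-∈ : ∀ N p {w} → w ∈ sortedWords N p → length w ≡ p × All (_< N) w
sortedWords-∈ zero zero (here refl) = refl , []
sortedWords-∈ (suc N) p w∈
  with find (∈-concatMap⁻ (λ q → map (_++ replicate (p ∸ q) N) (sortedWords N q)) {upTo (suc p)} w∈)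
... | q , q∈ , j with ∈-map⁻ (_++ replicate (p ∸ q) N) j
...   | w , k , refl with sortedWords-∈ N q k | ∈-upTo⁻ q∈
...     | l , b | s≤s q≤p = len , Allₚ.++⁺ (All.map (λ lt → ℕₚ.≤-trans lt (ℕₚ.n≤1+n N)) b) (Allₚ.replicate⁺ (p ∸ q) ℕₚ.≤-refl)
  where
  len : length (w ++ replicate (p ∸ q) N) ≡ p
  len = trans (length-++ w) (trans (cong₂ ℕ._+_ l (length-replicate (p ∸ q))) (ℕₚ.m+[n∸m]≡n q≤p))

-- w fits below the row whose entries are one less than the bounds bs (bounds 0: no row above)
data Col : List ℕ → List ℕ → Set where
  [] : ∀ {bs} → Col bs []
  _∷_ : ∀ {b bs a w} → b ≤ a → Col bs w → Col (b ∷ bs) (a ∷ w)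

col? : ∀ bs w → Dec (Col bs w)
col? bs [] = yes []
col? [] (a ∷ w) = no (λ ())
col? (b ∷ bs) (a ∷ w) with b ≤? a | col? bs w
... | yes le | yes c = yes (le ∷ c)
... | no ¬le | _ = no (λ { (le ∷ _) → ¬le le })
... | _ | no ¬c = no (λ { (_ ∷ c) → ¬c c })

-- flattened tableaux of shape sh over 0, …, N-1 whose first row fits under bs
tableaux : ℕ → List ℕ → List ℕ → List (List ℕ)
tableaux N bs [] = [] ∷ []
tableaux N bs (p ∷ sh) =
  concatMap (λ w → map (w ++_) (tableaux N (map suc w) sh)) (filter (col? bs) (sortedWords N p))

∑-tableaux : ∀ N bs p sh f → ∑ (tableaux N bs (p ∷ sh)) f
  ≡ ∑ (sortedWords N p) (λ w → ind (col? bs w) ⊗ ∑ (tableaux N (map suc w) sh) (λ u → f (w ++ u)))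
∑-tableaux N bs p sh f = begin
  _ ≡⟨ ∑-concatMap (λ w → map (w ++_) (tableaux N (map suc w) sh)) (filter (col? bs) (sortedWords N p)) f ⟩
  _ ≡⟨ ∑-filter (col? bs) (sortedWords N p) _ ⟩
  _ ≡⟨ ∑-cong (sortedWords N p) (λ w → cong (ind (col? bs w) ⊗_) (∑-map (w ++_) (tableaux N (map suc w) sh) f)) ⟩
  _ ∎

count : ℕ → List ℕ → ℕ
count a w = length (filter (_≟ a) w)

below : ℕ → List ℕ → List ℕ
below N = filter (_<? N)

count-++ : ∀ a w u → count a (w ++ u) ≡ count a w ℕ.+ count a u
count-++ a w u = trans (cong length (filter-++ (_≟ a) w u)) (length-++ (filter (_≟ a) w))

count-row : ∀ {N w} e → All (_< N) w → count N (w ++ replicate e N) ≡ e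
count-row {N} {w} e b = trans (count-++ N w (replicate e N)) (cong₂ ℕ._+_
  (cong length (filter-none (_≟ N) (All.map ℕₚ.<⇒≢ b)))
  (trans (cong length (filter-all (_≟ N) (Allₚ.replicate⁺ e refl))) (length-replicate e)))

below-row : ∀ {N w} e → All (_< N) w → below N (w ++ replicate e N) ≡ w
below-row {N} {w} e b = trans (filter-++ (_<? N) w _) (trans (cong₂ _++_
  (filter-all (_<? N) b) (filter-none (_<? N) (Allₚ.replicate⁺ e (ℕₚ.<-irrefl refl)))) (++-identityʳ w))

-- A bound N + 1 admits no letter up to N, while a bound in `bs` admits N. So the copies of N are
-- restricted only by the length of `bs`.
Col-row : ∀ {N bs w} e f → All (_≤ N) bs → All (_< N) w →
  (Col (bs ++ replicate e (suc N)) (w ++ replicate f N) → Col bs w × length w ℕ.+ f ≤ length bs)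
Col-row {bs = []} zero zero [] [] c = [] , z≤n
Col-row {bs = []} (suc e) zero [] [] c = [] , z≤n
Col-row {bs = []} (suc e) (suc f) [] [] (le ∷ _) = contradiction le ℕₚ.1+n≰n
Col-row {bs = []} (suc e) f [] (lt ∷ _) (le ∷ _) = contradiction (ℕₚ.<-trans lt le) ℕₚ.1+n≰n
Col-row {bs = b ∷ bs} e zero (bb ∷ B) [] c = [] , z≤n
Col-row {bs = b ∷ bs} e (suc f) (bb ∷ B) [] (le ∷ c) = [] , s≤s (proj₂ (Col-row e f B [] c))
Col-row {bs = b ∷ bs} e f (bb ∷ B) (lt ∷ W) (le ∷ c) with Col-row e f B W c
... | d , l = (le ∷ d) , s≤s l

row-Col : ∀ {N bs w} e f → All (_≤ N) bs → (Col bs w × length w ℕ.+ f ≤ length bs)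
  → Col (bs ++ replicate e (suc N)) (w ++ replicate f N)
row-Col {w = []} e zero B (c , l) = []
row-Col {w = []} e (suc f) (bb ∷ B) (c , s≤s l) = bb ∷ row-Col e f B ([] , l)
row-Col {w = _ ∷ _} e f (bb ∷ B) (le ∷ c , s≤s l) = le ∷ row-Col e f B (c , l)

-- Deleting the letter N leaves a tableau whose shape differs from sh by a horizontal strip: nothing
-- may stand below the e copies of N in the row above, so a row is at most as long as the part of
-- the previous row with smaller letters. `K` is arbitrary because the induction over the rows
-- prepends a row to the word and adds its copies of N to the count.
tableaux-largest : ∀ N bs e sh (K : ℕ → List ℕ → ℤ) → All (_≤ N) bs →
  ∑ (tableaux (suc N) (bs ++ replicate e (suc N)) sh) (λ t → K (count N t) (below N t))
  ≡ ind (head₀ sh ≤? length bs) ⊗ ∑ (Schur.h sh) (λ μ → ∑ (tableaux N bs μ) (K (sum sh ∸ sum μ)))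
tableaux-largest N bs e [] K B = sym (trans (1⊗ z≤n) (⊕-identityʳ _))
tableaux-largest N bs e (p ∷ sh) K B = begin
  _ ≡⟨ ∑-tableaux (suc N) bs′ p sh _ ⟩
  _ ≡⟨ ∑-sortedWords N p _ ⟩
  ∑ (upTo (suc p)) (λ q → ∑ (sortedWords N q) (λ w → ind (col? bs′ (w ++ rep q)) ⊗
    ∑ (tableaux (suc N) (map suc (w ++ rep q)) sh) (λ u → K (count N ((w ++ rep q) ++ u)) (below N ((w ++ rep q) ++ u)))))
    ≡⟨ ∑-cong∈ (upTo (suc p)) (λ {q} q∈ → ∑-cong∈ (sortedWords N q) (λ {w} w∈ → row q w (∈-upTo⁻ q∈) (sortedWords-∈ N q w∈))) ⟩
  ∑ (upTo (suc p)) (λ q → ∑ (sortedWords N q) (λ w → d ⊗ (ind (head₀ sh ≤? q) ⊗ ∑ (Schur.h sh) (λ μ → term q w μ))))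
    ≡⟨ ∑-cong (upTo (suc p)) (λ q → trans (∑-⊗ˡ d (sortedWords N q) _) (cong (d ⊗_) (trans
         (∑-⊗ˡ (ind (head₀ sh ≤? q)) (sortedWords N q) _) (cong (ind (head₀ sh ≤? q) ⊗_)
         (trans (∑-swap (sortedWords N q) (Schur.h sh) (term q)) (∑-cong (Schur.h sh) (λ μ → sym (∑-tableaux N bs q μ _)))))))) ⟩
  _ ≡⟨ ∑-⊗ˡ d (upTo (suc p)) _ ⟩
  _ ≡⟨ cong (d ⊗_) (Schur.∑-h p sh _) ⟨
  _ ∎
  where
  bs′ = bs ++ replicate e (suc N)
  d = ind (p ≤? length bs)
  rep : ℕ → List ℕ
  rep q = replicate (p ∸ q) N
  term : ℕ → List ℕ → List ℕ → ℤ
  term q w μ = ind (col? bs w) ⊗ ∑ (tableaux N (map suc w) μ) (λ u → K ((p ℕ.+ sum sh) ∸ (q ℕ.+ sum μ)) (w ++ u))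
  row : ∀ q w → q < suc p → length w ≡ q × All (_< N) w →
    ind (col? bs′ (w ++ rep q)) ⊗
    ∑ (tableaux (suc N) (map suc (w ++ rep q)) sh) (λ u → K (count N ((w ++ rep q) ++ u)) (below N ((w ++ rep q) ++ u)))
    ≡ d ⊗ (ind (head₀ sh ≤? q) ⊗ ∑ (Schur.h sh) (λ μ → term q w μ))
  row q w (s≤s q≤p) (refl , W) = begin
    _ ≡⟨ cong₂ _⊗_ (trans (ind-cong
           (λ c → subst (_≤ length bs) (ℕₚ.m+[n∸m]≡n q≤p) (proj₂ (split c)) , proj₁ (split c))
           (λ { (l , c) → row-Col e (p ∸ q) B (c , subst (_≤ length bs) (sym (ℕₚ.m+[n∸m]≡n q≤p)) l) }))
             (ind-× (p ≤? length bs) (col? bs w)))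
         (trans (cong (λ z → ∑ (tableaux (suc N) z sh) (λ u → K (count N ((w ++ rep q) ++ u)) (below N ((w ++ rep q) ++ u)))) (trans (map-++ suc w (rep q)) (cong (map suc w ++_) (map-replicate suc (p ∸ q) N))))
         (trans (∑-cong (tableaux (suc N) (map suc w ++ replicate (p ∸ q) (suc N)) sh) (λ u → cong₂ K
             (trans (count-++ N (w ++ rep q) u) (cong (ℕ._+ count N u) (count-row (p ∸ q) W)))
             (trans (filter-++ (_<? N) (w ++ rep q) u) (cong (_++ below N u) (below-row (p ∸ q) W)))))
         (trans (tableaux-largest N (map suc w) (p ∸ q) sh (λ c u → K (p ∸ q ℕ.+ c) (w ++ u)) (Allₚ.map⁺ W))
         (cong (λ z → ind (head₀ sh ≤? z) ⊗ ∑ (Schur.h sh) (λ μ → ∑ (tableaux N (map suc w) μ) (λ u → K (p ∸ q ℕ.+ (sum sh ∸ sum μ)) (w ++ u))))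
           (length-map suc w))))) ⟩
    (d ⊗ c) ⊗ (i ⊗ ∑ (Schur.h sh) (λ μ → ∑ (tableaux N (map suc w) μ) (λ u → K (p ∸ q ℕ.+ (sum sh ∸ sum μ)) (w ++ u))))
      ≡⟨ trans (⊗-assoc d c _) (cong (d ⊗_) (trans (⊗-swap c i _) (cong (i ⊗_) (sym (∑-⊗ˡ c (Schur.h sh) _))))) ⟩
    d ⊗ (i ⊗ ∑ (Schur.h sh) (λ μ → c ⊗ ∑ (tableaux N (map suc w) μ) (λ u → K (p ∸ q ℕ.+ (sum sh ∸ sum μ)) (w ++ u))))
      ≡⟨ cong (λ z → d ⊗ (i ⊗ z)) (∑-cong∈ (Schur.h sh) (λ {μ} μ∈ → cong (c ⊗_) (∑-cong (tableaux N (map suc w) μ)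
           (λ u → cong (λ z → K z (w ++ u)) (sizes (Schur.HStrip-≤ (Schur.h-strip sh μ∈))))))) ⟩
    d ⊗ (i ⊗ ∑ (Schur.h sh) (λ μ → term q w μ)) ∎
    where
    c = ind (col? bs w)
    i = ind (head₀ sh ≤? q)
    split = Col-row {N} {bs} {w} e (p ∸ q) B W
    sizes : ∀ {b} → b ≤ sum sh → p ∸ q ℕ.+ (sum sh ∸ b) ≡ (p ℕ.+ sum sh) ∸ (q ℕ.+ b)
    sizes {b} b≤ = begin
      p ∸ q ℕ.+ (sum sh ∸ b) ≡⟨ ℕₚ.+-∸-assoc (p ∸ q) b≤ ⟨
      (p ∸ q ℕ.+ sum sh) ∸ b ≡⟨ cong (_∸ b) (ℕₚ.+-∸-comm (sum sh) q≤p) ⟨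
      (p ℕ.+ sum sh) ∸ q ∸ b ≡⟨ ℕₚ.∸-+-assoc (p ℕ.+ sum sh) q b ⟩
      (p ℕ.+ sum sh) ∸ (q ℕ.+ b) ∎

-- α lists the multiplicities of the letters, the largest letter first
HasContent : List ℕ → List ℕ → Set
HasContent [] t = ⊤
HasContent (j ∷ α) t = count (length α) t ≡ j × HasContent α t

hasContent? : ∀ α t → Dec (HasContent α t)
hasContent? [] t = yes tt
hasContent? (j ∷ α) t = (count (length α) t ≟ j) ×-dec hasContent? α t

count-below : ∀ {a N} t → a < N → count a (below N t) ≡ count a t
count-below [] lt = refl
count-below {a} {N} (x ∷ t) lt = go (x <? N)
  where
  step : Dec (x ≡ a) → count a (x ∷ below N t) ≡ count a (x ∷ t)
  step (yes e) = trans (cong length (filter-accept (_≟ a) {xs = below N t} e))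
    (trans (cong suc (count-below t lt)) (sym (cong length (filter-accept (_≟ a) {xs = t} e))))
  step (no ne) = trans (cong length (filter-reject (_≟ a) {xs = below N t} ne))
    (trans (count-below t lt) (sym (cong length (filter-reject (_≟ a) {xs = t} ne))))
  go : Dec (x < N) → count a (below N (x ∷ t)) ≡ count a (x ∷ t)
  go (yes b) = trans (cong (count a) (filter-accept (_<? N) {xs = t} b)) (step (x ≟ a))
  go (no ¬b) = trans (cong (count a) (filter-reject (_<? N) {xs = t} ¬b)) (trans (count-below t lt)
    (sym (cong length (filter-reject (_≟ a) {xs = t} (λ e → ¬b (subst (_< N) (sym e) lt))))))

HasContent-below : ∀ α {N t} → length α ≤ N → HasContent α (below N t) → HasContent α t
HasContent-below [] le _ = tt
HasContent-below (j ∷ α) {t = t} le (e , c) = trans (sym (count-below t le)) e , HasContent-below α (ℕₚ.<⇒≤ le) c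

below-HasContent : ∀ α {N t} → length α ≤ N → HasContent α t → HasContent α (below N t)
below-HasContent [] le _ = tt
below-HasContent (j ∷ α) {t = t} le (e , c) = trans (count-below t le) e , below-HasContent α (ℕₚ.<⇒≤ le) c

tableaux-zero : ∀ bs sh f → ∑ (tableaux 0 bs sh) f ≡ ind (sum sh ≟ 0) ⊗ f []
tableaux-zero bs [] f = trans (⊕-identityʳ _) (sym (1⊗ refl))
tableaux-zero bs (zero ∷ sh) f = trans (∑-tableaux 0 bs 0 sh f) (trans (⊕-identityʳ _)
  (trans (1⊗ []) (tableaux-zero [] sh f)))
tableaux-zero bs (suc p ∷ sh) f = trans (∑-tableaux 0 bs (suc p) sh f) (sym (0⊗ (λ ())))

-- Bounds 0 over the whole first row impose no condition. Deleting the letters from the largest down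
-- is then the recursion of `Schur.coef`.
tableaux-coef : ∀ α m sh → head₀ sh ≤ m →
  ∑ (tableaux (length α) (replicate m 0) sh) (λ t → ind (hasContent? α t)) ≡ Schur.coef sh α
tableaux-coef [] m sh le = trans (tableaux-zero _ sh _) (trans (cong (ind (sum sh ≟ 0) ⊗_) (ind-yes tt)) (⊗-identityʳ _))
tableaux-coef (j ∷ α) m sh le = begin
  _ ≡⟨ ∑-cong (tableaux (suc N) (replicate m 0) sh) (λ t → trans (ind-× (count N t ≟ j) (hasContent? α t))
         (cong (ind (count N t ≟ j) ⊗_) (ind-cong (below-HasContent α ℕₚ.≤-refl) (HasContent-below α ℕₚ.≤-refl)))) ⟩
  _ ≡⟨ cong (λ z → ∑ (tableaux (suc N) z sh) (λ t → K (count N t) (below N t))) (++-identityʳ (replicate m 0)) ⟨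
  _ ≡⟨ tableaux-largest N (replicate m 0) 0 sh K (Allₚ.replicate⁺ m z≤n) ⟩
  _ ≡⟨ 1⊗ (subst (head₀ sh ≤_) (sym (length-replicate m)) le) ⟩
  ∑ (Schur.h sh) (λ μ → ∑ (tableaux N (replicate m 0) μ) (K (sum sh ∸ sum μ)))
    ≡⟨ ∑-cong∈ (Schur.h sh) (λ {μ} μ∈ → trans (∑-⊗ˡ (ind (sum sh ∸ sum μ ≟ j)) (tableaux N (replicate m 0) μ) _)
         (cong₂ _⊗_ (size (Schur.HStrip-≤ (Schur.h-strip sh μ∈)))
           (tableaux-coef α m μ (ℕₚ.≤-trans (first (Schur.h-strip sh μ∈)) le)))) ⟩
  Schur.coef sh (j ∷ α) ∎
  where
  N = length α
  K : ℕ → List ℕ → ℤ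
  K c u = ind (c ≟ j) ⊗ ind (hasContent? α u)
  size : ∀ {b} → b ≤ sum sh → ind (sum sh ∸ b ≟ j) ≡ ind (b ℕ.+ j ≟ sum sh)
  size {b} b≤ = ind-cong (λ e → trans (cong (b ℕ.+_) (sym e)) (ℕₚ.m+[n∸m]≡n b≤))
    (λ e → trans (cong (_∸ b) (sym e)) (ℕₚ.m+n∸m≡n b j))
  first : ∀ {x y} → Schur.HStrip x y → head₀ y ≤ head₀ x
  first Schur.[] = z≤n
  first (Schur.row _ q≤p _) = q≤p

-- The Schur coefficients of the definitions

_⇔_ : Set → Set → Set
A ⇔ B = (A → B) × (B → A)

countB-∑ : {A : Set} (p : A → Bool) (xs : List A) → + countB p xs ≡ ∑ xs (λ x → ind (T? (p x)))
countB-∑ p [] = refl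
countB-∑ p (x ∷ xs) with p x
... | true = trans (trans (sym (⊕≡+ 1ℤ (+ countB p xs))) (cong (1ℤ ⊕_) (countB-∑ p xs))) (cong₂ _⊕_ (sym (ind-yes tt)) refl)
... | false = trans (countB-∑ p xs) (trans (sym (⊕-identityˡ _)) (cong₂ _⊕_ (sym (ind-no (λ ()))) refl))

T-∧ : ∀ {a b} → T (a ∧ b) ⇔ (T a × T b)
T-∧ {true} = (λ t → tt , t) , proj₂
T-∧ {false} = (λ ()) , (λ ())

T-if : ∀ {a b} → T (if a then b else true) ⇔ (T a → T b)
T-if {true} = (λ t _ → t) , (λ f → f tt)
T-if {false} = (λ _ ()) , (λ _ → tt)

T-allB : {A : Set} {p : A → Bool} (xs : List A) → T (allB p xs) ⇔ (∀ {x} → x ∈ xs → T (p x))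
T-allB [] = (λ _ ()) , (λ _ → tt)
T-allB {p = p} (x ∷ xs) =
  (λ t → λ { (here refl) → proj₁ (proj₁ T-∧ t) ; (there i) → proj₁ (T-allB xs) (proj₂ (proj₁ (T-∧ {p x}) t)) i }) ,
  (λ f → proj₂ T-∧ (f (here refl) , proj₂ (T-allB xs) (λ i → f (there i))))

T-==ᶠ : ∀ {n} {i j : Fin n} → T (i ==ᶠ j) ⇔ (i ≡ j)
T-==ᶠ {i = i} {j} = (λ t → Fₚ.toℕ-injective (ℕₚ.≡ᵇ⇒≡ (toℕ i) (toℕ j) t)) , (λ e → ℕₚ.≡⇒≡ᵇ (toℕ i) (toℕ j) (cong toℕ e))

T-vecEqB : ∀ {n} (xs ys : Vec ℕ n) → T (vecEqB xs ys) ⇔ (∀ i → V.lookup xs i ≡ V.lookup ys i)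
T-vecEqB [] [] = (λ _ ()) , (λ _ → tt)
T-vecEqB (x ∷ xs) (y ∷ ys) =
  (λ t → λ { zero → ℕₚ.≡ᵇ⇒≡ x y (proj₁ (proj₁ T-∧ t)) ; (suc i) → proj₁ (T-vecEqB xs ys) (proj₂ (proj₁ (T-∧ {x ≡ᵇ y}) t)) i }) ,
  (λ e → proj₂ T-∧ (ℕₚ.≡⇒≡ᵇ x y (e zero) , proj₂ (T-vecEqB xs ys) (λ i → e (suc i))))

-- There is no constructor for a missing entry, just as `leM` and `ltM` are false there.
data RelM (R : ℕ → ℕ → Set) : Maybe ℕ → Maybe ℕ → Set where
  just : ∀ {a b} → R a b → RelM R (just a) (just b)

unjust : ∀ {R a b} → RelM R (just a) (just b) → R a b
unjust (just r) = r

nth-++ˡ : {A : Set} (w : List A) {u : List A} {r : ℕ} → r < length w → nth (w ++ u) r ≡ nth w r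
nth-++ˡ (x ∷ w) {r = zero} _ = refl
nth-++ˡ (x ∷ w) {r = suc r} (s≤s lt) = nth-++ˡ w lt

nth-++ʳ : {A : Set} (w : List A) {u : List A} (r : ℕ) → nth (w ++ u) (length w ℕ.+ r) ≡ nth u r
nth-++ʳ [] r = refl
nth-++ʳ (x ∷ w) r = nth-++ʳ w r

nth-map : {A B : Set} (f : A → B) (w : List A) (r : ℕ) → nth (map f w) r ≡ Maybe.map f (nth w r)
nth-map f [] r = refl
nth-map f (x ∷ w) zero = refl
nth-map f (x ∷ w) (suc r) = nth-map f w r

Sorted-nth : ∀ w → Sorted w ⇔ (∀ c → suc c < length w → RelM _≤_ (nth w c) (nth w (suc c)))
Sorted-nth w = to , from w
  where
  to : ∀ {w} → Sorted w → ∀ c → suc c < length w → RelM _≤_ (nth w c) (nth w (suc c))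
  to [-] c (s≤s ())
  to (le ∷ s) zero _ = just le
  to (le ∷ s) (suc c) (s≤s lt) = to s c lt
  from : ∀ w → (∀ c → suc c < length w → RelM _≤_ (nth w c) (nth w (suc c))) → Sorted w
  from [] _ = []
  from (x ∷ []) _ = [-]
  from (x ∷ y ∷ w) f = unjust (f 0 (s≤s (s≤s z≤n))) ∷ from (y ∷ w) (λ c lt → f (suc c) (s≤s lt))

Col-nth : ∀ bs w → Col bs w ⇔ (∀ c → c < length w → RelM _≤_ (nth bs c) (nth w c))
Col-nth bs w = to , from bs w
  where
  to : ∀ {bs w} → Col bs w → ∀ c → c < length w → RelM _≤_ (nth bs c) (nth w c)
  to (le ∷ _) zero _ = just le
  to (_ ∷ s) (suc c) (s≤s lt) = to s c lt
  from : ∀ bs w → (∀ c → c < length w → RelM _≤_ (nth bs c) (nth w c)) → Col bs w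
  from bs [] f = []
  from [] (a ∷ w) f with () ← f 0 (s≤s z≤n)
  from (b ∷ bs) (a ∷ w) f = unjust (f 0 (s≤s z≤n)) ∷ from bs w (λ c lt → f (suc c) (s≤s lt))

Tableau : List ℕ → List ℕ → List ℕ → Set
Tableau bs [] t = ⊤
Tableau bs (p ∷ sh) t = Sorted (take p t) × Col bs (take p t) × Tableau (map suc (take p t)) sh (drop p t)

tableau? : ∀ bs sh t → Dec (Tableau bs sh t)
tableau? bs [] t = yes tt
tableau? bs (p ∷ sh) t =
  sorted? (take p t) ×-dec (col? bs (take p t) ×-dec tableau? (map suc (take p t)) sh (drop p t))

take-++ : {A : Set} (w u : List A) → take (length w) (w ++ u) ≡ w
take-++ [] u = refl
take-++ (x ∷ w) u = cong (x ∷_) (take-++ w u)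

drop-++ : {A : Set} (w u : List A) → drop (length w) (w ++ u) ≡ u
drop-++ [] u = refl
drop-++ (x ∷ w) u = drop-++ w u

∑-tableau : ∀ n bs sh f → ∑ (words n (sum sh)) (λ t → ind (tableau? bs sh t) ⊗ f t) ≡ ∑ (tableaux n bs sh) f
∑-tableau n bs [] f = cong (_⊕ 0ℤ) (1⊗ tt)
∑-tableau n bs (p ∷ sh) f = begin
  _ ≡⟨ ∑-words-++ n p (sum sh) _ ⟩
  ∑ (words n p) (λ w → ∑ (words n (sum sh)) (λ u → ind (tableau? bs (p ∷ sh) (w ++ u)) ⊗ f (w ++ u)))
    ≡⟨ ∑-cong∈ (words n p) (λ {w} w∈ → trans
         (∑-cong (words n (sum sh)) (λ u → split w u (words-length n p w∈)))
         (trans (∑-⊗ˡ (ind (sorted? w)) (words n (sum sh)) _) (cong (ind (sorted? w) ⊗_)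
           (trans (∑-⊗ˡ (ind (col? bs w)) (words n (sum sh)) _)
             (cong (ind (col? bs w) ⊗_) (∑-tableau n (map suc w) sh (λ u → f (w ++ u)))))))) ⟩
  ∑ (words n p) (λ w → ind (sorted? w) ⊗ (ind (col? bs w) ⊗ ∑ (tableaux n (map suc w) sh) (λ u → f (w ++ u))))
    ≡⟨ ∑-sorted n p _ ⟩
  _ ≡⟨ ∑-tableaux n bs p sh f ⟨
  _ ∎
  where
  split : ∀ w u → length w ≡ p → ind (tableau? bs (p ∷ sh) (w ++ u)) ⊗ f (w ++ u) ≡
    ind (sorted? w) ⊗ (ind (col? bs w) ⊗ (ind (tableau? (map suc w) sh u) ⊗ f (w ++ u)))
  split w u refl rewrite take-++ w u | drop-++ w u = trans (cong (_⊗ f (w ++ u))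
    (trans (ind-× (sorted? w) _) (cong (ind (sorted? w) ⊗_) (ind-× (col? bs w) (tableau? (map suc w) sh u)))))
    (trans (⊗-assoc _ _ _) (cong (ind (sorted? w) ⊗_) (⊗-assoc _ _ _)))

offset : List ℕ → ℕ → ℕ
offset sh r = sum (take r sh)

RowsWeak ColsStrict : List ℕ → List ℕ → Set
RowsWeak sh t = ∀ r c → suc c < partAt sh r → RelM _≤_ (nth t (offset sh r ℕ.+ c)) (nth t (offset sh r ℕ.+ suc c))
ColsStrict sh t = ∀ r c → c < partAt sh (suc r) → RelM _<_ (nth t (offset sh r ℕ.+ c)) (nth t (offset sh (suc r) ℕ.+ c))

Under : List ℕ → List ℕ → List ℕ → Set
Under bs sh t = ∀ c → c < head₀ sh → RelM _≤_ (nth bs c) (nth t c)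

RelM-subst : ∀ R {a a′ b b′} → a ≡ a′ → b ≡ b′ → RelM R a b → RelM R a′ b′
RelM-subst R refl refl x = x

RelM-suc : ∀ {a b} → RelM _≤_ (Maybe.map suc a) b ⇔ RelM _<_ a b
RelM-suc {just a} = (λ { (just le) → just le }) , (λ { (just lt) → just lt })
RelM-suc {nothing} = (λ ()) , (λ ())

nth-row : ∀ (w u : List ℕ) o c → nth (w ++ u) (length w ℕ.+ o ℕ.+ c) ≡ nth u (o ℕ.+ c)
nth-row w u o c = trans (cong (nth (w ++ u)) (ℕₚ.+-assoc (length w) o c)) (nth-++ʳ w (o ℕ.+ c))

nth-next : ∀ (w u : List ℕ) c → nth (w ++ u) (length w ℕ.+ 0 ℕ.+ c) ≡ nth u c
nth-next w u c = nth-row w u 0 c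

-- Row lengths decrease weakly, so every entry of the second row has one above it inside the prefix
-- `w`. Strictness against that row thus becomes the bound `map suc w` on the remaining tableau.
Tableau-spec : ∀ bs sh t → Decr sh → length t ≡ sum sh →
  Tableau bs sh t ⇔ (RowsWeak sh t × ColsStrict sh t × Under bs sh t)
Tableau-spec bs [] t d len = (λ _ → (λ { _ _ () }) , (λ { _ _ () }) , (λ { _ () })) , (λ _ → tt)
Tableau-spec bs (p ∷ sh) t (le ∷ d) len =
    subst (λ t → Tableau bs (p ∷ sh) t ⇔ (RowsWeak (p ∷ sh) t × ColsStrict (p ∷ sh) t × Under bs (p ∷ sh) t))
      (take++drop≡id p t)
      (split (take p t) (drop p t) (trans (length-take p t) (ℕₚ.m≤n⇒m⊓n≡m (subst (p ≤_) (sym len) (ℕₚ.m≤m+n p _))))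
        (trans (length-drop p t) (trans (cong (_∸ p) len) (ℕₚ.m+n∸m≡n p _))))
  where
  split : ∀ w u → length w ≡ p → length u ≡ sum sh →
    Tableau bs (p ∷ sh) (w ++ u) ⇔ (RowsWeak (p ∷ sh) (w ++ u) × ColsStrict (p ∷ sh) (w ++ u) × Under bs (p ∷ sh) (w ++ u))
  split w u refl lenu rewrite take-++ w u | drop-++ w u = to , from
    where
    ih = Tableau-spec (map suc w) sh u d lenu
    to : Sorted w × Col bs w × Tableau (map suc w) sh u → _
    to (s , c , tab) with proj₁ ih tab
    ... | rw , cs , un =
      (λ { zero x lt → RelM-subst _≤_ (sym (nth-++ˡ w (ℕₚ.<⇒≤ lt))) (sym (nth-++ˡ w lt)) (proj₁ (Sorted-nth w) s x lt)
         ; (suc r) x lt → RelM-subst _≤_ (sym (nth-row w u (offset sh r) x)) (sym (nth-row w u (offset sh r) (suc x))) (rw r x lt) }) ,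
      (λ { zero x lt → RelM-subst _<_ (sym (nth-++ˡ w (ℕₚ.≤-trans lt le))) (sym (nth-next w u x))
             (proj₁ (RelM-suc {nth w x}) (RelM-subst _≤_ (nth-map suc w x) refl (un x lt)))
         ; (suc r) x lt → RelM-subst _<_ (sym (nth-row w u (offset sh r) x)) (sym (nth-row w u (offset sh (suc r)) x)) (cs r x lt) }) ,
      (λ x lt → RelM-subst _≤_ refl (sym (nth-++ˡ w lt)) (proj₁ (Col-nth bs w) c x lt))
    from : _ → Sorted w × Col bs w × Tableau (map suc w) sh u
    from (rw , cs , un) =
      proj₂ (Sorted-nth w) (λ x lt → RelM-subst _≤_ (nth-++ˡ w (ℕₚ.<⇒≤ lt)) (nth-++ˡ w lt) (rw 0 x lt)) ,
      proj₂ (Col-nth bs w) (λ x lt → RelM-subst _≤_ refl (nth-++ˡ w lt) (un x lt)) ,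
      proj₂ ih ((λ r x lt → RelM-subst _≤_ (nth-row w u (offset sh r) x) (nth-row w u (offset sh r) (suc x)) (rw (suc r) x lt)) ,
        (λ r x lt → RelM-subst _<_ (nth-row w u (offset sh r) x) (nth-row w u (offset sh (suc r)) x) (cs (suc r) x lt)) ,
        (λ x lt → RelM-subst _≤_ (sym (nth-map suc w x)) refl (proj₂ (RelM-suc {nth w x})
          (RelM-subst _<_ (nth-++ˡ w (ℕₚ.≤-trans lt le)) (nth-next w u x) (cs 0 x lt)))))

leM-spec : ∀ {n} (a b : Maybe (Fin n)) → T (leM a b) ⇔ RelM _≤_ (Maybe.map toℕ a) (Maybe.map toℕ b)
leM-spec (just a) (just b) = (λ t → just (ℕₚ.≤ᵇ⇒≤ (toℕ a) (toℕ b) t)) , (λ { (just le) → ℕₚ.≤⇒≤ᵇ le })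
leM-spec (just a) nothing = (λ ()) , (λ ())
leM-spec nothing b = (λ ()) , (λ ())

ltM-spec : ∀ {n} (a b : Maybe (Fin n)) → T (ltM a b) ⇔ RelM _<_ (Maybe.map toℕ a) (Maybe.map toℕ b)
ltM-spec (just a) (just b) = (λ t → just (ℕₚ.<ᵇ⇒< (toℕ a) (toℕ b) t)) , (λ { (just lt) → ℕₚ.<⇒<ᵇ lt })
ltM-spec (just a) nothing = (λ ()) , (λ ())
ltM-spec nothing b = (λ ()) , (λ ())

partAt-length : ∀ sh r {c} → c < partAt sh r → r < length sh
partAt-length (p ∷ sh) zero _ = s≤s z≤n
partAt-length (p ∷ sh) (suc r) lt = s≤s (partAt-length sh r lt)

isSSYT-spec : ∀ {n} sh (t : List (Fin n)) → T (isSSYT sh t) ⇔ (RowsWeak sh (map toℕ t) × ColsStrict sh (map toℕ t))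
isSSYT-spec sh t = to , from
  where
  to : T (isSSYT sh t) → _
  to tr with proj₁ T-∧ tr
  ... | a , b =
    (λ r c lt → RelM-subst _≤_ (sym (nth-map toℕ t _)) (sym (nth-map toℕ t _)) (proj₁ (leM-spec (entry sh t r c) (entry sh t r (suc c)))
      (proj₁ T-if (proj₁ (T-allB _) (proj₁ (T-allB (upTo (length sh))) a (∈-upTo⁺ (partAt-length sh r lt)))
        (∈-upTo⁺ (ℕₚ.<⇒≤ lt))) (ℕₚ.<⇒<ᵇ lt)))) ,
    (λ r c lt → RelM-subst _<_ (sym (nth-map toℕ t _)) (sym (nth-map toℕ t _)) (proj₁ (ltM-spec (entry sh t r c) (entry sh t (suc r) c))
      (proj₁ (T-allB _) (proj₁ (T-allB (upTo (length sh))) b (∈-upTo⁺ (ℕₚ.<⇒≤ (partAt-length sh (suc r) lt))))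
        (∈-upTo⁺ lt))))
  from : _ → T (isSSYT sh t)
  from (rw , cs) = proj₂ T-∧
    ( proj₂ (T-allB (upTo (length sh))) (λ {r} _ → proj₂ (T-allB (upTo (partAt sh r))) (λ {c} _ → proj₂ T-if (λ lt →
        proj₂ (leM-spec (entry sh t r c) (entry sh t r (suc c)))
          (RelM-subst _≤_ (nth-map toℕ t _) (nth-map toℕ t _) (rw r c (ℕₚ.<ᵇ⇒< (suc c) (partAt sh r) lt))))))
    , proj₂ (T-allB (upTo (length sh))) (λ {r} _ → proj₂ (T-allB (upTo (partAt sh (suc r)))) (λ {c} c∈ →
        proj₂ (ltM-spec (entry sh t r c) (entry sh t (suc r) c))
          (RelM-subst _<_ (nth-map toℕ t _) (nth-map toℕ t _) (cs r c (∈-upTo⁻ c∈))))) )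

∑-allFin : ∀ {n} (f : Fin n → ℤ) (g : ℕ → ℤ) → (∀ i → f i ≡ g (toℕ i)) → ∑ (allFin n) f ≡ ∑ (upTo n) g
∑-allFin f g = go f g id id
  where
  go : ∀ {n m} (f : Fin m → ℤ) (g : ℕ → ℤ) (k : Fin n → Fin m) (u : ℕ → ℕ) → (∀ i → f (k i) ≡ g (u (toℕ i)))
    → ∑ (tabulate k) f ≡ ∑ (applyUpTo u n) g
  go {zero} f g k u e = refl
  go {suc n} f g k u e = cong₂ _⊕_ (e zero) (go f g (k ∘ suc) (u ∘ suc) (λ i → e (suc i)))

∑-allVecs-suc : ∀ m n {f : Vec (Fin n) (suc m) → ℤ} → ∑ (allVecs (suc m) n) f ≡ ∑ (allFin n) (λ i → ∑ (allVecs m n) (λ w → f (i ∷ w)))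
∑-allVecs-suc m n {f} = trans (∑-concatMap (λ i → map (i ∷_) (allVecs m n)) (allFin n) f)
  (∑-cong (allFin n) (λ i → ∑-map (i ∷_) (allVecs m n) f))

∑-allVecs-words : ∀ m n (f : List (Fin n) → ℤ) (g : List ℕ → ℤ) →
  (∀ t → length t ≡ m → f t ≡ g (map toℕ t)) → ∑ (allVecs m n) (λ w → f (V.toList w)) ≡ ∑ (words n m) g
∑-allVecs-words zero n f g e = cong (_⊕ 0ℤ) (e [] refl)
∑-allVecs-words (suc m) n f g e = trans (∑-allVecs-suc m n) (trans
  (∑-allFin _ _ (λ i → ∑-allVecs-words m n (λ t → f (i ∷ t)) (λ t → g (toℕ i ∷ t)) (λ t l → e (i ∷ t) (cong suc l))))
  (sym (∑-words n m g)))

-- β lists the exponents from the largest letter down, as in HasContent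
exponent : List ℕ → ℕ → ℕ
exponent [] a = 0
exponent (j ∷ β) a = if a ≡ᵇ length β then j else exponent β a

exponents : ∀ n → List ℕ → Vec ℕ n
exponents n β = V.tabulate (λ i → exponent β (toℕ i))

exponent-head : ∀ j β → exponent (j ∷ β) (length β) ≡ j
exponent-head j β with length β ≡ᵇ length β in eq
... | true = refl
... | false = ⊥-elim (subst T eq (ℕₚ.≡⇒≡ᵇ (length β) (length β) refl))

exponent-tail : ∀ j β {a} → a < length β → exponent (j ∷ β) a ≡ exponent β a
exponent-tail j β {a} lt with a ≡ᵇ length β in eq
... | true = contradiction (ℕₚ.≡ᵇ⇒≡ a (length β) (subst T (sym eq) tt)) (ℕₚ.<⇒≢ lt)
... | false = refl

HasContent-exponent : ∀ β t → HasContent β t ⇔ (∀ a → a < length β → count a t ≡ exponent β a)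
HasContent-exponent [] t = (λ _ _ ()) , (λ _ → tt)
HasContent-exponent (j ∷ β) t = to , from
  where
  ih = HasContent-exponent β t
  to : HasContent (j ∷ β) t → ∀ a → a < suc (length β) → count a t ≡ exponent (j ∷ β) a
  to (e , c) a (s≤s le) with ℕₚ.m≤n⇒m<n∨m≡n le
  ... | inj₁ lt = trans (proj₁ ih c a lt) (sym (exponent-tail j β lt))
  ... | inj₂ refl = trans e (sym (exponent-head j β))
  from : (∀ a → a < suc (length β) → count a t ≡ exponent (j ∷ β) a) → HasContent (j ∷ β) t
  from f = trans (f (length β) ℕₚ.≤-refl) (exponent-head j β) ,
    proj₂ ih (λ a lt → trans (f a (ℕₚ.≤-trans lt (ℕₚ.n≤1+n _))) (exponent-tail j β lt))

count-toℕ : ∀ {n} (i : Fin n) (t : List (Fin n)) → countB (λ x → x ==ᶠ i) t ≡ count (toℕ i) (map toℕ t)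
count-toℕ i [] = refl
count-toℕ i (x ∷ t) with toℕ x ≡ᵇ toℕ i
... | true = cong suc (count-toℕ i t)
... | false = count-toℕ i t

exponents-spec : ∀ {n} β (t : List ℕ) (v : Vec ℕ n) → length β ≡ n → (∀ i → V.lookup v i ≡ count (toℕ i) t)
  → T (vecEqB v (exponents n β)) ⇔ HasContent β t
exponents-spec {n} β t v refl lhs = to , from
  where
  spec = T-vecEqB v (exponents n β)
  to : _ → _
  to tr = proj₂ (HasContent-exponent β t) (λ a lt → subst (λ a → count a t ≡ exponent β a) (Fₚ.toℕ-fromℕ< lt)
    (trans (sym (lhs (fromℕ< lt))) (trans (proj₁ spec tr (fromℕ< lt)) (Vₚ.lookup∘tabulate _ (fromℕ< lt)))))
  from : _ → _
  from hc = proj₂ spec (λ i → trans (lhs i) (trans (proj₁ (HasContent-exponent β t) hc (toℕ i) (Fₚ.toℕ<n i))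
    (sym (Vₚ.lookup∘tabulate _ i))))

content-spec : ∀ {n} β (t : List (Fin n)) → length β ≡ n
  → T (vecEqB (content t) (exponents n β)) ⇔ HasContent β (map toℕ t)
content-spec β t e = exponents-spec β (map toℕ t) (content t) e
  (λ i → trans (Vₚ.lookup∘tabulate _ i) (count-toℕ i t))

Under-zeros : ∀ sh t → length t ≡ sum sh → Under (replicate (head₀ sh) 0) sh t
Under-zeros sh t e c lt = go (head₀ sh) t c lt (ℕₚ.≤-trans lt (subst (head₀ sh ≤_) (sym e) (first sh)))
  where
  first : ∀ sh → head₀ sh ≤ sum sh
  first [] = z≤n
  first (p ∷ sh) = ℕₚ.m≤m+n p _
  go : ∀ m t c → c < m → c < length t → RelM _≤_ (nth (replicate m 0) c) (nth t c)
  go (suc m) (x ∷ t) zero _ _ = just z≤n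
  go (suc m) (x ∷ t) (suc c) (s≤s a) (s≤s b) = go m t c a b

sCoef-coef : ∀ n sh β → Decr sh → length β ≡ n → + sCoef n sh (exponents n β) ≡ Schur.coef sh β
sCoef-coef n sh β d refl = begin
  _ ≡⟨ countB-∑ _ (map V.toList (allVecs (sum sh) n)) ⟩
  _ ≡⟨ ∑-map V.toList (allVecs (sum sh) n) _ ⟩
  _ ≡⟨ ∑-allVecs-words (sum sh) n _ (λ t → ind (tableau? (replicate (head₀ sh) 0) sh t) ⊗ ind (hasContent? β t)) same ⟩
  _ ≡⟨ ∑-tableau n (replicate (head₀ sh) 0) sh _ ⟩
  _ ≡⟨ tableaux-coef β (head₀ sh) sh ℕₚ.≤-refl ⟩
  Schur.coef sh β ∎
  where
  same : ∀ (t : List (Fin n)) → length t ≡ sum sh → ind (T? (isSSYT sh t ∧ vecEqB (content t) (exponents n β)))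
    ≡ ind (tableau? (replicate (head₀ sh) 0) sh (map toℕ t)) ⊗ ind (hasContent? β (map toℕ t))
  same t len = trans (ind-cong
      (λ tr → let (a , b) = proj₁ (T-∧ {isSSYT sh t}) tr ; (rw , cs) = proj₁ (isSSYT-spec sh t) a in
        proj₂ spec (rw , cs , Under-zeros sh (map toℕ t) len′) , proj₁ (content-spec β t refl) b)
      (λ { (tab , hc) → let (rw , cs , _) = proj₁ spec tab in
        proj₂ (T-∧ {isSSYT sh t}) (proj₂ (isSSYT-spec sh t) (rw , cs) , proj₂ (content-spec β t refl) hc) }))
    (ind-× (tableau? _ sh (map toℕ t)) (hasContent? β (map toℕ t)))
    where
    len′ : length (map toℕ t) ≡ sum sh
    len′ = trans (length-map toℕ t) len
    spec = Tableau-spec (replicate (head₀ sh) 0) sh (map toℕ t) d len′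

-- The power sum coefficients of the definitions

module CoefZeros (calculus : StripCalculus) where
  open StripCalculus calculus

  -- Once α is used up, each remaining 0 applies h_0^⊥, the identity by `h-full`. This allows an
  -- exponent list to be padded to n entries.
  coef-zeros : ∀ α e {x} → Ok x → coef x (α ++ replicate e 0) ≡ coef x α
  coef-zeros [] zero ok = refl
  coef-zeros [] (suc e) {x} ok = begin
    ∑ (h x) (λ y → ind (sum y ℕ.+ 0 ≟ sum x) ⊗ coef y (replicate e 0))
      ≡⟨ ∑-cong∈ (h x) (λ {y} y∈ → cong₂ _⊗_ (ind-cong (trans (sym (ℕₚ.+-identityʳ _))) (trans (ℕₚ.+-identityʳ _)))
           (coef-zeros [] e (h-Ok ok y∈))) ⟩
    ∑ (h x) (λ y → ind (sum y ≟ sum x) ⊗ coef y []) ≡⟨ h-full ok (λ y → coef y []) ⟩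
    coef x [] ∎
  coef-zeros (j ∷ α) e {x} ok =
    ∑-cong∈ (h x) (λ {y} y∈ → cong (ind (sum y ℕ.+ j ≟ sum x) ⊗_) (coef-zeros α e (h-Ok ok y∈)))

-- A choice of variables for the parts of μ is encoded by a word, so that exponents become letter counts.
partWords : ℕ → List ℕ → List (List ℕ)
partWords N [] = [] ∷ []
partWords N (m ∷ μ) = concatMap (λ i → map (replicate m i ++_) (partWords N μ)) (upTo N)

∑-partWords : ∀ N m μ f → ∑ (partWords N (m ∷ μ)) f ≡ ∑ (upTo N) (λ i → ∑ (partWords N μ) (λ t → f (replicate m i ++ t)))
∑-partWords N m μ f = trans (∑-concatMap (λ i → map (replicate m i ++_) (partWords N μ)) (upTo N) f)
  (∑-cong (upTo N) (λ i → ∑-map (replicate m i ++_) (partWords N μ) f))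

count-replicate : ∀ {a i} m → i ≡ a → count a (replicate m i) ≡ m
count-replicate {a} m e = trans (cong length (filter-all (_≟ a) (Allₚ.replicate⁺ m e))) (length-replicate m)

count-replicate-≢ : ∀ {a i} m → i ≢ a → count a (replicate m i) ≡ 0
count-replicate-≢ {a} m e = cong length (filter-none (_≟ a) (Allₚ.replicate⁺ m e))

-- The parts assigned to the variable N yield exactly the letters N, so deleting these letters drops
-- those parts, as `PowerSum.h` does.
partWords-largest : ∀ N μ (K : ℕ → List ℕ → ℤ) → ∑ (partWords (suc N) μ) (λ t → K (count N t) (below N t))
  ≡ ∑ (PowerSum.h μ) (λ ρ → ∑ (partWords N ρ) (K (sum μ ∸ sum ρ)))
partWords-largest N [] K = sym (⊕-identityʳ _)
partWords-largest N (m ∷ μ) K = begin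
  _ ≡⟨ ∑-partWords (suc N) m μ _ ⟩
  _ ≡⟨ ∑-upTo N _ ⟩
  _ ≡⟨ cong₂ _⊕_ (∑-cong∈ (upTo N) (λ {i} i∈ → small i (∈-upTo⁻ i∈))) largest ⟩
  ∑ (upTo N) (λ i → ∑ (PowerSum.h μ) (λ ρ → term i ρ)) ⊕ ∑ (PowerSum.h μ) (λ ρ → ∑ (partWords N ρ) (K ((m ℕ.+ sum μ) ∸ sum ρ)))
    ≡⟨ ⊕-comm _ _ ⟩
  _ ≡⟨ cong₂ _⊕_ refl (trans (∑-swap (upTo N) (PowerSum.h μ) term) (∑-cong (PowerSum.h μ) (λ ρ → sym (∑-partWords N m ρ _)))) ⟩
  _ ≡⟨ PowerSum.∑-h m μ _ ⟨
  _ ∎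
  where
  term : ℕ → List ℕ → ℤ
  term i ρ = ∑ (partWords N ρ) (λ t → K ((m ℕ.+ sum μ) ∸ (m ℕ.+ sum ρ)) (replicate m i ++ t))
  small : ∀ i → i < N → ∑ (partWords (suc N) μ) (λ t → K (count N (replicate m i ++ t)) (below N (replicate m i ++ t)))
    ≡ ∑ (PowerSum.h μ) (term i)
  small i lt = begin
    _ ≡⟨ ∑-cong (partWords (suc N) μ) (λ t → cong₂ K
           (trans (count-++ N (replicate m i) t) (cong (ℕ._+ count N t) (count-replicate-≢ m (ℕₚ.<⇒≢ lt))))
           (trans (filter-++ (_<? N) (replicate m i) t) (cong (_++ below N t) (filter-all (_<? N) (Allₚ.replicate⁺ m lt))))) ⟩
    _ ≡⟨ partWords-largest N μ (λ c t → K c (replicate m i ++ t)) ⟩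
    _ ≡⟨ ∑-cong (PowerSum.h μ) (λ ρ → cong (λ z → ∑ (partWords N ρ) (λ t → K z (replicate m i ++ t)))
           (sym (ℕₚ.[m+n]∸[m+o]≡n∸o m (sum μ) (sum ρ)))) ⟩
    _ ∎
  largest : ∑ (partWords (suc N) μ) (λ t → K (count N (replicate m N ++ t)) (below N (replicate m N ++ t)))
    ≡ ∑ (PowerSum.h μ) (λ ρ → ∑ (partWords N ρ) (K ((m ℕ.+ sum μ) ∸ sum ρ)))
  largest = begin
    _ ≡⟨ ∑-cong (partWords (suc N) μ) (λ t → cong₂ K
           (trans (count-++ N (replicate m N) t) (cong (ℕ._+ count N t) (count-replicate m refl)))
           (trans (filter-++ (_<? N) (replicate m N) t)
             (cong (_++ below N t) (filter-none (_<? N) (Allₚ.replicate⁺ m (ℕₚ.<-irrefl refl)))))) ⟩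
    _ ≡⟨ partWords-largest N μ (λ c t → K (m ℕ.+ c) t) ⟩
    _ ≡⟨ ∑-cong∈ (PowerSum.h μ) (λ {ρ} ρ∈ → cong (λ z → ∑ (partWords N ρ) (K z))
           (sym (ℕₚ.+-∸-assoc m (PowerSum.h-≤ μ ρ∈)))) ⟩
    _ ∎

partWords-coef : ∀ β {μ} → PowerSum.Positive μ →
  ∑ (partWords (length β) μ) (λ t → ind (hasContent? β t)) ≡ PowerSum.coef μ β
partWords-coef [] [] = trans (⊕-identityʳ _) (ind-cong (λ _ → refl) (λ _ → _))
partWords-coef [] (s≤s _ ∷ _) = sym (ind-no (λ ()))
partWords-coef (j ∷ β) {μ} ok = begin
  _ ≡⟨ ∑-cong (partWords (suc N) μ) (λ t → trans (ind-× (count N t ≟ j) (hasContent? β t))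
         (cong (ind (count N t ≟ j) ⊗_) (ind-cong (below-HasContent β ℕₚ.≤-refl) (HasContent-below β ℕₚ.≤-refl)))) ⟩
  _ ≡⟨ partWords-largest N μ (λ c u → ind (c ≟ j) ⊗ ind (hasContent? β u)) ⟩
  _ ≡⟨ ∑-cong∈ (PowerSum.h μ) (λ {ρ} ρ∈ → trans (∑-⊗ˡ (ind (sum μ ∸ sum ρ ≟ j)) (partWords N ρ) _)
         (cong₂ _⊗_ (size (PowerSum.h-≤ μ ρ∈)) (partWords-coef β (PowerSum.h-positive ok ρ∈)))) ⟩
  PowerSum.coef μ (j ∷ β) ∎
  where
  N = length β
  size : ∀ {b} → b ≤ sum μ → ind (sum μ ∸ b ≟ j) ≡ ind (b ℕ.+ j ≟ sum μ)
  size {b} b≤ = ind-cong (λ e → trans (cong (b ℕ.+_) (sym e)) (ℕₚ.m+[n∸m]≡n b≤))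
    (λ e → trans (cong (_∸ b) (sym e)) (ℕₚ.m+n∸m≡n b j))

partWord : ∀ {n} (μ : List ℕ) → Vec (Fin n) (length μ) → List ℕ
partWord [] [] = []
partWord (m ∷ μ) (c ∷ cs) = replicate m (toℕ c) ++ partWord μ cs

∑-partWord : ∀ n μ f → ∑ (allVecs (length μ) n) (λ c → f (partWord μ c)) ≡ ∑ (partWords n μ) f
∑-partWord n [] f = refl
∑-partWord n (m ∷ μ) f = trans (∑-allVecs-suc (length μ) n) (trans
  (∑-allFin {n} _ (λ i → ∑ (partWords n μ) (λ t → f (replicate m i ++ t))) (λ i → ∑-partWord n μ (λ t → f (replicate m (toℕ i) ++ t)))) (sym (∑-partWords n m μ f)))

lookup-weight : ∀ {n} μ (c : Vec (Fin n) (length μ)) i → V.lookup (weight μ c) i ≡ count (toℕ i) (partWord μ c)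
lookup-weight [] [] i = Vₚ.lookup-replicate i 0
lookup-weight (m ∷ μ) (c ∷ cs) i = trans (Vₚ.lookup∘tabulate _ i) (trans
  (cong₂ ℕ._+_ first (lookup-weight μ cs i)) (sym (count-++ (toℕ i) (replicate m (toℕ c)) (partWord μ cs))))
  where
  first : (if c ==ᶠ i then m else 0) ≡ count (toℕ i) (replicate m (toℕ c))
  first with toℕ c ≡ᵇ toℕ i in eq
  ... | true = sym (count-replicate m (ℕₚ.≡ᵇ⇒≡ (toℕ c) (toℕ i) (subst T (sym eq) _)))
  ... | false = sym (count-replicate-≢ m (λ e → subst T eq (ℕₚ.≡⇒≡ᵇ (toℕ c) (toℕ i) e)))

pCoef-coef : ∀ n β {μ} → PowerSum.Positive μ → length β ≡ n → + pCoef n μ (exponents n β) ≡ PowerSum.coef μ β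
pCoef-coef n β {μ} ok refl = begin
  _ ≡⟨ countB-∑ _ (allVecs (length μ) n) ⟩
  _ ≡⟨ ∑-cong (allVecs (length μ) n) (λ c → let spec = exponents-spec β (partWord μ c) (weight μ c) refl (lookup-weight μ c) in
         ind-cong (proj₁ spec) (proj₂ spec)) ⟩
  _ ≡⟨ ∑-partWord n μ (λ t → ind (hasContent? β t)) ⟩
  _ ≡⟨ partWords-coef β ok ⟩
  PowerSum.coef μ β ∎

-- Orbits of a permutation

Injectiveᵥ : ∀ {n} → Vec (Fin n) n → Set
Injectiveᵥ w = ∀ x y → lookup w x ≡ lookup w y → x ≡ y

Orbit : ∀ {n} → Vec (Fin n) n → Fin n → Fin n → Set
Orbit w x y = ∃ λ m → iter w m x ≡ y

Least : ∀ {n} → Vec (Fin n) n → Fin n → Set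
Least w x = ∀ y → Orbit w x y → toℕ x ≤ toℕ y

iter-+ : ∀ {n} (w : Vec (Fin n) n) a b x → iter w (a ℕ.+ b) x ≡ iter w a (iter w b x)
iter-+ w zero b x = refl
iter-+ w (suc a) b x = cong (lookup w) (iter-+ w a b x)

iter-suc : ∀ {n} (w : Vec (Fin n) n) a x → iter w (suc a) x ≡ iter w a (lookup w x)
iter-suc w zero x = refl
iter-suc w (suc a) x = cong (lookup w) (iter-suc w a x)

Orbit-refl : ∀ {n} {w : Vec (Fin n) n} {x} → Orbit w x x
Orbit-refl = 0 , refl

Orbit-trans : ∀ {n} {w : Vec (Fin n) n} {x y z} → Orbit w x y → Orbit w y z → Orbit w x z
Orbit-trans {w = w} {x} (a , refl) (b , refl) = b ℕ.+ a , iter-+ w b a x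

Orbit-step : ∀ {n} {w : Vec (Fin n) n} {x} → Orbit w x (lookup w x)
Orbit-step = 1 , refl

mutual
  -- The local function of cycleLen has no name in scope; unification in search-named recovers it.
  search : ∀ {n} → Vec (Fin n) n → Fin n → ℕ → ℕ → ℕ
  search = _

  search-named : ∀ {n} (w : Vec (Fin (suc n)) (suc n)) i
    → cycleLen w i ≡ (if iter w 1 i ==ᶠ i then 1 else search w i n 2)
  search-named {n} w i with suc n | w | i | 2
  ... | N | w′ | i′ | m = cong (if iter w′ 1 i′ ==ᶠ i′ then 1 else_) {search w′ i′ n m} refl

record FirstReturn {n} (w : Vec (Fin n) n) (i : Fin n) (from L : ℕ) : Set where
  field
    starts : from ≤ L
    returns : iter w L i ≡ i
    first : ∀ s → from ≤ s → s < L → iter w s i ≢ i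

-- A known return time r in the window from m to m + k - 1 prevents the search from running out of
-- fuel, when it would answer 0.
search-spec : ∀ {n} (w : Vec (Fin n) n) i k m r → m ≤ r → r < m ℕ.+ k → iter w r i ≡ i
  → FirstReturn w i m (search w i k m)
search-spec w i zero m r m≤r r< e = contradiction (subst (r <_) (ℕₚ.+-identityʳ m) r<) (ℕₚ.≤⇒≯ m≤r)
search-spec w i (suc k) m r m≤r r< e with iter w m i ==ᶠ i in eq
... | true = record
  { starts = ℕₚ.≤-refl ; returns = proj₁ T-==ᶠ (subst T (sym eq) _)
  ; first = λ s m≤s s<m _ → contradiction s<m (ℕₚ.≤⇒≯ m≤s) }
... | false = record
  { starts = ℕₚ.<⇒≤ (FirstReturn.starts rest) ; returns = FirstReturn.returns rest
  ; first = λ s m≤s s< e′ → case s m≤s s< e′ (ℕₚ.m≤n⇒m<n∨m≡n m≤s) }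
  where
  later : m ≢ r
  later refl = subst T eq (proj₂ T-==ᶠ e)
  rest = search-spec w i k (suc m) r (ℕₚ.≤∧≢⇒< m≤r later) (subst (r <_) (ℕₚ.+-suc m k) r<) e
  case : ∀ s → m ≤ s → s < search w i k (suc m) → iter w s i ≡ i → m < s ⊎ m ≡ s → ⊥
  case s m≤s s< e′ (inj₁ lt) = FirstReturn.first rest s lt s< e′
  case s m≤s s< e′ (inj₂ refl) = subst T eq (proj₂ T-==ᶠ e′)

module Orbits {n : ℕ} (w : Vec (Fin n) n) (inj : Injectiveᵥ w) where

  iter-injective : ∀ m {x y} → iter w m x ≡ iter w m y → x ≡ y
  iter-injective zero e = e
  iter-injective (suc m) e = iter-injective m (inj _ _ e)

  iter-difference : ∀ {a b x} → a ≤ b → iter w a x ≡ iter w b x → iter w (b ∸ a) x ≡ x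
  iter-difference {a} {b} {x} a≤b e = sym (iter-injective a (trans e
    (trans (cong (λ m → iter w m x) (sym (ℕₚ.m+[n∸m]≡n a≤b))) (iter-+ w a (b ∸ a) x))))

  period : ∀ x → ∃ λ L → 1 ≤ L × L ≤ n × iter w L x ≡ x
  period x with Fₚ.pigeonhole ℕₚ.≤-refl (λ (i : Fin (suc n)) → iter w (toℕ i) x)
  ... | i , j , i<j , e = toℕ j ∸ toℕ i , ℕₚ.m<n⇒0<n∸m i<j ,
    ℕₚ.≤-trans (ℕₚ.m∸n≤m (toℕ j) (toℕ i)) (ℕₚ.≤-pred (Fₚ.toℕ<n j)) , iter-difference (ℕₚ.<⇒≤ i<j) e

  cycleLen-spec : ∀ i → FirstReturn w i 1 (cycleLen w i)
  cycleLen-spec i with period i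
  ... | L , 1≤L , L≤n , e = search-spec w i n 1 L 1≤L (s≤s L≤n) e

  iter-* : ∀ {L x} k → iter w L x ≡ x → iter w (k ℕ.* L) x ≡ x
  iter-* zero e = refl
  iter-* {L} {x} (suc k) e = trans (iter-+ w L (k ℕ.* L) x) (trans (cong (iter w L) (iter-* k e)) e)

  Orbit-sym : ∀ {x y} → Orbit w x y → Orbit w y x
  Orbit-sym {x} (m , refl) with period x
  -- m full periods lead from x back to x; the first m steps reach y, and the remaining ones lead
  -- from y to x.
  ... | suc L , _ , _ , e = m ℕ.* suc L ∸ m , trans (sym (iter-+ w (m ℕ.* suc L ∸ m) m x))
    (trans (cong (λ k → iter w k x) (ℕₚ.m∸n+n≡m (ℕₚ.m≤m*n m (suc L)))) (iter-* m e))

  iter-mod : ∀ m L .{{_ : ℕ.NonZero L}} {x} → iter w L x ≡ x → iter w (m % L) x ≡ iter w m x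
  iter-mod m L {x} e = sym (trans (cong (λ k → iter w k x) (m≡m%n+[m/n]*n m L))
    (trans (iter-+ w (m % L) (m / L ℕ.* L) x) (cong (iter w (m % L)) (iter-* (m / L) e))))

  Orbit-bounded : ∀ {x y} → Orbit w x y → ∃ λ m → m < n × iter w m x ≡ y
  Orbit-bounded {x} (m , e) with period x
  ... | suc L , _ , L≤n , r = m % suc L , ℕₚ.≤-trans (m%n<n m (suc L)) L≤n , trans (iter-mod m (suc L) r) e

  isCycleMin-Least : ∀ x → T (isCycleMin w x) ⇔ Least w x
  isCycleMin-Least x =
    (λ t y o → let (m , m<n , e) = Orbit-bounded o in
      subst (λ z → toℕ x ≤ toℕ z) e (ℕₚ.≤ᵇ⇒≤ _ _ (proj₁ (T-allB (upTo n)) t (∈-upTo⁺ m<n)))) ,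
    (λ l → proj₂ (T-allB (upTo n)) (λ {m} _ → ℕₚ.≤⇒≤ᵇ (l _ (m , refl))))

  leastInOrbit : ∀ x → ∃ λ y → Orbit w x y × Least w y
  leastInOrbit x = go (suc (toℕ x)) x ℕₚ.≤-refl
    where
    go : ∀ b x → toℕ x < b → ∃ λ y → Orbit w x y × Least w y
    go (suc b) x (s≤s x≤b) with ℕₚ.anyUpTo? (λ m → toℕ (iter w m x) <? toℕ x) n
    ... | yes (m , _ , lt) = let (y , o , l) = go b (iter w m x) (ℕₚ.≤-trans lt x≤b) in
      y , Orbit-trans (m , refl) o , l
    ... | no none = x , Orbit-refl , λ y o → let (m , m<n , e) = Orbit-bounded o in
      subst (λ z → toℕ x ≤ toℕ z) e (ℕₚ.≮⇒≥ (λ lt → none (m , m<n , lt)))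

  rep : Fin n → Fin n
  rep x = proj₁ (leastInOrbit x)

  Orbit-rep : ∀ x → Orbit w x (rep x)
  Orbit-rep x = proj₁ (proj₂ (leastInOrbit x))

  Least-rep : ∀ x → Least w (rep x)
  Least-rep x = proj₂ (proj₂ (leastInOrbit x))

  Least-unique : ∀ {x y} → Orbit w x y → Least w x → Least w y → x ≡ y
  Least-unique o lx ly = Fₚ.toℕ-injective (ℕₚ.≤-antisym (lx _ o) (ly _ (Orbit-sym o)))

  rep-unique : ∀ {x y} → Orbit w x y → Least w y → rep x ≡ y
  rep-unique {x} o l = Least-unique (Orbit-trans (Orbit-sym (Orbit-rep x)) o) (Least-rep x) l

  rep-Orbit : ∀ {x y} → Orbit w x y → rep x ≡ rep y
  rep-Orbit {x} {y} o = rep-unique (Orbit-trans o (Orbit-rep y)) (Least-rep y)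

  Orbit? : ∀ x y → Dec (Orbit w x y)
  Orbit? x y with rep x F.≟ rep y
  ... | yes e = yes (Orbit-trans (Orbit-rep x) (subst (λ z → Orbit w z y) (sym e) (Orbit-sym (Orbit-rep y))))
  ... | no ne = no (ne ∘ rep-Orbit)

-- Sums with one nonzero term and reindexing

∑-upTo-once : ∀ {k} L → k < L → ∑ (upTo L) (λ m → ind (m ≟ k)) ≡ 1ℤ
∑-upTo-once {k} (suc L) (s≤s k≤L) with ℕₚ.m≤n⇒m<n∨m≡n k≤L
... | inj₁ lt = trans (∑-upTo L (λ m → ind (m ≟ k)))
  (trans (cong₂ _⊕_ (∑-upTo-once L lt) (ind-no (λ e → ℕₚ.<⇒≢ lt (sym e)))) (⊕-identityʳ 1ℤ))
... | inj₂ refl = trans (∑-upTo-last L (λ m → ind (m ≟ k)) (λ lt → ind-no (ℕₚ.<⇒≢ lt))) (ind-yes refl)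

∑-allFin-suc : ∀ n (f : Fin (suc n) → ℤ) → ∑ (allFin (suc n)) f ≡ f zero ⊕ ∑ (allFin n) (f ∘ suc)
∑-allFin-suc n f = cong (f zero ⊕_) (go suc)
  where
  go : ∀ {m} (k : Fin m → Fin (suc n)) → ∑ (tabulate k) f ≡ ∑ (allFin m) (f ∘ k)
  go {m} k = trans (cong (λ xs → ∑ xs f) (sym (map-tabulate id k))) (∑-map k (allFin m) f)

∑-allFin-once : ∀ {n} (a : Fin n) (g : Fin n → ℤ) → ∑ (allFin n) (λ i → ind (i F.≟ a) ⊗ g i) ≡ g a
∑-allFin-once {suc n} zero g = trans (∑-allFin-suc n _)
  (trans (cong₂ _⊕_ (1⊗ refl) (∑-zero (allFin n) (λ _ → 0⊗ (λ ())))) (⊕-identityʳ _))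
∑-allFin-once {suc n} (suc a) g = trans (∑-allFin-suc n _)
  (trans (cong₂ _⊕_ (0⊗ (λ ())) (∑-cong (allFin n) (λ i → cong (_⊗ g (suc i)) (ind-cong Fₚ.suc-injective (cong suc)))))
    (trans (⊕-identityˡ _) (∑-allFin-once a (g ∘ suc))))

_≟ᵥ_ : ∀ {m n} (x y : Vec (Fin n) m) → Dec (x ≡ y)
_≟ᵥ_ = Vₚ.≡-dec F._≟_

∑-allVecs-once : ∀ {m n} (a : Vec (Fin n) m) (g : Vec (Fin n) m → ℤ) → ∑ (allVecs m n) (λ x → ind (x ≟ᵥ a) ⊗ g x) ≡ g a
∑-allVecs-once {zero} [] g = trans (⊕-identityʳ _) (1⊗ refl)
∑-allVecs-once {suc m} {n} (a ∷ as) g = begin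
  _ ≡⟨ ∑-allVecs-suc m n ⟩
  _ ≡⟨ ∑-cong (allFin n) (λ i → trans (∑-cong (allVecs m n) (λ x → trans (cong (_⊗ g (i ∷ x))
         (trans (ind-cong (λ e → Vₚ.∷-injectiveˡ e , Vₚ.∷-injectiveʳ e) (λ (p , q) → cong₂ _∷_ p q))
           (ind-× (i F.≟ a) (x ≟ᵥ as)))) (⊗-assoc _ _ _)))
         (trans (∑-⊗ˡ (ind (i F.≟ a)) (allVecs m n) _) (cong (ind (i F.≟ a) ⊗_) (∑-allVecs-once as (λ x → g (i ∷ x)))))) ⟩
  _ ≡⟨ ∑-allFin-once a (λ i → g (i ∷ as)) ⟩
  g (a ∷ as) ∎

-- Both sides sum f y over the pairs with y = φ x, a condition that the involution turns into x = φ
-- y.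
∑-involution : ∀ {m n} (φ : Vec (Fin n) m → Vec (Fin n) m) → (∀ x → φ (φ x) ≡ x) →
  (f : Vec (Fin n) m → ℤ) → ∑ (allVecs m n) (λ x → f (φ x)) ≡ ∑ (allVecs m n) f
∑-involution {m} {n} φ invol f = begin
  ∑ V (λ x → f (φ x)) ≡⟨ ∑-cong V (λ x → ∑-allVecs-once (φ x) f) ⟨
  ∑ V (λ x → ∑ V (λ y → ind (y ≟ᵥ φ x) ⊗ f y)) ≡⟨ ∑-swap V V _ ⟩
  ∑ V (λ y → ∑ V (λ x → ind (y ≟ᵥ φ x) ⊗ f y))
    ≡⟨ ∑-cong V (λ y → ∑-cong V (λ x → cong (_⊗ f y) (ind-cong
         (λ e → trans (sym (invol x)) (cong φ (sym e))) (λ e → trans (sym (invol y)) (cong φ (sym e)))))) ⟩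
  ∑ V (λ y → ∑ V (λ x → ind (x ≟ᵥ φ y) ⊗ f y)) ≡⟨ ∑-cong V (λ y → ∑-allVecs-once (φ y) (λ _ → f y)) ⟩
  ∑ V f ∎
  where V = allVecs m n

-- Parity of the number of cycles

cycleLens : ∀ {n} → Vec (Fin n) n → List (Fin n) → List ℕ
cycleLens w [] = []
cycleLens w (i ∷ is) = if isCycleMin w i then cycleLen w i ∷ cycleLens w is else cycleLens w is

mutual
  -- The local function of `cycleType`, recovered in the same way as `search`.
  collect : ∀ {n} → Vec (Fin n) n → List (Fin n) → List ℕ
  collect = _

  collect-named : ∀ {n} (w : Vec (Fin n) n) → cycleType w ≡ collect w (allFin n)
  collect-named {n} w with allFin n
  ... | is = refl {x = collect w is}

cycleType-cycleLens : ∀ {n} (w : Vec (Fin n) n) → cycleType w ≡ cycleLens w (allFin n)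
cycleType-cycleLens {n} w = go (allFin n)
  where
  go : ∀ is → collect w is ≡ cycleLens w is
  go [] = refl
  go (i ∷ is) = cong (λ r → if isCycleMin w i then cycleLen w i ∷ r else r) (go is)

record Swapped {n} (w w′ : Vec (Fin n) n) (u v : Fin n) : Set where
  field
    at-u : lookup w′ u ≡ lookup w v
    at-v : lookup w′ v ≡ lookup w u
    elsewhere : ∀ {x} → x ≢ u → x ≢ v → lookup w′ x ≡ lookup w x

Swapped-flip : ∀ {n} {w w′ : Vec (Fin n) n} {u v} → Swapped w w′ u v → Swapped w w′ v u
Swapped-flip s = record { at-u = at-v ; at-v = at-u ; elsewhere = λ a b → elsewhere b a }
  where open Swapped s

Swapped-sym : ∀ {n} {w w′ : Vec (Fin n) n} {u v} → Swapped w w′ u v → Swapped w′ w u v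
Swapped-sym s = record { at-u = sym at-v ; at-v = sym at-u ; elsewhere = λ a b → sym (elsewhere a b) }
  where open Swapped s

firstHit : ∀ {n} (w : Vec (Fin n) n) {x y} → Orbit w x y → ∃ λ a → iter w a x ≡ y × (∀ {s} → s < a → iter w s x ≢ y)
firstHit w {x} {y} (m , e) = go (suc m) m ℕₚ.≤-refl e
  where
  go : ∀ b m → m < b → iter w m x ≡ y → ∃ λ a → iter w a x ≡ y × (∀ {s} → s < a → iter w s x ≢ y)
  go (suc b) m (s≤s m≤b) e with ℕₚ.anyUpTo? (λ s → iter w s x F.≟ y) m
  ... | yes (s , s<m , e′) = go b s (ℕₚ.≤-trans s<m m≤b) e′
  ... | no none = m , e , λ s<m e′ → none (_ , s<m , e′)

module _ {n : ℕ} {w w′ : Vec (Fin n) n} (inj : Injectiveᵥ w) (inj′ : Injectiveᵥ w′) where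
  private
    module O = Orbits w inj
    module O′ = Orbits w′ inj′

  swap-splits : ∀ {u v} → u ≢ v → Swapped w w′ u v → Orbit w u v → ¬ Orbit w′ u v
  swap-splits {u} {v} u≢v s o o′ with firstHit w o
  ... | zero , e , _ = u≢v e
  ... | suc a , hit , earlier = let (m , e) = O′.Orbit-sym o′ in
    u∉Z (subst Z e (closed m))
    where
    open Swapped s
    -- Z is the arc of the orbit from w u to v, which w′ closes up into a cycle.
    Z : Fin n → Set
    Z z = ∃ λ i → 1 ≤ i × i ≤ suc a × iter w i u ≡ z
    -- A return to u along the arc would leave a shorter path from u to v.
    u∉Z : ¬ Z u
    u∉Z (i , 1≤i , i≤a , e) = earlier {suc a ∸ i} (ℕₚ.∸-monoʳ-< 1≤i i≤a) (trans (cong (iter w (suc a ∸ i)) (sym e))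
      (trans (sym (iter-+ w (suc a ∸ i) i u)) (trans (cong (λ k → iter w k u) (ℕₚ.m∸n+n≡m i≤a)) hit)))
    closed : ∀ m → Z (iter w′ m v)
    closed zero = suc a , s≤s z≤n , ℕₚ.≤-refl , hit
    closed (suc m) with closed m
    ... | i , 1≤i , i≤a , e with ℕₚ.m≤n⇒m<n∨m≡n i≤a
    ...   | inj₁ i<a = suc i , s≤s z≤n , i<a , trans (cong (lookup w) e)
              (sym (elsewhere (λ e′ → u∉Z (i , 1≤i , i≤a , trans e e′)) (λ e′ → earlier i<a (trans e e′))))
    ...   | inj₂ refl = 1 , s≤s z≤n , s≤s z≤n , trans (sym at-v) (cong (lookup w′) (trans (sym hit) e))

  -- Up to its first visit to v the path meets neither u nor v, the only points where w and w′
  -- differ.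
  reach : ∀ {u v} → Swapped w w′ u v → ∀ b x → iter w b x ≡ v → ¬ Orbit w x u → Orbit w′ x v
  reach {u} {v} s zero x e _ = 0 , e
  reach {u} {v} s (suc b) x e x≁u with x F.≟ v
  ... | yes refl = Orbit-refl
  ... | no x≢v = Orbit-trans (1 , Swapped.elsewhere s (λ { refl → x≁u Orbit-refl }) x≢v)
          (reach s b (lookup w x) (trans (sym (iter-suc w b x)) e) (λ o → x≁u (Orbit-trans Orbit-step o)))

  -- When u and v lie on different cycles of w, these become one cycle of w′ and the others do not
  -- change. Exactly one cycle minimum then disappears, the larger of the two.
  module Merge {u v} (s : Swapped w w′ u v) (u≁v : ¬ Orbit w u v) where
    open Swapped s

    v≁u : ¬ Orbit w v u
    v≁u o = u≁v (O.Orbit-sym o)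

    to-v : ∀ {x} → Orbit w x v → Orbit w′ x v
    to-v {x} o = reach s (proj₁ o) x (proj₂ o) (λ o′ → u≁v (Orbit-trans (O.Orbit-sym o′) o))

    to-u : ∀ {x} → Orbit w x u → Orbit w′ x u
    to-u {x} o = reach (Swapped-flip s) (proj₁ o) x (proj₂ o) (λ o′ → v≁u (Orbit-trans (O.Orbit-sym o′) o))

    joined : Orbit w′ u v
    joined = Orbit-trans (1 , at-u) (to-v (O.Orbit-sym Orbit-step))

    Touched : Fin n → Set
    Touched x = Orbit w x u ⊎ Orbit w x v

    touched-u : ∀ {x} → Touched x → Orbit w′ x u
    touched-u (inj₁ o) = to-u o
    touched-u (inj₂ o) = Orbit-trans (to-v o) (O′.Orbit-sym joined)

    touched-step : ∀ {x} → Touched x → Touched (lookup w′ x)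
    touched-step {x} t with x F.≟ u | x F.≟ v
    ... | yes refl | _ = inj₂ (subst (λ z → Orbit w z v) (sym at-u) (O.Orbit-sym Orbit-step))
    ... | no _ | yes refl = inj₁ (subst (λ z → Orbit w z u) (sym at-v) (O.Orbit-sym Orbit-step))
    ... | no a | no b = subst Touched (sym (elsewhere a b)) ([ inj₁ ∘ back , inj₂ ∘ back ]′ t)
      where
      back : ∀ {y} → Orbit w x y → Orbit w (lookup w x) y
      back o = Orbit-trans (O.Orbit-sym Orbit-step) o

    touched-orbit : ∀ {x y} → Touched x → Orbit w′ x y → Touched y
    touched-orbit t (zero , refl) = t
    touched-orbit t (suc m , refl) = touched-step (touched-orbit t (m , refl))

    untouched-iter : ∀ {x} → ¬ Touched x → ∀ m → iter w′ m x ≡ iter w m x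
    untouched-iter nt zero = refl
    untouched-iter {x} nt (suc m) = trans (cong (lookup w′) (untouched-iter nt m))
      (elsewhere (λ e → nt (inj₁ (m , e))) (λ e → nt (inj₂ (m , e))))

    touched? : ∀ x → Dec (Touched x)
    touched? x with O.Orbit? x u | O.Orbit? x v
    ... | yes o | _ = yes (inj₁ o)
    ... | no _ | yes o = yes (inj₂ o)
    ... | no a | no b = no [ a , b ]′

    Orbit-grows : ∀ {x y} → Orbit w x y → Orbit w′ x y
    Orbit-grows {x} {y} o with touched? x
    ... | yes t = Orbit-trans (touched-u t) (O′.Orbit-sym (touched-u ([ inj₁ ∘ back , inj₂ ∘ back ]′ t)))
      where
      back : ∀ {z} → Orbit w x z → Orbit w y z
      back o′ = Orbit-trans (O.Orbit-sym o) o′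
    ... | no nt = proj₁ o , trans (untouched-iter nt (proj₁ o)) (proj₂ o)

    Least-shrinks : ∀ {x} → Least w′ x → Least w x
    Least-shrinks l y o = l y (Orbit-grows o)

    module _ (lt : toℕ (O.rep u) < toℕ (O.rep v)) where

      lost : ¬ Least w′ (O.rep v)
      lost l = ℕₚ.<⇒≱ lt (l (O.rep u) (Orbit-trans (touched-u (inj₂ (O.Orbit-sym (O.Orbit-rep v)))) (Orbit-grows (O.Orbit-rep u))))

      -- Every point of the joined cycle lies on the old cycle of u or of v, hence is at least
      -- `rep u`. A minimum other than `rep v` is either `rep u` or lies on an untouched cycle.
      kept : ∀ {x} → x ≢ O.rep v → Least w x → Least w′ x
      kept {x} x≢ l y o with O.Orbit? x u | O.Orbit? x v
      ... | yes a | _ = subst (λ z → toℕ z ≤ toℕ y) (O.rep-unique (O.Orbit-sym a) l)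
          ([ (λ b → rep-≤ b) , (λ b → ℕₚ.≤-trans (ℕₚ.<⇒≤ lt) (rep-≤ b)) ]′ (touched-orbit (inj₁ a) o))
        where
        rep-≤ : ∀ {z} → Orbit w y z → toℕ (O.rep z) ≤ toℕ y
        rep-≤ {z} b = O.Least-rep z y (O.Orbit-sym (Orbit-trans b (O.Orbit-rep z)))
      ... | no _ | yes b = contradiction (sym (O.rep-unique (O.Orbit-sym b) l)) x≢
      ... | no a | no b = l y (proj₁ o , trans (sym (untouched-iter [ a , b ]′ (proj₁ o))) (proj₂ o))

T-ext : ∀ {a b} → T a ⇔ T b → a ≡ b
T-ext {true} {true} _ = refl
T-ext {true} {false} (f , _) = ⊥-elim (f _)
T-ext {false} {true} (_ , g) = ⊥-elim (g _)
T-ext {false} {false} _ = refl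

sign-cycleLens : ∀ {n} (w : Vec (Fin n) n) i is → PowerSum.sign (cycleLens w (i ∷ is))
  ≡ (if isCycleMin w i then ⊝ PowerSum.sign (cycleLens w is) else PowerSum.sign (cycleLens w is))
sign-cycleLens w i is with isCycleMin w i
... | true = refl
... | false = refl

module _ {n} {w w′ : Vec (Fin n) n} {z : Fin n} (same : ∀ {x} → x ≢ z → isCycleMin w x ≡ isCycleMin w′ x)
  (before : isCycleMin w z ≡ true) (after : isCycleMin w′ z ≡ false) where

  sign-same : ∀ {is} → z ∉ is → PowerSum.sign (cycleLens w is) ≡ PowerSum.sign (cycleLens w′ is)
  sign-same {[]} _ = refl
  sign-same {i ∷ is} z∉ rewrite sign-cycleLens w i is | sign-cycleLens w′ i is
    | same {i} (λ e → z∉ (here (sym e))) | sign-same {is} (z∉ ∘ there) = refl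

  -- The cycle lengths may differ, but the sign depends only on their number, and this changes at z
  -- alone.
  sign-flips : ∀ {is} → Unique is → z ∈ is → PowerSum.sign (cycleLens w is) ≡ ⊝ PowerSum.sign (cycleLens w′ is)
  sign-flips {i ∷ is} (i∉ ∷ uniq) (here refl) rewrite sign-cycleLens w i is | sign-cycleLens w′ i is
    | before | after = cong ⊝_ (sign-same (λ z∈ → All.lookup i∉ z∈ refl))
  sign-flips {i ∷ is} (i∉ ∷ uniq) (there z∈) rewrite sign-cycleLens w i is | sign-cycleLens w′ i is
    | same {i} (λ e → All.lookup i∉ z∈ e) | sign-flips {is} uniq z∈ with isCycleMin w′ i
  ... | true = refl
  ... | false = refl

cycleSign : ∀ {n} → Vec (Fin n) n → ℤ
cycleSign w = PowerSum.sign (cycleType w)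

cycleSign-flips : ∀ {n} {w w′ : Vec (Fin n) n} {z} → (∀ {x} → x ≢ z → isCycleMin w x ≡ isCycleMin w′ x)
  → isCycleMin w z ≡ true → isCycleMin w′ z ≡ false → cycleSign w ≡ ⊝ cycleSign w′
cycleSign-flips {n} {w} {w′} {z} same before after = trans (cong PowerSum.sign (cycleType-cycleLens w))
  (trans (sign-flips same before after (Uniqueₚ.allFin⁺ n) (∈-allFin z))
    (cong (λ μ → ⊝ PowerSum.sign μ) (sym (cycleType-cycleLens w′))))

module _ {n} {w w′ : Vec (Fin n) n} (inj : Injectiveᵥ w) (inj′ : Injectiveᵥ w′) where
  private
    module O = Orbits w inj
    module O′ = Orbits w′ inj′

  cycleSign-merge-< : ∀ {u v} → Swapped w w′ u v → ¬ Orbit w u v → toℕ (O.rep u) < toℕ (O.rep v)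
    → cycleSign w ≡ ⊝ cycleSign w′
  cycleSign-merge-< {u} {v} s u≁v lt = cycleSign-flips
    (λ {x} x≢ → T-ext ((λ t → proj₂ (O′.isCycleMin-Least x) (M.kept lt x≢ (proj₁ (O.isCycleMin-Least x) t)))
                     , (λ t → proj₂ (O.isCycleMin-Least x) (M.Least-shrinks (proj₁ (O′.isCycleMin-Least x) t)))))
    (T-ext ((λ _ → _) , (λ _ → proj₂ (O.isCycleMin-Least (O.rep v)) (O.Least-rep v))))
    (T-ext ((λ t → M.lost lt (proj₁ (O′.isCycleMin-Least (O.rep v)) t)) , ⊥-elim))
    where module M = Merge inj inj′ s u≁v

  cycleSign-merge : ∀ {u v} → Swapped w w′ u v → ¬ Orbit w u v → cycleSign w ≡ ⊝ cycleSign w′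
  cycleSign-merge {u} {v} s u≁v with ℕₚ.<-cmp (toℕ (O.rep u)) (toℕ (O.rep v))
  ... | tri< lt _ _ = cycleSign-merge-< s u≁v lt
  ... | tri> _ _ gt = cycleSign-merge-< (Swapped-flip s) (u≁v ∘ O.Orbit-sym) gt
  ... | tri≈ _ e _ = contradiction (Orbit-trans (O.Orbit-rep u)
          (subst (λ z → Orbit w z v) (sym (Fₚ.toℕ-injective e)) (O.Orbit-sym (O.Orbit-rep v)))) u≁v

-- A transposition changes the number of cycles by one. If u and v share a cycle of w, they are
-- separated in w′, and w arises from w′ by a merge.
cycleSign-swap : ∀ {n} {w w′ : Vec (Fin n) n} {u v} → Injectiveᵥ w → Injectiveᵥ w′ → u ≢ v → Swapped w w′ u v
  → cycleSign w′ ≡ ⊝ cycleSign w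
cycleSign-swap {w = w} {w′} {u} {v} inj inj′ u≢v s with Orbits.Orbit? w inj u v
... | no u≁v = trans (sym (⊝-involutive _)) (cong ⊝_ (sym (cycleSign-merge inj inj′ s u≁v)))
... | yes o = cycleSign-merge inj′ inj (Swapped-sym s) (swap-splits inj inj′ u≢v s o)

-- Invariant colourings

lookup-ext : ∀ {A : Set} {n} {x y : Vec A n} → (∀ i → lookup x i ≡ lookup y i) → x ≡ y
lookup-ext {x = x} {y} e = trans (sym (Vₚ.tabulate∘lookup x)) (trans (Vₚ.tabulate-cong e) (Vₚ.tabulate∘lookup y))

Invariant : ∀ {n ℓ} → Vec (Fin n) n → Vec (Fin ℓ) n → Set
Invariant w d = ∀ x → lookup d (lookup w x) ≡ lookup d x

invariant? : ∀ {n ℓ} (w : Vec (Fin n) n) (d : Vec (Fin ℓ) n) → Dec (Invariant w d)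
invariant? w d = Fₚ.all? (λ x → lookup d (lookup w x) F.≟ lookup d x)

Invariant-Orbit : ∀ {n ℓ} {w : Vec (Fin n) n} (d : Vec (Fin ℓ) n) → Invariant w d
  → ∀ {x y} → Orbit w x y → lookup d y ≡ lookup d x
Invariant-Orbit d inv (zero , refl) = refl
Invariant-Orbit {w = w} d inv {x} (suc m , refl) = trans (inv (iter w m x)) (Invariant-Orbit d inv (m , refl))

opaque
  unfolding _⊕_

  pos-⊕ : ∀ a b → + (a ℕ.+ b) ≡ + a ⊕ + b
  pos-⊕ = ℤₚ.pos-+

pos-count : ∀ a t → + count a t ≡ ∑ t (λ x → ind (x ≟ a))
pos-count a [] = refl
pos-count a (x ∷ t) with x ≟ a
... | yes e = trans (cong (λ z → + length z) (filter-accept (_≟ a) {xs = t} e))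
  (trans (pos-⊕ 1 (count a t)) (cong₂ _⊕_ (sym (ind-yes e)) (pos-count a t)))
... | no ne = trans (cong (λ z → + length z) (filter-reject (_≟ a) {xs = t} ne))
  (trans (pos-count a t) (trans (sym (⊕-identityˡ _)) (cong₂ _⊕_ (sym (ind-no ne)) refl)))

pos-count-replicate : ∀ a i m → + count a (replicate m i) ≡ + m ⊗ ind (i ≟ a)
pos-count-replicate a i m with i ≟ a
... | yes e = trans (cong +_ (count-replicate m e)) (sym (trans (cong (+ m ⊗_) (ind-yes e)) (⊗-identityʳ _)))
... | no ne = trans (cong +_ (count-replicate-≢ m ne)) (sym (trans (cong (+ m ⊗_) (ind-no ne)) (⊗-zeroʳ _)))

pos-∑ : ∀ L → + L ≡ ∑ (upTo L) (λ _ → 1ℤ)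
pos-∑ zero = refl
pos-∑ (suc L) = trans (cong +_ (ℕₚ.+-comm 1 L)) (trans (pos-⊕ L 1)
  (trans (cong (_⊕ 1ℤ) (pos-∑ L)) (sym (∑-upTo L (λ _ → 1ℤ)))))

pos-count-toList : ∀ {ℓ n} a (d : Vec (Fin ℓ) n) → + count a (map toℕ (V.toList d)) ≡ ∑ (allFin n) (λ x → ind (toℕ (lookup d x) ≟ a))
pos-count-toList a d = trans (pos-count a (map toℕ (V.toList d))) (go d)
  where
  go : ∀ {n} (d : Vec (Fin _) n) → ∑ (map toℕ (V.toList d)) (λ x → ind (x ≟ a)) ≡ ∑ (allFin n) (λ x → ind (toℕ (lookup d x) ≟ a))
  go [] = refl
  go (x ∷ d) = trans (cong (ind (toℕ x ≟ a) ⊕_) (go d)) (sym (∑-allFin-suc _ (λ i → ind (toℕ (lookup (x ∷ d) i) ≟ a))))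

module _ {n : ℕ} (w : Vec (Fin n) n) {ℓ : ℕ} where

  -- The colours of the cycle minima, one for each part of the cycle type: exactly the choice of
  -- variables that makes up a term of the power sum.
  restrict : ∀ xs → (Fin n → Fin ℓ) → Vec (Fin ℓ) (length (cycleLens w xs))
  restrict [] e = []
  restrict (i ∷ is) e with isCycleMin w i
  ... | true = e i ∷ restrict is e
  ... | false = restrict is e

  restrict-cong : ∀ xs {e e′} → (∀ {x} → x ∈ xs → T (isCycleMin w x) → e x ≡ e′ x) → restrict xs e ≡ restrict xs e′
  restrict-cong [] _ = refl
  restrict-cong (i ∷ is) f with isCycleMin w i in eq
  ... | true = cong₂ _∷_ (f (here refl) (subst T (sym eq) _)) (restrict-cong is (f ∘ there))
  ... | false = restrict-cong is (f ∘ there)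

  restrict-injective : ∀ xs {e e′} → restrict xs e ≡ restrict xs e′ → ∀ {x} → x ∈ xs → T (isCycleMin w x) → e x ≡ e′ x
  restrict-injective (i ∷ is) q x∈ t with isCycleMin w i in eq
  restrict-injective (i ∷ is) q (here refl) t | true = Vₚ.∷-injectiveˡ q
  restrict-injective (i ∷ is) q (there x∈) t | true = restrict-injective is (Vₚ.∷-injectiveʳ q) x∈ t
  restrict-injective (i ∷ is) q (here refl) t | false = ⊥-elim (subst T eq t)
  restrict-injective (i ∷ is) q (there x∈) t | false = restrict-injective is q x∈ t

  pos-count-restrict : ∀ a xs e → + count a (partWord (cycleLens w xs) (restrict xs e))
    ≡ ∑ xs (λ i → ind (T? (isCycleMin w i)) ⊗ (+ cycleLen w i ⊗ ind (toℕ (e i) ≟ a)))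
  pos-count-restrict a [] e = refl
  pos-count-restrict a (i ∷ is) e with isCycleMin w i
  ... | true = trans (cong +_ (count-++ a (replicate (cycleLen w i) (toℕ (e i))) _)) (trans (pos-⊕ _ _)
    (cong₂ _⊕_ (trans (pos-count-replicate a (toℕ (e i)) (cycleLen w i)) (sym (1⊗ _))) (pos-count-restrict a is e)))
  ... | false = trans (pos-count-restrict a is e) (trans (sym (⊕-identityˡ _)) (cong₂ _⊕_ (sym (0⊗ (λ ()))) refl))

restrict-surjective : ∀ {n ℓ} (w : Vec (Fin n) n) {xs} → Unique xs → (c : Vec (Fin (suc ℓ)) (length (cycleLens w xs)))
  → ∃ λ e → restrict w xs e ≡ c
-- Points that are not cycle minima in the list need a default colour, hence the colour set
-- `Fin (suc ℓ)`.
restrict-surjective w {[]} [] [] = (λ _ → zero) , refl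
restrict-surjective w {i ∷ is} (i∉ ∷ uniq) c with isCycleMin w i
... | false = restrict-surjective w uniq c
... | true = extend c
  where
  extend : ∀ c → ∃ λ e → e i ∷ restrict w is e ≡ c
  extend (a ∷ c) with restrict-surjective w uniq c
  ... | e , q = e′ , cong₂ _∷_ at (trans (restrict-cong w is (λ x∈ _ → off x∈)) q)
    where
    e′ : _ → _
    e′ x with x F.≟ i
    ... | yes _ = a
    ... | no _ = e x
    at : e′ i ≡ a
    at with i F.≟ i
    ... | yes _ = refl
    ... | no ne = contradiction refl ne
    off : ∀ {x} → x ∈ is → e′ x ≡ e x
    off {x} x∈ with x F.≟ i
    ... | yes refl = ⊥-elim (All.lookup i∉ x∈ refl)
    ... | no _ = refl

module _ {n : ℕ} {w : Vec (Fin n) n} (inj : Injectiveᵥ w) where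
  private module O = Orbits w inj

  cycleLens-positive : ∀ xs → PowerSum.Positive (cycleLens w xs)
  cycleLens-positive [] = []
  cycleLens-positive (i ∷ is) with isCycleMin w i
  ... | true = FirstReturn.starts (O.cycleLen-spec i) ∷ cycleLens-positive is
  ... | false = cycleLens-positive is

  -- The iterates of i before the first return visit each point of its cycle once: they are
  -- distinct, and any later iterate reduces to one of them modulo L.
  cycleLen-orbit : ∀ {i} → Least w i → + cycleLen w i ≡ ∑ (allFin n) (λ x → ind (i F.≟ O.rep x))
  cycleLen-orbit {i} li = begin
    + L ≡⟨ pos-∑ L ⟩
    ∑ (upTo L) (λ _ → 1ℤ) ≡⟨ ∑-cong (upTo L) (λ m → trans (∑-allFin-once (iter w m i) (λ _ → 1ℤ)) refl) ⟨
    ∑ (upTo L) (λ m → ∑ (allFin n) (λ x → ind (x F.≟ iter w m i) ⊗ 1ℤ)) ≡⟨ ∑-swap (upTo L) (allFin n) _ ⟩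
    ∑ (allFin n) (λ x → ∑ (upTo L) (λ m → ind (x F.≟ iter w m i) ⊗ 1ℤ))
      ≡⟨ ∑-cong (allFin n) (λ x → trans (∑-cong (upTo L) (λ m → ⊗-identityʳ _)) (visits x)) ⟩
    ∑ (allFin n) (λ x → ind (i F.≟ O.rep x)) ∎
    where
    L = cycleLen w i
    open FirstReturn (O.cycleLen-spec i)
    distinct : ∀ {a b} → a < b → b < L → iter w a i ≢ iter w b i
    distinct {a} {b} a<b b<L e = first (b ∸ a) (ℕₚ.m<n⇒0<n∸m a<b) (ℕₚ.≤-<-trans (ℕₚ.m∸n≤m b a) b<L)
      (O.iter-difference (ℕₚ.<⇒≤ a<b) e)
    same-time : ∀ {a b} → a < L → b < L → iter w a i ≡ iter w b i → a ≡ b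
    same-time {a} {b} a<L b<L e with ℕₚ.<-cmp a b
    ... | tri< lt _ _ = contradiction e (distinct lt b<L)
    ... | tri≈ _ q _ = q
    ... | tri> _ _ gt = contradiction (sym e) (distinct gt a<L)
    instance
      L≢0 : ℕ.NonZero L
      L≢0 = ℕ.>-nonZero starts
    visits : ∀ x → ∑ (upTo L) (λ m → ind (x F.≟ iter w m i)) ≡ ind (i F.≟ O.rep x)
    visits x with i F.≟ O.rep x
    ... | no ne = trans (∑-zero (upTo L) (λ {m} _ → ind-no (λ e → ne (sym (O.rep-unique (O.Orbit-sym (m , sym e)) li))))) (sym (ind-no ne))
    ... | yes e with O.Orbit-sym (subst (Orbit w x) (sym e) (O.Orbit-rep x))
    ...   | k , q = trans (∑-cong∈ (upTo L) (λ {m} m∈ → ind-cong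
              (λ r → same-time (∈-upTo⁻ m∈) (m%n<n k L) (trans (sym r) (sym at)))
              (λ { refl → sym at })))
            (trans (∑-upTo-once {k % L} L (m%n<n k L)) (sym (ind-yes e)))
      where
      at : iter w (k % L) i ≡ x
      at = trans (O.iter-mod k L returns) q

  -- A cycle contributes its length to the colour of its minimum, and this is the colour of all its
  -- points.
  count-invariant : ∀ {ℓ} (d : Vec (Fin ℓ) n) → Invariant w d → ∀ a →
    count a (partWord (cycleLens w (allFin n)) (restrict w (allFin n) (lookup d))) ≡ count a (map toℕ (V.toList d))
  count-invariant d inv a = ℤₚ.+-injective (begin
    _ ≡⟨ pos-count-restrict w a (allFin n) (lookup d) ⟩
    ∑ (allFin n) (λ i → ind (T? (isCycleMin w i)) ⊗ (+ cycleLen w i ⊗ g i))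
      ≡⟨ ∑-cong (allFin n) (λ i → trans (ind-guard (λ t → cong (_⊗ g i) (cycleLen-orbit (proj₁ (O.isCycleMin-Least i) t))))
           (trans (cong (ind (T? (isCycleMin w i)) ⊗_) (sym (∑-⊗ʳ (g i) (allFin n) _)))
             (sym (∑-⊗ˡ (ind (T? (isCycleMin w i))) (allFin n) _)))) ⟩
    ∑ (allFin n) (λ i → ∑ (allFin n) (λ x → ind (T? (isCycleMin w i)) ⊗ (ind (i F.≟ O.rep x) ⊗ g i)))
      ≡⟨ ∑-swap (allFin n) (allFin n) _ ⟩
    ∑ (allFin n) (λ x → ∑ (allFin n) (λ i → ind (T? (isCycleMin w i)) ⊗ (ind (i F.≟ O.rep x) ⊗ g i)))
      ≡⟨ ∑-cong (allFin n) (λ x → trans (∑-cong (allFin n) (λ i → ⊗-swap _ _ (g i)))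
           (trans (∑-allFin-once (O.rep x) (λ i → ind (T? (isCycleMin w i)) ⊗ g i))
             (trans (1⊗ (proj₂ (O.isCycleMin-Least (O.rep x)) (O.Least-rep x)))
               (cong (λ z → ind (toℕ z ≟ a)) (Invariant-Orbit d inv (O.Orbit-rep x)))))) ⟩
    ∑ (allFin n) g ≡⟨ pos-count-toList a d ⟨
    _ ∎)
    where
    g : Fin n → ℤ
    g i = ind (toℕ (lookup d i) ≟ a)

  HasContent-cong : ∀ β {s t} → (∀ a → count a s ≡ count a t) → HasContent β s → HasContent β t
  HasContent-cong [] e _ = _
  HasContent-cong (j ∷ β) e (q , hc) = trans (sym (e (length β))) q , HasContent-cong β e hc

  -- Choosing a variable for each part of the cycle type is colouring each cycle, and the exponents
  -- become the sizes of the colour classes. `R` is the graph of this bijection.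
  coef-colourings : ∀ {ℓ} β → length β ≡ suc ℓ → PowerSum.coef (cycleType w) β ≡
    ∑ (allVecs n (suc ℓ)) (λ d → ind (invariant? w d) ⊗ ind (hasContent? β (map toℕ (V.toList d))))
  coef-colourings {ℓ} β len = begin
    PowerSum.coef (cycleType w) β ≡⟨ cong (λ μ → PowerSum.coef μ β) (cycleType-cycleLens w) ⟩
    PowerSum.coef μ β ≡⟨ partWords-coef β (cycleLens-positive (allFin n)) ⟨
    ∑ (partWords (length β) μ) G ≡⟨ cong (λ k → ∑ (partWords k μ) G) len ⟩
    ∑ (partWords (suc ℓ) μ) G ≡⟨ ∑-partWord (suc ℓ) μ G ⟨
    ∑ C (λ c → G (partWord μ c)) ≡⟨ ∑-cong C (λ c → trans (cong (_⊗ G (partWord μ c)) (once c)) (⊗-identityˡ _)) ⟨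
    ∑ C (λ c → ∑ D (λ d → R c d) ⊗ G (partWord μ c)) ≡⟨ ∑-cong C (λ c → sym (∑-⊗ʳ (G (partWord μ c)) D _)) ⟩
    ∑ C (λ c → ∑ D (λ d → R c d ⊗ G (partWord μ c))) ≡⟨ ∑-swap C D _ ⟩
    ∑ D (λ d → ∑ C (λ c → R c d ⊗ G (partWord μ c)))
      ≡⟨ ∑-cong D (λ d → trans (∑-cong C (λ c → ⊗-assoc _ _ _))
           (trans (∑-allVecs-once (restrict w (allFin n) (lookup d)) (λ c → ind (invariant? w d) ⊗ G (partWord μ c)))
             (ind-guard (λ inv → ind-cong (HasContent-cong β (count-invariant d inv))
               (HasContent-cong β (λ a → sym (count-invariant d inv a))))))) ⟩
    _ ∎
    where
    μ = cycleLens w (allFin n)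
    C = allVecs (length μ) (suc ℓ)
    D = allVecs n (suc ℓ)
    G : List ℕ → ℤ
    G t = ind (hasContent? β t)
    R : Vec (Fin (suc ℓ)) (length μ) → Vec (Fin (suc ℓ)) n → ℤ
    R c d = ind (c ≟ᵥ restrict w (allFin n) (lookup d)) ⊗ ind (invariant? w d)
    once : ∀ c → ∑ D (R c) ≡ 1ℤ
    once c with restrict-surjective w (Uniqueₚ.allFin⁺ n) c
    ... | e , q = trans (∑-cong D (λ d → trans (sym (ind-× (c ≟ᵥ restrict w (allFin n) (lookup d)) (invariant? w d)))
        (trans (ind-cong {e = d ≟ᵥ d₀} (λ (r , inv) → unique d r inv) (λ { refl → sym restricted , invariant₀ }))
          (sym (⊗-identityʳ _)))))
        (∑-allVecs-once d₀ (λ _ → 1ℤ))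
      where
      d₀ : Vec (Fin (suc ℓ)) n
      d₀ = V.tabulate (λ x → e (O.rep x))
      lookup₀ : ∀ x → lookup d₀ x ≡ e (O.rep x)
      lookup₀ = Vₚ.lookup∘tabulate (λ x → e (O.rep x))
      invariant₀ : Invariant w d₀
      invariant₀ x = trans (lookup₀ (lookup w x)) (trans (cong e (sym (O.rep-Orbit Orbit-step))) (sym (lookup₀ x)))
      restricted : restrict w (allFin n) (lookup d₀) ≡ c
      restricted = trans (restrict-cong w (allFin n) (λ {x} _ t → trans (lookup₀ x)
        (cong e (O.rep-unique Orbit-refl (proj₁ (O.isCycleMin-Least x) t))))) q
      unique : ∀ d → c ≡ restrict w (allFin n) (lookup d) → Invariant w d → d ≡ d₀
      unique d r inv = lookup-ext (λ x → trans (sym (Invariant-Orbit d inv (O.Orbit-rep x)))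
        (trans (restrict-injective w (allFin n) (trans (sym r) (sym q)) (∈-allFin (O.rep x))
          (proj₂ (O.isCycleMin-Least (O.rep x)) (O.Least-rep x))) (sym (lookup₀ x))))

-- The atomic function

mutual
  total : (n k : ℕ) (I J : Vec (Fin n) k) (α : Vec ℕ n) → List (Vec (Fin n) n) → ℕ
  total = _

  total-named : (n k : ℕ) (I J : Vec (Fin n) k) (α : Vec ℕ n) → aCoef n k I J α ≡ total n k I J α (allVecs n n)
  total-named n k I J α with allVecs n n
  ... | ws = refl {x = total n k I J α ws}

module _ {n k : ℕ} (I J : Vec (Fin n) k) where

  Admissible : Vec (Fin n) n → Set
  Admissible w = T (isPermB w ∧ mapsB w I J)

  admissible? : ∀ w → Dec (Admissible w)
  admissible? w = T? (isPermB w ∧ mapsB w I J)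

  aCoef-∑ : ∀ α → + aCoef n k I J α ≡ ∑ (allVecs n n) (λ w → ind (admissible? w) ⊗ + pCoef n (cycleType w) α)
  aCoef-∑ α = trans (cong +_ (total-named n k I J α)) (go (allVecs n n))
    where
    go : ∀ ws → + total n k I J α ws ≡ ∑ ws (λ w → ind (admissible? w) ⊗ + pCoef n (cycleType w) α)
    go [] = refl
    go (w ∷ ws) with isPermB w ∧ mapsB w I J
    ... | true = trans (pos-⊕ (pCoef n (cycleType w) α) _) (cong₂ _⊕_ (sym (1⊗ _)) (go ws))
    ... | false = trans (go ws) (trans (sym (⊕-identityˡ _)) (cong₂ _⊕_ (sym (0⊗ (λ ()))) refl))

isPermB-spec : ∀ {n} (w : Vec (Fin n) n) → T (isPermB w) ⇔ Injectiveᵥ w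
isPermB-spec {n} w =
  (λ t x y e → proj₁ T-==ᶠ (proj₁ T-if (proj₁ (T-allB (allFin n)) (proj₁ (T-allB (allFin n)) t (∈-allFin x)) (∈-allFin y))
    (proj₂ T-==ᶠ e))) ,
  (λ inj → proj₂ (T-allB (allFin n)) (λ {x} _ → proj₂ (T-allB (allFin n)) (λ {y} _ →
    proj₂ T-if (λ t → proj₂ T-==ᶠ (inj x y (proj₁ T-==ᶠ t))))))

mapsB-spec : ∀ {n k} (w : Vec (Fin n) n) (I J : Vec (Fin n) k) → T (mapsB w I J) ⇔ (∀ s → lookup w (lookup I s) ≡ lookup J s)
mapsB-spec w [] [] = (λ _ ()) , (λ _ → _)
mapsB-spec w (i ∷ I) (j ∷ J) =
  (λ t → λ { zero → proj₁ T-==ᶠ (proj₁ (proj₁ T-∧ t))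
           ; (suc s) → proj₁ (mapsB-spec w I J) (proj₂ (proj₁ (T-∧ {lookup w i ==ᶠ j}) t)) s }) ,
  (λ f → proj₂ T-∧ (proj₂ T-==ᶠ (f zero) , proj₂ (mapsB-spec w I J) (λ s → f (suc s))))

-- Cancellation under a transposition

transpose : ∀ {n} → Fin n → Fin n → Fin n → Fin n
transpose u v x with x F.≟ u | x F.≟ v
... | yes _ | _ = v
... | no _ | yes _ = u
... | no _ | no _ = x

module _ {n : ℕ} (u v : Fin n) where

  transpose-u : transpose u v u ≡ v
  transpose-u with u F.≟ u
  ... | yes _ = refl
  ... | no ne = contradiction refl ne

  transpose-v : transpose u v v ≡ u
  transpose-v with v F.≟ u | v F.≟ v
  ... | yes e | _ = e
  ... | no _ | yes _ = refl
  ... | no _ | no ne = contradiction refl ne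

  transpose-else : ∀ {x} → x ≢ u → x ≢ v → transpose u v x ≡ x
  transpose-else {x} x≢u x≢v with x F.≟ u | x F.≟ v
  ... | yes e | _ = contradiction e x≢u
  ... | no _ | yes e = contradiction e x≢v
  ... | no _ | no _ = refl

  transpose-involutive : ∀ x → transpose u v (transpose u v x) ≡ x
  transpose-involutive x with x F.≟ u | x F.≟ v
  ... | yes refl | _ = transpose-v
  ... | no _ | yes refl = transpose-u
  ... | no a | no b = transpose-else a b

swapEntries : ∀ {n} → Fin n → Fin n → Vec (Fin n) n → Vec (Fin n) n
swapEntries u v w = V.tabulate (λ x → lookup w (transpose u v x))

module _ {n : ℕ} (u v : Fin n) where

  lookup-swapEntries : ∀ w x → lookup (swapEntries u v w) x ≡ lookup w (transpose u v x)
  lookup-swapEntries w = Vₚ.lookup∘tabulate (λ x → lookup w (transpose u v x))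

  swapEntries-involutive : ∀ w → swapEntries u v (swapEntries u v w) ≡ w
  swapEntries-involutive w = lookup-ext (λ x → trans (lookup-swapEntries (swapEntries u v w) x)
    (trans (lookup-swapEntries w (transpose u v x)) (cong (lookup w) (transpose-involutive u v x))))

  swapEntries-Swapped : ∀ w → Swapped w (swapEntries u v w) u v
  swapEntries-Swapped w = record
    { at-u = trans (lookup-swapEntries w u) (cong (lookup w) (transpose-u u v))
    ; at-v = trans (lookup-swapEntries w v) (cong (lookup w) (transpose-v u v))
    ; elsewhere = λ a b → trans (lookup-swapEntries w _) (cong (lookup w) (transpose-else u v a b)) }

  swapEntries-injective : ∀ w → Injectiveᵥ w → Injectiveᵥ (swapEntries u v w)
  swapEntries-injective w inj x y e = trans (sym (transpose-involutive u v x)) (trans (cong (transpose u v)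
    (inj _ _ (trans (sym (lookup-swapEntries w x)) (trans e (lookup-swapEntries w y))))) (transpose-involutive u v y))

  swapEntries-Invariant : ∀ {ℓ} w (d : Vec (Fin ℓ) n) → lookup d u ≡ lookup d v → Invariant w d → Invariant (swapEntries u v w) d
  swapEntries-Invariant w d duv inv x = trans (cong (lookup d) (lookup-swapEntries w x)) (trans (inv (transpose u v x)) (same x))
    where
    same : ∀ x → lookup d (transpose u v x) ≡ lookup d x
    same x with x F.≟ u | x F.≟ v
    ... | yes refl | _ = sym duv
    ... | no _ | yes refl = duv
    ... | no _ | no _ = refl

opaque
  unfolding _⊕_

  self-negative : ∀ a → a ≡ ⊝ a → a ≡ 0ℤ
  self-negative (+ zero) _ = refl
  self-negative (+ suc _) ()
  self-negative -[1+ _ ] ()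

module _ {n k : ℕ} (I J : Vec (Fin n) k) where

  -- The boxes for the pigeonhole principle: each point of I has its own, so a collision must happen
  -- outside I and between points of one colour.
  place : ∀ {ℓ} → Vec (Fin ℓ) n → Fin n → Fin k ⊎ Fin ℓ
  place d x with Fₚ.any? (λ s → lookup I s F.≟ x)
  ... | yes (s , _) = inj₁ s
  ... | no _ = inj₂ (lookup d x)

  place-collision : ∀ {ℓ} (d : Vec (Fin ℓ) n) {u v} → u ≢ v → place d u ≡ place d v →
    (∀ s → lookup I s ≢ u) × (∀ s → lookup I s ≢ v) × lookup d u ≡ lookup d v
  place-collision d {u} {v} u≢v e
    with Fₚ.any? (λ s → lookup I s F.≟ u) | Fₚ.any? (λ s → lookup I s F.≟ v) | e
  ... | yes (s , p) | yes (_ , q) | refl = contradiction (trans (sym p) q) u≢v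
  ... | no a | no b | e′ = (λ s p → a (s , p)) , (λ s p → b (s , p)) , inj₂-injective e′
  ... | yes _ | no _ | ()
  ... | no _ | yes _ | ()

  monochromatic-pair : ∀ {ℓ} → k ℕ.+ ℓ < n → (d : Vec (Fin ℓ) n) →
    ∃₂ λ u v → u ≢ v × (∀ s → lookup I s ≢ u) × (∀ s → lookup I s ≢ v) × lookup d u ≡ lookup d v
  monochromatic-pair {ℓ} lt d with Fₚ.pigeonhole lt (λ x → F.join k ℓ (place d x))
  ... | u , v , u<v , e = u , v , Fₚ.<⇒≢ u<v , place-collision d (Fₚ.<⇒≢ u<v)
    (trans (sym (Fₚ.splitAt-join k ℓ (place d u))) (trans (cong (F.splitAt k) e) (Fₚ.splitAt-join k ℓ (place d v))))

  module _ {ℓ : ℕ} (d : Vec (Fin ℓ) n) {u v : Fin n} (u≢v : u ≢ v)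
    (u∉I : ∀ s → lookup I s ≢ u) (v∉I : ∀ s → lookup I s ≢ v) (duv : lookup d u ≡ lookup d v) where

    private
      φ = swapEntries u v
      f : Vec (Fin n) n → ℤ
      f w = ind (admissible? I J w) ⊗ (cycleSign w ⊗ ind (invariant? w d))

    swap-Admissible : ∀ {w} → Admissible I J w → Admissible I J (φ w)
    swap-Admissible {w} t = let (p , m) = proj₁ (T-∧ {isPermB w}) t in
      proj₂ T-∧ (proj₂ (isPermB-spec (φ w)) (swapEntries-injective u v w (proj₁ (isPermB-spec w) p)) ,
        proj₂ (mapsB-spec (φ w) I J) (λ s → trans (Swapped.elsewhere (swapEntries-Swapped u v w) (u∉I s) (v∉I s))
          (proj₁ (mapsB-spec w I J) m s)))

    -- The exchange respects w(I) = J because u and v avoid I, and the invariance of d because they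
    -- share a colour. Only the sign changes.
    swap-negates : ∀ w → f (φ w) ≡ ⊝ f w
    swap-negates w with admissible? I J w
    ... | yes t = let (p , m) = proj₁ (T-∧ {isPermB w}) t ; inj = proj₁ (isPermB-spec w) p in begin
      ind (admissible? I J (φ w)) ⊗ (cycleSign (φ w) ⊗ ind (invariant? (φ w) d)) ≡⟨ 1⊗ (swap-Admissible {w} t) ⟩
      cycleSign (φ w) ⊗ ind (invariant? (φ w) d)
        ≡⟨ cong₂ _⊗_ (cycleSign-swap inj (swapEntries-injective u v w inj) u≢v (swapEntries-Swapped u v w))
             (ind-cong (λ i → subst (λ w → Invariant w d) (swapEntries-involutive u v w) (swapEntries-Invariant u v (φ w) d duv i))
               (swapEntries-Invariant u v w d duv)) ⟩
      ⊝ cycleSign w ⊗ ind (invariant? w d) ≡⟨ ⊝-⊗ˡ _ _ ⟨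
      ⊝ (cycleSign w ⊗ ind (invariant? w d)) ≡⟨ cong ⊝_ (1⊗ t) ⟨
      ⊝ (ind (yes t) ⊗ (cycleSign w ⊗ ind (invariant? w d))) ∎
    ... | no nt = trans (0⊗ (λ t → nt (subst (Admissible I J) (swapEntries-involutive u v w) (swap-Admissible {φ w} t))))
          (sym (trans (cong ⊝_ (0⊗ nt)) ⊝-zero))

    monochromatic-cancels : ∑ (allVecs n n) f ≡ 0ℤ
    monochromatic-cancels = self-negative _ (trans (sym (∑-involution φ (swapEntries-involutive u v) f))
      (trans (∑-cong (allVecs n n) swap-negates) (∑-⊝ (allVecs n n) f)))

  -- coefficients of the atomic symmetric function, indexed by lists of exponents
  atomic : List ℕ → ℤ
  atomic γ = ∑ (allVecs n n) (λ w → ind (admissible? I J w) ⊗ PowerSum.coef (cycleType w) γ)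

  cycleType-positive : ∀ {w} → Admissible I J w → PowerSum.Positive (cycleType w)
  cycleType-positive {w} t = subst PowerSum.Positive (sym (cycleType-cycleLens w))
    (cycleLens-positive (proj₁ (isPermB-spec w) (proj₁ (proj₁ (T-∧ {isPermB w}) t))) (allFin n))

  E*-atomic : ∀ β {ℓ} → length β ≡ suc ℓ → k ℕ.+ suc ℓ < n → E* β atomic ≡ 0ℤ
  E*-atomic β {ℓ} len lt = begin
    E* β atomic ≡⟨ ∑-L (E*-linear β) (allVecs n n) _ ⟩
    ∑ (allVecs n n) (λ w → E* β (λ γ → ind (admissible? I J w) ⊗ PowerSum.coef (cycleType w) γ))
      ≡⟨ ∑-cong (allVecs n n) (λ w → trans (⊗-L (E*-linear β) (ind (admissible? I J w)) (PowerSum.coef (cycleType w)))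
           (ind-guard (λ t → trans (PowerSum.E*-powersum β (cycleType-positive {w} t)) (cong (cycleSign w ⊗_)
             (coef-colourings (proj₁ (isPermB-spec w) (proj₁ (proj₁ (T-∧ {isPermB w}) t))) β len))))) ⟩
    ∑ (allVecs n n) (λ w → ind (admissible? I J w) ⊗ (cycleSign w ⊗ ∑ D (λ d → ind (invariant? w d) ⊗ C d)))
      ≡⟨ ∑-cong (allVecs n n) (λ w → trans (cong (ind (admissible? I J w) ⊗_) (trans (sym (∑-⊗ˡ (cycleSign w) D _))
           (∑-cong D (λ d → sym (⊗-assoc (cycleSign w) (ind (invariant? w d)) (C d))))))
             (trans (sym (∑-⊗ˡ (ind (admissible? I J w)) D _)) (∑-cong D (λ d → sym (⊗-assoc _ _ (C d)))))) ⟩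
    ∑ (allVecs n n) (λ w → ∑ D (λ d → ind (admissible? I J w) ⊗ (cycleSign w ⊗ ind (invariant? w d)) ⊗ C d))
      ≡⟨ ∑-swap (allVecs n n) D _ ⟩
    ∑ D (λ d → ∑ (allVecs n n) (λ w → ind (admissible? I J w) ⊗ (cycleSign w ⊗ ind (invariant? w d)) ⊗ C d))
      ≡⟨ ∑-zero D (λ {d} _ → trans (∑-⊗ʳ (C d) (allVecs n n) _) (trans (cong (_⊗ C d) (vanish d)) (⊗-zeroˡ _))) ⟩
    0ℤ ∎
    where
    D = allVecs n (suc ℓ)
    C : Vec (Fin (suc ℓ)) n → ℤ
    C d = ind (hasContent? β (map toℕ (V.toList d)))
    vanish : ∀ d → ∑ (allVecs n n) (λ w → ind (admissible? I J w) ⊗ (cycleSign w ⊗ ind (invariant? w d))) ≡ 0ℤ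
    vanish d = let (u , v , u≢v , u∉ , v∉ , e) = monochromatic-pair lt d in monochromatic-cancels d u≢v u∉ v∉ e

-- The triangular system for the Schur coefficients

partsLE-spec : ∀ f s m {x} → x ∈ partsLE f s m → Decr x × sum x ≡ s × head₀ x ≤ m
partsLE-spec f zero m (here refl) = [] , refl , z≤n
partsLE-spec (suc f) (suc s) m x∈
  with find (∈-concatMap⁻ (λ p → map (p ∷_) (partsLE f (suc s ∸ p) p)) {map suc (upTo (suc s ⊓ m))} x∈)
... | p , p∈ , j with ∈-map⁻ suc p∈ | ∈-map⁻ (p ∷_) j
...   | i , i∈ , refl | y , y∈ , refl with partsLE-spec f (s ∸ i) (suc i) y∈
...     | d , e , le = (le ∷ d) , cong suc (trans (cong (i ℕ.+_) e) (ℕₚ.m+[n∸m]≡n (ℕₚ.≤-pred (ℕₚ.≤-trans i< (ℕₚ.m⊓n≤m (suc s) m))))) ,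
            ℕₚ.≤-trans i< (ℕₚ.m⊓n≤n (suc s) m)
  where i< = ∈-upTo⁻ i∈

-- First parts are enumerated in increasing order and the remaining parts recursively, so the list
-- of partitions is already lexicographically increasing.
partsLE-sorted : ∀ f s m → AllPairs _⋖_ (partsLE f s m)
partsLE-sorted f zero m = [] ∷ []
partsLE-sorted zero (suc s) m = []
partsLE-sorted (suc f) (suc s) m = AllPairsₚ.concat⁺
  (Allₚ.map⁺ (All.universal (λ p → AllPairsₚ.map⁺ (AllPairs.map there (partsLE-sorted f (suc s ∸ p) p))) _))
  (AllPairsₚ.map⁺ (AllPairsₚ.map⁺ (AllPairsₚ.applyUpTo⁺₁ id (suc s ⊓ m) (λ i<j _ →
    Allₚ.map⁺ (All.universal (λ _ → Allₚ.map⁺ (All.universal (λ _ → here (s≤s i<j)) _)) _)))))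

foldr-∑ : {A : Set} (f : A → ℤ) (xs : List A) → foldr _+_ (+ 0) (map f xs) ≡ ∑ xs f
foldr-∑ f [] = refl
foldr-∑ f (x ∷ xs) = trans (cong (λ z → f x + z) (foldr-∑ f xs)) (sym (⊕≡+ (f x) _))

Sign-cancel : ∀ {a u} → Schur.Sign u → a ⊗ u ≡ 0ℤ → a ≡ 0ℤ
Sign-cancel (inj₁ refl) e = trans (sym (⊗-identityʳ _)) e
Sign-cancel {a} (inj₂ refl) e = trans (sym (⊝-involutive a)) (trans (cong ⊝_ (trans (cong ⊝_ (sym (⊗-identityʳ a)))
  (trans (⊝-⊗ʳ a 1ℤ) e))) ⊝-zero)

⋖-head : ∀ {x y} → x ⋖ y → head₀ x ≤ head₀ y
⋖-head (here lt) = ℕₚ.<⇒≤ lt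
⋖-head (there _) = ℕₚ.≤-refl

-- The smallest partition of L is the only one that contributes to the equation it indexes.
triangular-solve : ∀ {n} M (b : List ℕ → ℤ) L → AllPairs _⋖_ L → (∀ {x} → x ∈ L → Decr x × sum x ≡ n) →
  (∀ {x} → x ∈ L → head₀ x < M → ∑ L (λ y → b y ⊗ E* (Schur.conj (head₀ x) x) (Schur.coef y)) ≡ 0ℤ) →
  ∀ {x} → x ∈ L → head₀ x < M → b x ≡ 0ℤ
triangular-solve M b (x ∷ L) (x⋖ ∷ sorted) ok eqs = solve
  where
  head-solved : head₀ x < M → b x ≡ 0ℤ
  head-solved lt = Sign-cancel (Schur.E*-diagonal (head₀ x) (proj₁ (ok (here refl))) ℕₚ.≤-refl) (begin
    b x ⊗ E* β (Schur.coef x) ≡⟨ ⊕-identityʳ _ ⟨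
    b x ⊗ E* β (Schur.coef x) ⊕ 0ℤ ≡⟨ cong (b x ⊗ E* β (Schur.coef x) ⊕_) (∑-zero L (λ {y} y∈ →
      trans (cong (b y ⊗_) (Schur.E*-triangular (head₀ x) (proj₁ (ok (here refl))) (proj₁ (ok (there y∈))) ℕₚ.≤-refl
        (trans (proj₂ (ok (here refl))) (sym (proj₂ (ok (there y∈))))) (All.lookup x⋖ y∈))) (⊗-zeroʳ _))) ⟨
    _ ≡⟨ eqs (here refl) lt ⟩
    0ℤ ∎)
    where β = Schur.conj (head₀ x) x
  solve : ∀ {z} → z ∈ x ∷ L → head₀ z < M → b z ≡ 0ℤ
  solve (here refl) lt = head-solved lt
  solve (there z∈) lt = triangular-solve M b L sorted (ok ∘ there)
    (λ {y} y∈ lt′ → trans (sym (⊕-identityˡ _)) (trans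
      (cong₂ _⊕_ (sym (trans (cong (_⊗ _) bx≡0) (⊗-zeroˡ _))) refl) (eqs (there y∈) lt′))) z∈ lt
    where
    -- The list increases, so the first row of x is at most that of z and also below M.
    bx≡0 = head-solved (ℕₚ.≤-<-trans (⋖-head (All.lookup x⋖ z∈)) lt)

theorem4p6 : (n k : ℕ) (I J : Vec (Fin n) k)
    → (∀ s t → lookup I s ≡ lookup I t → s ≡ t)
    → (∀ s t → lookup J s ≡ lookup J t → s ≡ t)
    → (b : List ℕ → ℤ)
    → (∀ (α : Vec ℕ n) → + aCoef n k I J α
    ≡ Data.List.foldr _+_ (+ 0) (map (λ λ' → b λ' * + sCoef n λ' α) (partitions n)))
    → ∀ λ' → λ' ∈ partitions n → partAt λ' 0 < n ∸ k → b λ' ≡ + 0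
theorem4p6 n k I J _ _ b expansion λ' λ'∈ lt =
  triangular-solve (n ∸ k) b (partitions n) (partsLE-sorted n n n) ok equations λ'∈ lt
  where
  ok : ∀ {x} → x ∈ partitions n → Decr x × sum x ≡ n
  ok x∈ = let (d , e , _) = partsLE-spec n n n x∈ in d , e

  combination : List ℕ → ℤ
  combination γ = ∑ (partitions n) (λ y → b y ⊗ Schur.coef y γ)

  -- The expansion speaks of exactly n exponents; γ is padded with zeros, which change neither side.
  same : ∀ γ → length γ ≤ n → atomic I J γ ≡ combination γ
  same γ le = begin
    atomic I J γ ≡⟨ ∑-cong (allVecs n n) (λ w → ind-guard (λ t → trans
      (sym (PowerZeros.coef-zeros γ e (cycleType-positive I J {w} t)))
      (sym (pCoef-coef n γ⁺ (cycleType-positive I J {w} t) len)))) ⟩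
    ∑ (allVecs n n) (λ w → ind (admissible? I J w) ⊗ + pCoef n (cycleType w) (exponents n γ⁺)) ≡⟨ aCoef-∑ I J _ ⟨
    + aCoef n k I J (exponents n γ⁺) ≡⟨ expansion (exponents n γ⁺) ⟩
    _ ≡⟨ foldr-∑ _ (partitions n) ⟩
    _ ≡⟨ ∑-cong∈ (partitions n) (λ {y} y∈ → trans (sym (⊗≡* (b y) _)) (cong (b y ⊗_) (trans
      (sCoef-coef n y γ⁺ (proj₁ (ok y∈)) len) (SchurZeros.coef-zeros γ e (proj₁ (ok y∈)))))) ⟩
    combination γ ∎
    where
    module PowerZeros = CoefZeros PowerSum.calculus
    module SchurZeros = CoefZeros Schur.calculus
    e = n ∸ length γ
    γ⁺ = γ ++ replicate e 0
    len : length γ⁺ ≡ n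
    len = trans (length-++ γ) (trans (cong (length γ ℕ.+_) (length-replicate e)) (ℕₚ.m+[n∸m]≡n le))

  equations : ∀ {x} → x ∈ partitions n → head₀ x < n ∸ k →
    ∑ (partitions n) (λ y → b y ⊗ E* (Schur.conj (head₀ x) x) (Schur.coef y)) ≡ 0ℤ
  equations {x} x∈ lt = begin
    _ ≡⟨ ∑-cong (partitions n) (λ y → ⊗-L (E*-linear β) (b y) (Schur.coef y)) ⟨
    _ ≡⟨ ∑-L (E*-linear β) (partitions n) _ ⟨
    E* β combination ≡⟨ E*-local β (λ γ _ le → same γ (subst (length γ ≤_) sumβ le)) ⟨
    E* β (atomic I J) ≡⟨ vanishes (head₀ x) refl ⟩
    0ℤ ∎
    where
    β = Schur.conj (head₀ x) x
    sumβ : sum β ≡ n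
    sumβ = trans (Schur.sum-conj (head₀ x) (proj₁ (ok x∈)) ℕₚ.≤-refl) (proj₂ (ok x∈))
    vanishes : ∀ h → head₀ x ≡ h → E* β (atomic I J) ≡ 0ℤ
    -- An empty first row forces n = 0, and nothing is less than 0 ∸ k.
    vanishes zero e = contradiction (subst (head₀ x <_) n∸k≡0 lt) λ ()
      where
      n∸k≡0 : n ∸ k ≡ 0
      n∸k≡0 = ℕₚ.m≤n⇒m∸n≡0 (subst (_≤ k) (trans (sym (Schur.Decr-0 (proj₁ (ok x∈)) (ℕₚ.≤-reflexive e))) (proj₂ (ok x∈))) z≤n)
    -- The truncated difference is positive, so k < n and it is a true one: λ_1 < n ∸ k becomes k +
    -- λ_1 < n.
    vanishes (suc ℓ) e = E*-atomic I J β (trans (Schur.length-conj (head₀ x) x) e)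
      (subst (k ℕ.+ suc ℓ <_) (ℕₚ.m+[n∸m]≡n (ℕₚ.<⇒≤ k<n)) (ℕₚ.+-monoʳ-< k (subst (_< n ∸ k) e lt)))
      where
      k<n : k < n
      k<n = ℕₚ.m∸n≢0⇒n<m (ℕₚ.m<n⇒n≢0 lt)
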